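{- Let $\lambda\in\Lambda^+$ and $a\in\mathcal{F}$. Then $$|\mathcal{I}_a(\lambda)|=\sum_{Z\in\mathcal{Z}}c_a(Z)\,|\mathfrak{I}_\lambda\cap Z|,$$ where for each zone $Z$, $c_a(Z)=|PB_a(\mu)|$ for any $\mu\in Z$ (this does not depend on the choice of $\mu\in Z$).
   Context: Fix $n\ge1$; type $A_n$ setting: $E=\{x\in\mathbb{R}^{n+1}:\sum x_i=0\}$ with standard inner product, $\Phi=\{\varepsilon_i-\varepsilon_j:i\ne j\}$, simple roots $\alpha_i=\varepsilon_i-\varepsilon_{i+1}$, $\Phi^+=\{\varepsilon_i-\varepsilon_j:i<j\}$, $\tilde\alpha=\varepsilon_1-\varepsilon_{n+1}$, fundamental weights $\varpi_i$ ($\langle\varpi_i,\alpha_j\rangle=\delta_{ij}$), $\Lambda=\bigoplus\mathbb{Z}\varpi_i$, root lattice $\mathbb{Z}\Phi$, $\Lambda^+=\{\lambda\in\Lambda:\langle\lambda,\alpha_i\rangle\ge0\ \forall i\}$, $C^+=\{x\in E:\langle x,\alpha_i\rangle\ge0\ \forall i\}$, dominance order $\mu\le\lambda$ iff $\lambda-\mu\in\sum\mathbb{Z}_{\ge0}\alpha_i$. $W_{\mathrm{aff}}$ generated by reflections in $H_{\alpha,k}=\{\langle x,\alpha\rangle=k\}$, $W_{\mathrm f}$ generated by $s_{\alpha_i,0}$ with longest element $w_0$; $\mathcal{A}_{\mathrm{id}}=\{x:-1<\langle x,\alpha\rangle<0\ \forall\alpha\in\Phi^+\}$, $\mathcal{A}_w=w(\mathcal{A}_{\mathrm{id}})$;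 Bruhat order $\le$ w.r.t. $S=\{s_{\alpha_i,0}\}\cup\{s_{\tilde\alpha,-1}\}$. $\Pi^+=\{x:0\le\langle x,\alpha_i\rangle\le1\}$, $\Pi^-=w_0(\Pi^+)$, $\mathcal{F}=\{a:\mathcal{A}_a\subset\Pi^-\}$; $\theta_a(\lambda)$ the unique element with $\mathcal{A}_{\theta_a(\lambda)}=\mathcal{A}_{w_0a}+\lambda$; $\mathcal{I}_a(\lambda)=\{x\in W_{\mathrm{aff}}:x\le\theta_a(\lambda)\}$; $\mu\lessdot\lambda$ denotes a covering in $(\Lambda^+,\le)$; $PB_a(\lambda)=\mathcal{I}_a(\lambda)\setminus\bigcup_{\mu\lessdot\lambda}\mathcal{I}_a(\mu)$. Zones: $Z(\boldsymbol{i})=\{\lambda\in\Lambda^+:\langle\lambda,\alpha_j\rangle=i_j\text{ if }i_j\in\{0,1\},\ \ge2\text{ if }i_j=2\}$ for $\boldsymbol{i}\in\{0,1,2\}^n$, and $\mathcal{Z}=\{Z(\boldsymbol{i})\}$ (a partition of $\Lambda^+$). $\mathsf{P}(\lambda)=\mathrm{Conv}(W_{\mathrm f}\cdot\lambda)$ and $\mathfrak{I}_\lambda=\mathsf{P}(\lambda)\cap C^+\cap(\lambda+\mathbb{Z}\Phi)$, which equals $\{\mu\in\Lambda^+:\mu\le\lambda\}$. -}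

module Defs where

open import Data.Nat as ℕ using (ℕ; zero; suc; _≤ᵇ_)
open import Data.Integer as ℤ using (ℤ; +_)
open import Data.Rational as ℚ using (ℚ; 0ℚ; 1ℚ; _/_)
open import Data.Fin as Fin using (Fin; toℕ; fromℕ; inject₁)
open import Data.Vec as Vec using (Vec; []; _∷_; lookup; tabulate)
open import Data.List as List using (List; length; map; concatMap; allFin; foldr)
open import Data.Nat.ListAction using (sum)
open import Data.List.Membership.Propositional using (_∈_)
open import Data.List.Relation.Unary.Unique.Propositional using (Unique)
open import Data.List.Relation.Binary.Sublist.Propositional using (_⊆_)
open import Data.Product using (Σ; _×_; _,_; ∃)
open import Data.Bool using (if_then_else_)
open import Data.Maybe using (Maybe; just; nothing)
open import Data.Sum using (_⊎_)
open import Relation.Nullary using (¬_)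
open import Relation.Nullary.Decidable using (⌊_⌋)
open import Relation.Binary.PropositionalEquality using (_≡_; _≢_)
open import Function.Bundles using (_⇔_)

Card : {A : Set} → (A → Set) → ℕ → Set
Card {A} P k = Σ (List A) λ xs → length xs ≡ k × Unique xs × (∀ x → (x ∈ xs) ⇔ P x)

sumℚ : (m : ℕ) → (Fin m → ℚ) → ℚ
sumℚ zero    f = 0ℚ
sumℚ (suc m) f = f Fin.zero ℚ.+ sumℚ m (λ i → f (Fin.suc i))

ℤtoℚ : ℤ → ℚ
ℤtoℚ z = z / 1

ℕtoℚ : ℕ → ℚ
ℕtoℚ k = (+ k) / 1

-- Type A_n, with N = n+1 coordinates (0-indexed: ε_0 … ε_n).
-- Points of E (over ℚ): functions Fin (suc n) → ℚ with coordinate sum 0.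

Pt : ℕ → Set
Pt n = Fin (suc n) → ℚ

InE : (n : ℕ) → Pt n → Set
InE n x = sumℚ (suc n) x ≡ 0ℚ

-- ⟨x , ε_i - ε_j⟩
pair : (n : ℕ) → Pt n → Fin (suc n) → Fin (suc n) → ℚ
pair n x i j = x i ℚ.- x j

-- ⟨x , α_s⟩ for the simple root α_s = ε_s - ε_{s+1}, s : Fin n
pairSimple : (n : ℕ) → Pt n → Fin n → ℚ
pairSimple n x s = pair n x (inject₁ s) (Fin.suc s)

-- Affine maps  x ↦ (i ↦ x (σ i) + v i)  represented by data (σ , v).
-- Elements of W_aff are such data (this representation is faithful
-- on E).

Elt : ℕ → Set
Elt n = Vec (Fin (suc n)) (suc n) × Vec ℤ (suc n)

act : (n : ℕ) → Elt n → Pt n → Pt n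
act n (σ , v) x i = x (lookup σ i) ℚ.+ ℤtoℚ (lookup v i)

_∘ₑ_ : {n : ℕ} → Elt n → Elt n → Elt n
(σ , v) ∘ₑ (τ , u) =
  tabulate (λ i → lookup τ (lookup σ i)) ,
  tabulate (λ i → lookup u (lookup σ i) ℤ.+ lookup v i)

idₑ : (n : ℕ) → Elt n
idₑ n = tabulate (λ i → i) , tabulate (λ _ → + 0)

-- the reflection s_{α,k} in H_{α,k}, α = ε_i - ε_j :
-- x ↦ x - (⟨x,α⟩ - k) α
refl : (n : ℕ) → Fin (suc n) → Fin (suc n) → ℤ → Elt n
refl n i j k =
  tabulate (λ t → if ⌊ t Fin.≟ i ⌋ then j else (if ⌊ t Fin.≟ j ⌋ then i else t)) ,
  tabulate (λ t → if ⌊ t Fin.≟ i ⌋ then k else (if ⌊ t Fin.≟ j ⌋ then ℤ.- k else + 0))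

record AffRefl (n : ℕ) : Set where
  constructor mkAR
  field
    ri rj : Fin (suc n)
    rk    : ℤ
    r≢    : ri ≢ rj

prodRefl : (n : ℕ) → List (AffRefl n) → Elt n
prodRefl n = foldr (λ r w → refl n (AffRefl.ri r) (AffRefl.rj r) (AffRefl.rk r) ∘ₑ w) (idₑ n)

InWaff : (n : ℕ) → Elt n → Set
InWaff n w = Σ (List (AffRefl n)) λ rs → prodRefl n rs ≡ w

-- Coxeter generators S, indexed by Maybe (Fin n):
--   just s  ↦ s_{α_s,0}   (α_s = ε_s - ε_{s+1}, s = 0 … n-1)
--   nothing ↦ s_{α̃,-1}   (α̃ = ε_0 - ε_n)

Gen : ℕ → Set
Gen n = Maybe (Fin n)

gen : (n : ℕ) → Gen n → Elt n
gen n (just s) = refl n (inject₁ s) (Fin.suc s) (+ 0)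
gen n nothing  = refl n Fin.zero (fromℕ n) (ℤ.- (+ 1))

evalWord : (n : ℕ) → List (Gen n) → Elt n
evalWord n = foldr (λ g w → gen n g ∘ₑ w) (idₑ n)

Reduced : (n : ℕ) → List (Gen n) → Elt n → Set
Reduced n ws y = evalWord n ws ≡ y × (∀ us → evalWord n us ≡ y → length ws ℕ.≤ length us)

-- Bruhat order w.r.t. S (subword characterisation)
_≤B_ : {n : ℕ} → Elt n → Elt n → Set
_≤B_ {n} x y = Σ (List (Gen n)) λ ws → Reduced n ws y ×
                 Σ (List (Gen n)) λ us → us ⊆ ws × evalWord n us ≡ x

InAid : (n : ℕ) → Pt n → Set
InAid n x = InE n x × (∀ i j → toℕ i ℕ.< toℕ j →
              (ℚ.- 1ℚ) ℚ.< pair n x i j × pair n x i j ℚ.< 0ℚ)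

InAlc : (n : ℕ) → Elt n → Pt n → Set
InAlc n w p = Σ (Pt n) λ q → InAid n q × (∀ i → act n w q i ≡ p i)

-- longest element of W_f (type A: reversal of coordinates), as an element
w₀ : (n : ℕ) → Elt n
w₀ n = tabulate Fin.opposite , tabulate (λ _ → + 0)

InΠ⁺ : (n : ℕ) → Pt n → Set
InΠ⁺ n x = InE n x × (∀ s → 0ℚ ℚ.≤ pairSimple n x s × pairSimple n x s ℚ.≤ 1ℚ)

InΠ⁻ : (n : ℕ) → Pt n → Set
InΠ⁻ n p = Σ (Pt n) λ q → InΠ⁺ n q × (∀ i → act n (w₀ n) q i ≡ p i)

InF : (n : ℕ) → Elt n → Set
InF n a = InWaff n a × (∀ p → InAlc n a p → InΠ⁻ n p)

-- Weights: λ = Σ_s c_s ϖ_s, represented by c : Vec ℤ n (ϖ-coordinates).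

Wt : ℕ → Set
Wt n = Vec ℤ n

-- ϖ_s in ε-coordinates: Σ_{t ≤ s} ε_t - ((s+1)/(n+1)) Σ_t ε_t
ϖ : (n : ℕ) → Fin n → Pt n
ϖ n s t = (if toℕ t ≤ᵇ toℕ s then 1ℚ else 0ℚ) ℚ.- ((+ suc (toℕ s)) / suc n)

toE : (n : ℕ) → Wt n → Pt n
toE n c t = sumℚ n (λ s → ℤtoℚ (lookup c s) ℚ.* ϖ n s t)

αs : (n : ℕ) → Fin n → Pt n
αs n s t = (if ⌊ t Fin.≟ inject₁ s ⌋ then 1ℚ else 0ℚ)
           ℚ.- (if ⌊ t Fin.≟ Fin.suc s ⌋ then 1ℚ else 0ℚ)

Dominant : (n : ℕ) → Wt n → Set
Dominant n c = ∀ s → + 0 ℤ.≤ lookup c s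

_≼_ : {n : ℕ} → Wt n → Wt n → Set
_≼_ {n} μ λ' = Σ (Vec ℕ n) λ k →
  ∀ t → toE n λ' t ℚ.- toE n μ t ≡ sumℚ n (λ s → ℕtoℚ (lookup k s) ℚ.* αs n s t)

Covers : (n : ℕ) → Wt n → Wt n → Set
Covers n μ λ' = Dominant n μ × μ ≼ λ' × μ ≢ λ' ×
  (∀ ν → Dominant n ν → μ ≼ ν → ν ≼ λ' → ν ≡ μ ⊎ ν ≡ λ')

IsTheta : (n : ℕ) → Elt n → Wt n → Elt n → Set
IsTheta n a λ' y = InWaff n y ×
  (∀ p → InAlc n y p ⇔ InAlc n (w₀ n ∘ₑ a) (λ t → p t ℚ.- toE n λ' t))

InI : (n : ℕ) → Elt n → Wt n → Elt n → Set
InI n a λ' x = Σ (Elt n) λ y → IsTheta n a λ' y × x ≤B y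

InPB : (n : ℕ) → Elt n → Wt n → Elt n → Set
InPB n a λ' x = InI n a λ' x × (∀ μ → Covers n μ λ' → ¬ InI n a μ x)

Zone : ℕ → Set
Zone n = Vec (Fin 3) n

zoneCond : Fin 3 → ℤ → Set
zoneCond Fin.zero                       z = z ≡ + 0
zoneCond (Fin.suc Fin.zero)             z = z ≡ + 1
zoneCond (Fin.suc (Fin.suc Fin.zero))   z = + 2 ℤ.≤ z

InZone : (n : ℕ) → Zone n → Wt n → Set
InZone n i c = Dominant n c × (∀ s → zoneCond (lookup i s) (lookup c s))

allZones : (n : ℕ) → List (Zone n)
allZones zero    = [] List.∷ List.[]
allZones (suc n) = concatMap (λ f → map (f ∷_) (allZones n)) (allFin 3)

zoneSum : (n : ℕ) → (Zone n → ℕ) → (Zone n → ℕ) → ℕ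
zoneSum n c m = sum (map (λ i → c i ℕ.* m i) (allZones n))

InJ : (n : ℕ) → Wt n → Wt n → Set
InJ n λ' μ = Dominant n μ × μ ≼ λ'

{-# OPTIONS --safe #-}
module Submission where

open import Defs
open import Data.Bool using (if_then_else_; true; false)
open import Data.Empty using (⊥; ⊥-elim)
open import Data.Fin as Fin using (Fin; zero; suc; toℕ; fromℕ; inject₁)
import Data.Fin.Induction as FinInd
open import Data.Fin.Permutation as Perm using (Permutation′; _⟨$⟩ʳ_; _⟨$⟩ˡ_)
import Data.Fin.Properties as Finₚ
open import Data.Fin.Properties using (fromℕ≢inject₁; inject₁-injective; opposite-involutive; toℕ-fromℕ; toℕ-fromℕ<; toℕ-injective; toℕ-inject₁; toℕ<n; toℕ≤pred[n])
open import Data.Fin.Relation.Unary.Top using (‵fromℕ; ‵inject₁) renaming (view to topView)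
open import Data.Integer.Base as ℤ using (ℤ; +_; 0ℤ; 1ℤ; _+_; _-_; _*_; -_; _≤_; _⊔_; +≤+)
open import Data.Integer.DivMod using (_/ℕ_; [n/ℕd]*d≤n; n<s[n/ℕd]*d)
import Data.Integer.Properties as ℤₚ
open import Data.Integer.Properties using (*-cancelˡ-≡; *-comm; *-distribˡ-+; *-identityʳ; *-identityˡ; *-monoˡ-≤-nonNeg; *-zeroʳ; +-assoc; +-comm; +-identityʳ; +-identityˡ; +-injective; +-inverseʳ; +-mono-≤; +-monoʳ-≤; +-monoˡ-≤; 0≤i-j⇒j≤i; 0≤i⇒+∣i∣≡i; <-irrefl; <⇒≤; <⇒≱; drop‿+≤+; i-j≡0⇒i≡j; i<j⇒suc[i]≤j; i≡j⇒i-j≡0; i≤i⊔j; i≤j⇒0≤j-i; i≤j⇒i⊔j≡j; i≤j⊔i; i≤suc[i]; i≥j⇒i⊔j≡i; neg-distrib-+; pos-*; pos-+; suc-*; suc[i]≤j⇒i<j; ≤-antisym; ≤-refl; ≤-reflexive; ≤-total; ≤-trans; ≤∧≢⇒<; ≰⇒>)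
open import Data.Integer.Tactic.RingSolver using (solve-∀)
open import Data.List as List using (List; length)
import Data.List.Membership.DecPropositional as DecMem
open import Data.List.Membership.Propositional using (_∈_; find; lose)
import Data.List.Membership.Propositional.Properties as ∈ₚ
import Data.List.Properties as Listₚ
open import Data.List.Relation.Binary.Sublist.Propositional using (_⊆_; []; _∷_; _∷ʳ_)
open import Data.List.Relation.Unary.All as All using (All)
open import Data.List.Relation.Unary.AllPairs using ([]; _∷_)
open import Data.List.Relation.Unary.Any as Any using (Any; here; there)
import Data.List.Relation.Unary.Unique.DecPropositional.Properties as DecUnique
open import Data.List.Relation.Unary.Unique.Propositional using (Unique)
import Data.List.Relation.Unary.Unique.Propositional.Properties as Uniqueₚ
open import Data.Maybe using (just; nothing)
open import Data.Nat as ℕ using (ℕ; zero; suc)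
import Data.Nat.ListAction as ℕL
import Data.Nat.Properties as ℕₚ
open import Data.Product using (Σ; _×_; _,_; ∃; proj₁; proj₂)
import Data.Product.Properties as Prodₚ
open import Data.Rational as ℚ using (ℚ; 0ℚ; 1ℚ)
import Data.Rational.Properties as ℚₚ
open import Data.Rational.Solver using (module +-*-Solver)
open import Data.Rational.Unnormalised as ℚᵘ using (mkℚᵘ; *≡*; *≤*)
import Data.Rational.Unnormalised.Properties as ℚᵘₚ
open import Data.Sum using (_⊎_; inj₁; inj₂)
open import Data.Unit using (⊤; tt)
open import Data.Vec as Vec using (Vec; []; _∷_; lookup; tabulate)
import Data.Vec.Properties as Vecₚ
open import Function.Bundles using (_⇔_; mk⇔; Equivalence)
open import Relation.Binary using (tri<; tri≈; tri>)
open import Relation.Binary.Definitions using (DecidableEquality)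
open import Relation.Binary.PropositionalEquality as ≡ using (_≡_; _≢_; sym; trans; cong; cong₂; subst; subst₂; module ≡-Reasoning)
open import Relation.Nullary using (¬_; Dec; yes; no)
open import Relation.Nullary.Decidable using (⌊_⌋; _×-dec_; ¬?)
open import Algebra.Properties.CommutativeMonoid.Sum ℤₚ.+-0-commutativeMonoid using (sum; ∑-distrib-+; ∑-comm; sum-permute) renaming (sum-cong-≗ to sum-≡; sum-replicate-zero to sum-0)

-- Write N = n + 1.  An element w = (σ , v) of W_aff is the affine permutation with
-- window t ↦ σ t + N v t, and its alcove is {t ↦ q (w t)} for q the N-periodic extension
-- of a point of A_id; the generators swap adjacent entries of the window.  As for the
-- finite symmetric group, x ≤ y in the Bruhat order iff the rank function
-- #{t ≤ k : x t ≥ j} is dominated by that of y.  If y is dominant (its window is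
-- decreasing), this says that, once the window of x is sorted decreasingly, all partial
-- sums of ⌊(x t - j)/N⌋ are bounded by those of y: every vertex of the alcove of x,
-- moved to C⁺, is below the corresponding vertex of y in the dominance order.
--
-- The window of θ_a(λ) is that of w₀ a plus N λ, so λ ↦ λ - Σ κ_s α_s lowers the s-th
-- partial sum by κ_s.  Meets in the dominance order of Λ⁺ are pointwise minima of
-- partial sums, hence I_a(μ) ∩ I_a(μ') = I_a(μ ∧ μ') and every x in I_a(λ) lies in
-- PB_a(μ) for exactly one μ ≤ λ.  If λ and λ̂ lie in the same zone, adding
-- N (λ̂ - λ) to the sorted windows maps PB_a(λ) bijectively to PB_a(λ̂): where
-- ⟨λ,α_s⟩ ≥ 2, an x in PB_a(λ) is not in I_a(λ - α_s), which forces its sorted window to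
-- have such a large gap at s that it remains decreasing.

-- Integer arithmetic, finite sums and floors

-- The transport between weights of one zone rests on testing minimality on roots. If μ < λ are
-- dominant, then μ ≤ λ - β for some positive root β = ε_p - ε_{q+1} with λ - β dominant, and
-- whether λ - β is dominant depends only on which ⟨λ,α_s⟩ are 0, 1 or at least 2. So λ and λ̂ in
-- one zone admit the same β, although the sets of dominant weights below them look different.
-- Accordingly PB_a(λ) is handled as the set of x for which λ is minimal among the dominant μ with x
-- in I_a(μ). Two obstacles shape the rest. First, λ need not lie in the root lattice, so
-- translation by λ leaves W_aff; the alcove moved by λ is matched with an element of W_aff only
-- after rotating A_id by one of its symmetries. Second, the Bruhat order is given through reduced
-- words without a length function; the exchange property is therefore proved on windows, by
-- following one inversion along a word, and reduced words exist because swapping at a descent moves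
-- the window closer to the identity.

lin : ∀ {a b p q} → p ≤ q → b - a ≡ q - p → a ≤ b
lin {a} {b} p≤q e = 0≤i-j⇒j≤i (subst (0ℤ ≤_) (sym e) (i≤j⇒0≤j-i p≤q))

lin≡ : ∀ {a b p q} → p ≡ q → a - b ≡ p - q → a ≡ b
lin≡ {a} {b} p≡q e = i-j≡0⇒i≡j a b (trans e (i≡j⇒i-j≡0 p≡q))

infixl 6 _⊕_
-- Linear arithmetic is done by certificates: the hypotheses are added up with this operator, and
-- `lin` leaves a ring identity between two differences.
_⊕_ : ∀ {a b c d} → a ≤ b → c ≤ d → a + c ≤ b + d
_⊕_ = +-mono-≤

1+a≰a : ∀ {a} → ¬ (1ℤ + a ≤ a)
1+a≰a {a} p = <-irrefl ≡.refl (suc[i]≤j⇒i<j p)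

≤⊎> : ∀ a b → a ≤ b ⊎ 1ℤ + b ≤ a
≤⊎> a b with a ℤₚ.≤? b
... | yes p = inj₁ p
... | no ¬p = inj₂ (i<j⇒suc[i]≤j (≰⇒> ¬p))

1+≤⇒≤ : ∀ {a b} → 1ℤ + a ≤ b → a ≤ b
1+≤⇒≤ {a} {b} p = ≤-trans (lin {p = 0ℤ} {q = 1ℤ} (+≤+ ℕ.z≤n) (eq a)) p
  where
  eq : ∀ a → 1ℤ + a - a ≡ 1ℤ - 0ℤ
  eq = solve-∀

≤∧≢⇒1+≤ : ∀ {a b} → a ≤ b → a ≢ b → 1ℤ + a ≤ b
≤∧≢⇒1+≤ p q = i<j⇒suc[i]≤j (≤∧≢⇒< p q)

sum-mono : ∀ {m} {f g : Fin m → ℤ} → (∀ i → f i ≤ g i) → sum f ≤ sum g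
sum-mono {zero}  h = ≤-refl
sum-mono {suc m} h = h zero ⊕ sum-mono (λ i → h (suc i))

sum-mono-≡ : ∀ {m} {f g : Fin m → ℤ} → (∀ i → f i ≤ g i) → sum g ≤ sum f → ∀ i → f i ≡ g i
sum-mono-≡ {suc m} {f} {g} h e i = ≤-antisym (h i) (go i)
  where
  eq₁ : ∀ a b s t → a - b ≡ (a + s + t) - (b + t + s)
  eq₁ = solve-∀
  eq₂ : ∀ a b s t → s - t ≡ (a + s + b) - (b + t + a)
  eq₂ = solve-∀
  go : ∀ i → g i ≤ f i
  go zero    = lin (e ⊕ sum-mono (λ i → h (suc i))) (eq₁ (f zero) (g zero) (sum (λ i → f (suc i))) (sum (λ i → g (suc i))))
  go (suc i) = ≤-reflexive (sym (sum-mono-≡ (λ i → h (suc i))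
    (lin (e ⊕ h zero) (eq₂ (f zero) (g zero) (sum (λ i → f (suc i))) (sum (λ i → g (suc i))))) i))

sum-nonneg : ∀ {m} {f : Fin m → ℤ} → (∀ i → 0ℤ ≤ f i) → 0ℤ ≤ sum f
sum-nonneg {m} {f} h = subst (_≤ sum f) (sum-0 m) (sum-mono h)

*-distribˡ-sum : ∀ {m} c (f : Fin m → ℤ) → sum (λ i → c * f i) ≡ c * sum f
*-distribˡ-sum {zero}  c f = sym (*-zeroʳ c)
*-distribˡ-sum {suc m} c f = trans (cong (λ s → c * f zero + s) (*-distribˡ-sum c (λ i → f (suc i)))) (sym (*-distribˡ-+ c _ _))

sum-neg : ∀ {m} (f : Fin m → ℤ) → sum (λ i → - f i) ≡ - sum f
sum-neg {zero}  f = ≡.refl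
sum-neg {suc m} f = trans (cong (λ s → - f zero + s) (sum-neg (λ i → f (suc i)))) (sym (neg-distrib-+ (f zero) _))

sum-sub : ∀ {m} (f g : Fin m → ℤ) → sum (λ i → f i - g i) ≡ sum f - sum g
sum-sub f g = trans (∑-distrib-+ f (λ i → - g i)) (cong (_+_ (sum f)) (sum-neg g))

sum-const : ∀ m c → sum {m} (λ _ → c) ≡ + m * c
sum-const zero    c = ≡.refl
sum-const (suc m) c = trans (cong (λ s → c + s) (sum-const m c)) (sym (suc-* (+ m) c))

module _ {m : ℕ} where

  data UpdView (i j t : Fin m) : Set where
    at-i  : t ≡ i → UpdView i j t
    at-j  : t ≢ i → t ≡ j → UpdView i j t
    other : t ≢ i → t ≢ j → UpdView i j t

  updView : ∀ i j t → UpdView i j t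
  updView i j t with t Fin.≟ i | t Fin.≟ j
  ... | yes p | _     = at-i p
  ... | no ¬p | yes q = at-j ¬p q
  ... | no ¬p | no ¬q = other ¬p ¬q

module _ {A : Set} {m : ℕ} where

  -- Has the nested conditionals of `refl`, so that the vectors of a reflection are instances of it
  -- by unfolding.
  upd : Fin m → Fin m → A → A → (Fin m → A) → Fin m → A
  upd i j a b f t = if ⌊ t Fin.≟ i ⌋ then a else (if ⌊ t Fin.≟ j ⌋ then b else f t)

  upd-i : ∀ i j {a b f} → upd i j a b f i ≡ a
  upd-i i j with i Fin.≟ i
  ... | yes _ = ≡.refl
  ... | no ¬p = ⊥-elim (¬p ≡.refl)

  upd-j : ∀ {i j a b f} → i ≢ j → upd i j a b f j ≡ b
  upd-j {i} {j} i≢j with j Fin.≟ i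
  ... | yes p = ⊥-elim (i≢j (sym p))
  ... | no _ with j Fin.≟ j
  ...   | yes _ = ≡.refl
  ...   | no ¬p = ⊥-elim (¬p ≡.refl)

  upd-other : ∀ {i j t a b f} → t ≢ i → t ≢ j → upd i j a b f t ≡ f t
  upd-other {i} {j} {t} p q with t Fin.≟ i
  ... | yes e = ⊥-elim (p e)
  ... | no _ with t Fin.≟ j
  ...   | yes e = ⊥-elim (q e)
  ...   | no _  = ≡.refl

  upd-self : ∀ i j f t → upd i j (f i) (f j) f t ≡ f t
  upd-self i j f t with t Fin.≟ i
  ... | yes ≡.refl = ≡.refl
  ... | no _ with t Fin.≟ j
  ...   | yes ≡.refl = ≡.refl
  ...   | no _  = ≡.refl

sum-single : ∀ {m} (i : Fin m) a → sum (λ t → if ⌊ t Fin.≟ i ⌋ then a else 0ℤ) ≡ a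
sum-single {suc m} zero    a = trans (cong (_+_ a) (sum-0 m)) (+-identityʳ a)
sum-single {suc m} (suc i) a = trans (+-identityˡ _) (trans (sum-≡ same) (sum-single i a))
  where
  same : ∀ t → (if ⌊ suc t Fin.≟ suc i ⌋ then a else 0ℤ) ≡ (if ⌊ t Fin.≟ i ⌋ then a else 0ℤ)
  same t with t Fin.≟ i
  ... | yes _ = ≡.refl
  ... | no _  = ≡.refl

-- Isolates the two positions moved by a reflection; the remainder is the same before and after and
-- cancels in every comparison.
sum-upd : ∀ {m} {i j : Fin m} a b (f : Fin m → ℤ) → i ≢ j →
          sum (upd i j a b f) ≡ a + b + sum (upd i j 0ℤ 0ℤ f)
sum-upd {m} {i} {j} a b f i≢j = begin
  sum (upd i j a b f)                                     ≡⟨ sum-≡ pt ⟩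
  sum (λ t → (s i a t + s j b t) + upd i j 0ℤ 0ℤ f t)     ≡⟨ ∑-distrib-+ (λ t → s i a t + s j b t) (upd i j 0ℤ 0ℤ f) ⟩
  sum (λ t → s i a t + s j b t) + sum (upd i j 0ℤ 0ℤ f)   ≡⟨ cong (_+ sum (upd i j 0ℤ 0ℤ f)) (trans (∑-distrib-+ (s i a) (s j b)) (cong₂ _+_ (sum-single i a) (sum-single j b))) ⟩
  a + b + sum (upd i j 0ℤ 0ℤ f)                           ∎
  where
  open ≡-Reasoning
  s : Fin m → ℤ → Fin m → ℤ
  s k c t = if ⌊ t Fin.≟ k ⌋ then c else 0ℤ
  e₁ : ∀ a → a ≡ a + 0ℤ + 0ℤ
  e₁ = solve-∀
  e₂ : ∀ a → a ≡ 0ℤ + a + 0ℤ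
  e₂ = solve-∀
  e₃ : ∀ a → a ≡ 0ℤ + 0ℤ + a
  e₃ = solve-∀
  pt : ∀ t → upd i j a b f t ≡ (s i a t + s j b t) + upd i j 0ℤ 0ℤ f t
  pt t with t Fin.≟ i | t Fin.≟ j
  ... | yes p | yes q = ⊥-elim (i≢j (trans (sym p) q))
  ... | yes p | no _  = e₁ a
  ... | no _  | yes _ = e₂ b
  ... | no _  | no _  = e₃ (f t)

sum-split : ∀ {m} {i j : Fin m} (f : Fin m → ℤ) → i ≢ j → sum f ≡ f i + f j + sum (upd i j 0ℤ 0ℤ f)
sum-split {i = i} {j} f i≢j = trans (sum-≡ (λ t → sym (upd-self i j f t))) (sum-upd (f i) (f j) f i≢j)

N : ℕ → ℤ
N n = + suc n

abstract

  -- Opaque: outside this block only the two division bounds are visible.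
  fl : ℕ → ℤ → ℤ
  fl n z = z /ℕ suc n

  fl-lower : ∀ {n} z → N n * fl n z ≤ z
  fl-lower {n} z = subst (_≤ z) (*-comm (fl n z) (N n)) ([n/ℕd]*d≤n z (suc n))

  fl-upper : ∀ {n} z → 1ℤ + z ≤ N n * (1ℤ + fl n z)
  fl-upper {n} z = subst (1ℤ + z ≤_) (*-comm (1ℤ + fl n z) (N n)) (i<j⇒suc[i]≤j (n<s[n/ℕd]*d z (suc n)))

module _ {n : ℕ} where

  N-mono : ∀ {a b} → a ≤ b → N n * a ≤ N n * b
  N-mono = *-monoˡ-≤-nonNeg (N n)

  fl-greatest : ∀ {m z} → N n * m ≤ z → m ≤ fl n z
  fl-greatest {m} {z} h with ≤⊎> m (fl n z)
  ... | inj₁ p = p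
  ... | inj₂ p = ⊥-elim (1+a≰a (≤-trans (fl-upper z) (≤-trans (N-mono p) h)))

  fl-mono : ∀ {z z'} → z ≤ z' → fl n z ≤ fl n z'
  fl-mono {z} p = fl-greatest (≤-trans (fl-lower z) p)

  fl-shift : ∀ z m → fl n (z + N n * m) ≡ fl n z + m
  fl-shift z m = ≤-antisym
    (lin (fl-greatest (lin (fl-lower (z + N n * m)) (e₁ (N n) m (fl n (z + N n * m)) z))) (e₂ (fl n z) (fl n (z + N n * m)) m))
    (fl-greatest (lin (fl-lower z) (e₃ (N n) (fl n z) m z)))
    where
    e₁ : ∀ N m f z → z - N * (f - m) ≡ z + N * m - N * f
    e₁ = solve-∀
    e₂ : ∀ a b m → a + m - b ≡ a - (b - m)
    e₂ = solve-∀
    e₃ : ∀ N f m z → z + N * m - N * (f + m) ≡ z - N * f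
    e₃ = solve-∀

-- Windows of affine permutations

sum-φ-upd : ∀ {m} {A : Set} {i j : Fin m} (φ : Fin m → A → ℤ) a b (x : Fin m → A) → i ≢ j →
            sum (λ t → φ t (upd i j a b x t)) ≡ φ i a + φ j b + sum (upd i j 0ℤ 0ℤ (λ t → φ t (x t)))
sum-φ-upd {i = i} {j} φ a b x i≢j = trans (sum-≡ pt) (sum-upd (φ i a) (φ j b) (λ t → φ t (x t)) i≢j)
  where
  pt : ∀ t → φ t (upd i j a b x t) ≡ upd i j (φ i a) (φ j b) (λ t → φ t (x t)) t
  pt t with t Fin.≟ i
  ... | yes ≡.refl = ≡.refl
  ... | no _ with t Fin.≟ j
  ...   | yes ≡.refl = ≡.refl
  ...   | no _  = ≡.refl

-- Stated for any reflexive transitive relation, to serve increasing and decreasing windows alike.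
chain : ∀ {n} {R : ℤ → ℤ → Set} → (∀ {a} → R a a) → (∀ {a b c} → R a b → R b c → R a c) →
        (h : Fin (suc n) → ℤ) → (∀ s → R (h (inject₁ s)) (h (suc s))) →
        ∀ {s t} → toℕ s ℕ.≤ toℕ t → R (h s) (h t)
chain rf tr h st {zero} {zero} p = rf
chain {suc n} {R} rf tr h st {zero} {suc t} p =
  tr (st zero) (chain {R = R} rf tr (λ i → h (suc i)) (λ s → st (suc s)) {zero} {t} ℕ.z≤n)
chain {suc n} {R} rf tr h st {suc s} {suc t} (ℕ.s≤s p) =
  chain {R = R} rf tr (λ i → h (suc i)) (λ s → st (suc s)) {s} {t} p

module _ {n : ℕ} where

  fl-digit : (i : Fin (suc n)) (m : ℤ) → fl n (+ toℕ i + N n * m) ≡ m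
  fl-digit i m = trans (fl-shift (+ toℕ i) m) (trans (cong (_+ m) fl0) (+-identityˡ m))
    where
    fl0 : fl n (+ toℕ i) ≡ 0ℤ
    fl0 with ≤⊎> (fl n (+ toℕ i)) 0ℤ
    ... | inj₁ p = ≤-antisym p (fl-greatest (subst (_≤ + toℕ i) (sym (*-zeroʳ (N n))) (+≤+ ℕ.z≤n)))
    ... | inj₂ p = ⊥-elim (1+a≰a (≤-trans
            (≤-trans (+≤+ (toℕ<n i)) (subst (_≤ N n * fl n (+ toℕ i)) (*-identityʳ (N n)) (N-mono {n} p)))
            (fl-lower (+ toℕ i))))

  digit-inj : ∀ {i j : Fin (suc n)} {m m'} → + toℕ i + N n * m ≡ + toℕ j + N n * m' → i ≡ j × m ≡ m'
  digit-inj {i} {j} {m} {m'} e = toℕ-injective (+-injective (lin≡ (trans e (cong (λ q → + toℕ j + N n * q) (sym m≡m'))) (eq (+ toℕ i) (+ toℕ j) (N n * m)))) , m≡m'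
    where
    m≡m' : m ≡ m'
    m≡m' = trans (sym (fl-digit i m)) (trans (cong (fl n) e) (fl-digit j m'))
    eq : ∀ a b c → a - b ≡ a + c - (b + c)
    eq = solve-∀

  digits : ∀ z → Σ (Fin (suc n)) λ i → z ≡ + toℕ i + N n * fl n z
  digits z = Fin.fromℕ< r<N , trans eq (cong (_+ (N n * fl n z)) (trans (sym ∣r∣) (cong +_ (sym (toℕ-fromℕ< r<N)))))
    where
    r : ℤ
    r = z - N n * fl n z
    e₀ : ∀ z q → z ≡ z - q + q
    e₀ = solve-∀
    e₁ : ∀ z N q → N - (1ℤ + (z - N * q)) ≡ N * (1ℤ + q) - (1ℤ + z)
    e₁ = solve-∀
    eq : z ≡ r + N n * fl n z
    eq = e₀ z (N n * fl n z)
    ∣r∣ : + ℤ.∣ r ∣ ≡ r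
    ∣r∣ = 0≤i⇒+∣i∣≡i (i≤j⇒0≤j-i (fl-lower z))
    r<N : ℤ.∣ r ∣ ℕ.< suc n
    r<N = drop‿+≤+ (subst (λ q → 1ℤ + q ≤ N n) (sym ∣r∣) (lin (fl-upper z) (e₁ z (N n) (fl n z))))

  perm : Elt n → Fin (suc n) → Fin (suc n)
  perm w t = lookup (proj₁ w) t

  shift : Elt n → Fin (suc n) → ℤ
  shift w t = lookup (proj₂ w) t

  val : Elt n → Fin (suc n) → ℤ
  val w t = + toℕ (perm w t) + N n * shift w t

  vec-ext : ∀ {A : Set} {m} {u v : Vec A m} → (∀ i → lookup u i ≡ lookup v i) → u ≡ v
  vec-ext {u = u} {v} h = trans (sym (Vecₚ.tabulate∘lookup u)) (trans (Vecₚ.tabulate-cong h) (Vecₚ.tabulate∘lookup v))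

  val-tabulate : ∀ f g t → val (tabulate f , tabulate g) t ≡ + toℕ (f t) + N n * g t
  val-tabulate f g t = cong₂ (λ i m → + toℕ i + N n * m) (Vecₚ.lookup∘tabulate f t) (Vecₚ.lookup∘tabulate g t)

  val-injective : ∀ {w w'} → (∀ t → val w t ≡ val w' t) → w ≡ w'
  val-injective {w} {w'} h = cong₂ _,_ (vec-ext (λ t → proj₁ (dg t))) (vec-ext (λ t → proj₂ (dg t)))
    where
    dg : ∀ t → perm w t ≡ perm w' t × shift w t ≡ shift w' t
    dg t = digit-inj {perm w t} {perm w' t} {shift w t} {shift w' t} (h t)

  fromVal : (Fin (suc n) → ℤ) → Elt n
  fromVal x = tabulate (λ t → proj₁ (digits (x t))) , tabulate (λ t → fl n (x t))

  val-fromVal : ∀ x t → val (fromVal x) t ≡ x t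
  val-fromVal x t = trans (val-tabulate (λ t → proj₁ (digits (x t))) (λ t → fl n (x t)) t) (sym (proj₂ (digits (x t))))

  -- The right-hand side is the periodic extension of the window of `w` at the integer `val u t`:
  -- multiplication from the left permutes positions.
  val-∘ : ∀ u w t → val (u ∘ₑ w) t ≡ val w (perm u t) + N n * shift u t
  val-∘ u w t = trans (val-tabulate (λ t → perm w (perm u t)) (λ t → shift w (perm u t) + shift u t) t)
                      (eq (+ toℕ (perm w (perm u t))) (N n) (shift w (perm u t)) (shift u t))
    where
    eq : ∀ a N b c → a + N * (b + c) ≡ a + N * b + N * c
    eq = solve-∀

  perm-∘ : ∀ u w t → perm (u ∘ₑ w) t ≡ perm w (perm u t)
  perm-∘ u w t = Vecₚ.lookup∘tabulate (λ t → perm w (perm u t)) t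

  val-id : ∀ t → val (idₑ n) t ≡ + toℕ t
  val-id t = trans (val-tabulate (λ t → t) (λ _ → 0ℤ) t)
                   (trans (cong (_+_ (+ toℕ t)) (*-zeroʳ (N n))) (+-identityʳ _))

  reflVal : (i j : Fin (suc n)) (k : ℤ) → (Fin (suc n) → ℤ) → Fin (suc n) → ℤ
  reflVal i j k x = upd i j (x j + N n * k) (x i - N n * k) x

  perm-refl : ∀ i j k t → perm (refl n i j k) t ≡ upd i j j i (λ t → t) t
  perm-refl i j k t = Vecₚ.lookup∘tabulate (upd i j j i (λ t → t)) t

  val-refl : ∀ i j k w t → val (refl n i j k ∘ₑ w) t ≡ reflVal i j k (val w) t
  val-refl i j k w t = trans (val-∘ (refl n i j k) w t)
    (trans (cong₂ (λ i m → val w i + N n * m) (perm-refl i j k t) (Vecₚ.lookup∘tabulate (upd i j k (- k) (λ _ → 0ℤ)) t)) pt)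
    where
    e₁ : ∀ a N k → a + N * (- k) ≡ a - N * k
    e₁ = solve-∀
    e₂ : ∀ a N → a + N * 0ℤ ≡ a
    e₂ = solve-∀
    pt : val w (upd i j j i (λ t → t) t) + N n * upd i j k (- k) (λ _ → 0ℤ) t ≡ reflVal i j k (val w) t
    pt with t Fin.≟ i
    ... | yes _ = ≡.refl
    ... | no _ with t Fin.≟ j
    ...   | yes _ = e₁ (val w i) (N n) k
    ...   | no _  = e₂ (val w t) (N n)

  -- Windows of the affine symmetric group: distinct residues mod N and the same sum as the
  -- identity. This agrees with `InWaff` (`InWaff⇒IsAff`, `IsAff⇒InWaff`) and can be checked on a
  -- constructed window.
  record IsAff (w : Elt n) : Set where
    field
      inj : ∀ s t → perm w s ≡ perm w t → s ≡ t
      tot : sum (val w) ≡ sum {suc n} (λ t → + toℕ t)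
  open IsAff public

  isAff-id : IsAff (idₑ n)
  isAff-id .inj s t e = trans (sym (Vecₚ.lookup∘tabulate (λ i → i) s)) (trans e (Vecₚ.lookup∘tabulate (λ i → i) t))
  isAff-id .tot = sum-≡ val-id

  isAff-refl : ∀ {i j} k {w} → i ≢ j → IsAff w → IsAff (refl n i j k ∘ₑ w)
  isAff-refl {i} {j} k {w} i≢j G .inj s t e = swap-inj (inj G _ _ (trans (sym (pr s)) (trans e (pr t))))
    where
    pr : ∀ s → perm (refl n i j k ∘ₑ w) s ≡ perm w (upd i j j i (λ t → t) s)
    pr s = trans (perm-∘ (refl n i j k) w s) (cong (perm w) (perm-refl i j k s))
    swap-inj : ∀ {s t} → upd i j j i (λ t → t) s ≡ upd i j j i (λ t → t) t → s ≡ t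
    swap-inj {s} {t} with s Fin.≟ i | t Fin.≟ i
    ... | yes p | yes q = λ _ → trans p (sym q)
    swap-inj {s} {t} | yes p | no q with t Fin.≟ j
    ... | yes r = λ e → ⊥-elim (i≢j (sym e))
    ... | no r  = λ e → ⊥-elim (r (sym e))
    swap-inj {s} {t} | no q | yes p with s Fin.≟ j
    ... | yes r = λ e → ⊥-elim (i≢j e)
    ... | no r  = λ e → ⊥-elim (r e)
    swap-inj {s} {t} | no p | no q with s Fin.≟ j | t Fin.≟ j
    ... | yes a | yes b = λ _ → trans a (sym b)
    ... | yes a | no b  = λ e → ⊥-elim (q (sym e))
    ... | no a  | yes b = λ e → ⊥-elim (p e)
    ... | no a  | no b  = λ e → e
  isAff-refl {i} {j} k {w} i≢j G .tot = begin
    sum (val (refl n i j k ∘ₑ w))                                   ≡⟨ sum-≡ (val-refl i j k w) ⟩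
    sum (reflVal i j k x)                                           ≡⟨ sum-upd _ _ x i≢j ⟩
    x j + N n * k + (x i - N n * k) + sum (upd i j 0ℤ 0ℤ x)         ≡⟨ eq (x i) (x j) (N n * k) _ ⟩
    x i + x j + sum (upd i j 0ℤ 0ℤ x)                               ≡⟨ sum-split x i≢j ⟨
    sum x                                                           ≡⟨ tot G ⟩
    sum {suc n} (λ t → + toℕ t)                                             ∎
    where
    open ≡-Reasoning
    x = val w
    eq : ∀ a b c r → b + c + (a - c) + r ≡ a + b + r
    eq = solve-∀

  InWaff⇒IsAff : ∀ {w} → InWaff n w → IsAff w
  InWaff⇒IsAff (List.[] , ≡.refl) = isAff-id
  InWaff⇒IsAff (r List.∷ rs , ≡.refl) = isAff-refl (AffRefl.rk r) (AffRefl.r≢ r) (InWaff⇒IsAff (rs , ≡.refl))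

  -- Distinct positions carry distinct residues, which makes every comparison of entries in the
  -- periodic extension strict.
  val-≢ : ∀ {w s t} k → IsAff w → s ≢ t → val w s ≢ val w t + N n * k
  val-≢ {w} {s} {t} k G s≢t e = s≢t (inj G s t (proj₁ (digit-inj {m = shift w s} {shift w t + k} (trans e (eq (+ toℕ (perm w t)) (N n) (shift w t) k)))))
    where
    eq : ∀ a N b c → a + N * b + N * c ≡ a + N * (b + c)
    eq = solve-∀

-- Generators and ascending words

module _ {n : ℕ} where

  -- s_{α̃,-1} swaps the positions -1 and 0, and position -1 is position n shifted by off = - N.
  lowPos highPos : Gen n → Fin (suc n)
  lowPos (just s) = inject₁ s
  lowPos nothing  = fromℕ n
  highPos (just s) = suc s
  highPos nothing  = zero

  wrap : Gen n → ℤ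
  wrap (just _) = 0ℤ
  wrap nothing  = - 1ℤ

  off : Gen n → ℤ
  off g = N n * wrap g

  -- Adjacency in ℤ of the two swapped positions, which lets the affine generator be treated like
  -- the finite ones.
  pos-high : ∀ g → + toℕ (highPos g) ≡ 1ℤ + (+ toℕ (lowPos g)) + off g
  pos-high (just s) rewrite toℕ-inject₁ s | *-zeroʳ (N n) = cong +_ (sym (ℕₚ.+-identityʳ _))
  pos-high nothing rewrite toℕ-fromℕ n = eq (N n)
    where
    eq : ∀ N → 0ℤ ≡ N + N * (- 1ℤ)
    eq = solve-∀

  Descent Ascent : Gen n → (Fin (suc n) → ℤ) → Set
  Descent g x = 1ℤ + x (highPos g) ≤ x (lowPos g) + off g
  Ascent g x = 1ℤ + (x (lowPos g) + off g) ≤ x (highPos g)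

  swapVal : Gen n → (Fin (suc n) → ℤ) → Fin (suc n) → ℤ
  swapVal g x = upd (lowPos g) (highPos g) (x (highPos g) - off g) (x (lowPos g) + off g) x

  Descent-cong : ∀ (g : Gen n) {x y} → (∀ t → x t ≡ y t) → Descent g x → Descent g y
  Descent-cong g h = subst₂ (λ a b → 1ℤ + a ≤ b + off g) (h _) (h _)

  Ascent-cong : ∀ (g : Gen n) {x y} → (∀ t → x t ≡ y t) → Ascent g x → Ascent g y
  Ascent-cong g h = subst₂ (λ a b → 1ℤ + (a + off g) ≤ b) (h _) (h _)

  -- Monotone along the window and back to its start means constant. Applied to a window minus the
  -- identity window, and to the difference of two functions with the same pairings with all α_s.
  cyclic-monotone⇒0 : (h : Fin (suc n) → ℤ) → (∀ s → h (inject₁ s) ≤ h (suc s)) → h (fromℕ n) ≤ h zero →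
              sum h ≡ 0ℤ → ∀ t → h t ≡ 0ℤ
  cyclic-monotone⇒0 h st wr s0 t = trans (same t) h0
    where
    up : ∀ {s t} → toℕ s ℕ.≤ toℕ t → h s ≤ h t
    up = chain {R = _≤_} ≤-refl ≤-trans h st
    same : ∀ t → h t ≡ h zero
    same t = ≤-antisym (≤-trans (up (subst (toℕ t ℕ.≤_) (sym (toℕ-fromℕ n)) (toℕ≤pred[n] t))) wr) (up ℕ.z≤n)
    h0 : h zero ≡ 0ℤ
    h0 = *-cancelˡ-≡ (N n) (h zero) 0ℤ
      (trans (sym (sum-const (suc n) (h zero))) (trans (sum-≡ (λ t → sym (same t))) (trans s0 (sym (*-zeroʳ (N n))))))

module _ {n : ℕ} (1≤n : 1 ℕ.≤ n) where

  low≢high : ∀ (g : Gen n) → lowPos g ≢ highPos g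
  low≢high (just s) e = ℕₚ.1+n≢n (sym (trans (sym (toℕ-inject₁ s)) (cong toℕ e)))
  low≢high nothing  e = ℕₚ.1+n≰n (subst (1 ℕ.≤_) (trans (sym (toℕ-fromℕ n)) (cong toℕ e)) 1≤n)

  val-gen : ∀ (g : Gen n) w t → val (gen n g ∘ₑ w) t ≡ swapVal g (val w) t
  val-gen (just s) w t = trans (val-refl _ _ _ w t) (cong₂ (λ a b → upd (inject₁ s) (suc s) a b (val w) t) (e₁ (val w (suc s)) (N n)) (e₂ (val w (inject₁ s)) (N n)))
    where
    e₁ : ∀ a N → a + N * 0ℤ ≡ a - N * 0ℤ
    e₁ = solve-∀
    e₂ : ∀ a N → a - N * 0ℤ ≡ a + N * 0ℤ
    e₂ = solve-∀
  val-gen nothing w t = trans (val-refl _ _ _ w t) pt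
    where
    pt : reflVal zero (fromℕ n) (- 1ℤ) (val w) t ≡ swapVal nothing (val w) t
    pt with t Fin.≟ zero | t Fin.≟ fromℕ n
    ... | yes p | yes q = ⊥-elim (low≢high nothing (trans (sym q) p))
    ... | yes p | no q = ≡.refl
    ... | no p  | yes q = ≡.refl
    ... | no p  | no q = ≡.refl

  isAff-gen : ∀ (g : Gen n) {w} → IsAff w → IsAff (gen n g ∘ₑ w)
  isAff-gen (just s) = isAff-refl (+ 0) (low≢high (just s))
  isAff-gen nothing  = isAff-refl (- 1ℤ) (λ e → low≢high nothing (sym e))

  isAff-word : ∀ ws → IsAff (evalWord n ws)
  isAff-word List.[]       = isAff-id
  isAff-word (g List.∷ ws) = isAff-gen g (isAff-word ws)

  swapVal-low : ∀ (g : Gen n) x → swapVal g x (lowPos g) ≡ x (highPos g) - off g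
  swapVal-low g x = upd-i (lowPos g) (highPos g) {f = x}

  swapVal-high : ∀ (g : Gen n) x → swapVal g x (highPos g) ≡ x (lowPos g) + off g
  swapVal-high g x = upd-j {f = x} (low≢high g)

  swapVal-invol : ∀ (g : Gen n) x t → swapVal g (swapVal g x) t ≡ x t
  swapVal-invol g x t = trans (cong₂ (λ a b → upd (lowPos g) (highPos g) (a - off g) (b + off g) (swapVal g x) t) (swapVal-high g x) (swapVal-low g x)) pt
    where
    e₁ : ∀ a o → a + o - o ≡ a
    e₁ = solve-∀
    e₂ : ∀ a o → a - o + o ≡ a
    e₂ = solve-∀
    pt : upd (lowPos g) (highPos g) (x (lowPos g) + off g - off g) (x (highPos g) - off g + off g) (swapVal g x) t ≡ x t
    pt with t Fin.≟ lowPos g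
    ... | yes ≡.refl = e₁ _ _
    ... | no _ with t Fin.≟ highPos g
    ...   | yes ≡.refl = e₂ (x t) (off g)
    ...   | no _  = ≡.refl

  swapVal-cong : ∀ (g : Gen n) {x y} → (∀ t → x t ≡ y t) → ∀ t → swapVal g x t ≡ swapVal g y t
  swapVal-cong g h t with t Fin.≟ lowPos g
  ... | yes _ = cong (_- off g) (h _)
  ... | no _ with t Fin.≟ highPos g
  ...   | yes _ = cong (_+ off g) (h _)
  ...   | no _  = h t

  gen-invol : ∀ (g : Gen n) w → gen n g ∘ₑ (gen n g ∘ₑ w) ≡ w
  gen-invol g w = val-injective (λ t → trans (val-gen g (gen n g ∘ₑ w) t) (trans (swapVal-cong g (val-gen g w) t) (swapVal-invol g (val w) t)))

  swap-Descent : ∀ (g : Gen n) x → Descent g x → Ascent g (swapVal g x)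
  swap-Descent g x d = subst₂ (λ a b → 1ℤ + (a + off g) ≤ b) (sym (swapVal-low g x)) (sym (swapVal-high g x)) (lin d (eq (x (lowPos g)) (x (highPos g)) (off g)))
    where
    eq : ∀ l h o → l + o - (1ℤ + (h - o + o)) ≡ l + o - (1ℤ + h)
    eq = solve-∀

  swap-Ascent : ∀ (g : Gen n) x → Ascent g x → Descent g (swapVal g x)
  swap-Ascent g x d = subst₂ (λ a b → 1ℤ + a ≤ b + off g) (sym (swapVal-high g x)) (sym (swapVal-low g x)) (lin d (eq (x (lowPos g)) (x (highPos g)) (off g)))
    where
    eq : ∀ l h o → h - o + o - (1ℤ + (l + o)) ≡ h - (1ℤ + (l + o))
    eq = solve-∀

  descent⊎ascent : ∀ (g : Gen n) {w} → IsAff w → Descent g (val w) ⊎ Ascent g (val w)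
  descent⊎ascent g {w} G with ≤⊎> (val w (lowPos g) + off g) (val w (highPos g))
  ... | inj₁ p = inj₂ (≤∧≢⇒1+≤ p (λ e → val-≢ (wrap g) G (λ e → low≢high g (sym e)) (sym e)))
  ... | inj₂ p = inj₁ p

  -- Without descents consecutive entries grow by at least 1, also around the end, so `x t - t` is
  -- cyclically monotone of sum 0.
  noDescent⇒id : ∀ {w} → IsAff w → (∀ g → Ascent g (val w)) → w ≡ idₑ n
  noDescent⇒id {w} G asc = val-injective (λ t → trans (lin≡ (hz t) (e₀ (x t) (+ toℕ t))) (sym (val-id t)))
    where
    x = val w
    h : Fin (suc n) → ℤ
    h t = x t - + toℕ t
    e₀ : ∀ a b → a - b ≡ a - b - 0ℤ
    e₀ = solve-∀
    e₁ : ∀ a b p N → b - (1ℤ + p) - (a - p) ≡ b - (1ℤ + (a + N * 0ℤ))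
    e₁ = solve-∀
    st : ∀ s → h (inject₁ s) ≤ h (suc s)
    st s rewrite toℕ-inject₁ s = lin (asc (just s)) (e₁ (x (inject₁ s)) (x (suc s)) (+ toℕ s) (N n))
    e₂ : ∀ a b p → b - 0ℤ - (a - p) ≡ b - (1ℤ + (a + (1ℤ + p) * (- 1ℤ)))
    e₂ = solve-∀
    wr : h (fromℕ n) ≤ h zero
    wr rewrite toℕ-fromℕ n = lin (asc nothing) (e₂ (x (fromℕ n)) (x zero) (+ n))
    hz : ∀ t → h t ≡ 0ℤ
    hz = cyclic-monotone⇒0 h st wr (trans (sum-sub x (λ t → + toℕ t)) (i≡j⇒i-j≡0 (tot G)))

  -- Squared distance to the identity window, a termination measure in place of the length. A swap
  -- at a descent lowers it by exactly twice the height of the descent.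
  energy : (Fin (suc n) → ℤ) → ℤ
  energy x = sum (λ t → (x t - + toℕ t) * (x t - + toℕ t))

  sq-nonneg : ∀ a → 0ℤ ≤ a * a
  sq-nonneg (+ k)        = subst (0ℤ ≤_) (pos-* k k) (+≤+ ℕ.z≤n)
  sq-nonneg ℤ.-[1+ k ]   = +≤+ ℕ.z≤n

  energy-nonneg : ∀ x → 0ℤ ≤ energy x
  energy-nonneg x = sum-nonneg (λ t → sq-nonneg (x t - + toℕ t))

  energy-drop : ∀ (g : Gen n) x → Descent g x → 1ℤ + energy (swapVal g x) ≤ energy x
  energy-drop g x d = subst₂ (λ a b → 1ℤ + a ≤ b) (sym e₁) (sym e₂)
    (lin (d ⊕ d ⊕ 0≤1) (eq (x l) (x h) (+ toℕ l) (off g) (+ toℕ h) (pos-high g) rest))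
    where
    l = lowPos g
    h = highPos g
    φ : Fin (suc n) → ℤ → ℤ
    φ t a = (a - + toℕ t) * (a - + toℕ t)
    rest = sum (upd l h 0ℤ 0ℤ (λ t → φ t (x t)))
    e₁ : energy (swapVal g x) ≡ φ l (x h - off g) + φ h (x l + off g) + rest
    e₁ = sum-φ-upd φ _ _ x (low≢high g)
    e₂ : energy x ≡ φ l (x l) + φ h (x h) + rest
    e₂ = sum-split (λ t → φ t (x t)) (low≢high g)
    0≤1 : 0ℤ ≤ 1ℤ
    0≤1 = +≤+ ℕ.z≤n
    eq₀ : ∀ a b l o r →
      ((a - l) * (a - l) + (b - (1ℤ + l + o)) * (b - (1ℤ + l + o)) + r) -
      (1ℤ + (((b - o) - l) * ((b - o) - l) + ((a + o) - (1ℤ + l + o)) * ((a + o) - (1ℤ + l + o)) + r))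
      ≡ (a + o + (a + o) + 1ℤ) - (1ℤ + b + (1ℤ + b) + 0ℤ)
    eq₀ = solve-∀
    eq : ∀ a b l o h → h ≡ 1ℤ + l + o → ∀ r →
      ((a - l) * (a - l) + (b - h) * (b - h) + r) -
      (1ℤ + (((b - o) - l) * ((b - o) - l) + ((a + o) - h) * ((a + o) - h) + r))
      ≡ (a + o + (a + o) + 1ℤ) - (1ℤ + b + (1ℤ + b) + 0ℤ)
    eq a b l o h ≡.refl r = eq₀ a b l o r

  -- Each letter is prepended at an ascent, hence adds an inversion. These are the reduced words
  -- (`AscWord⇒minimal`, `minimal⇒AscWord`), described by a condition on one letter at a time.
  AscWord : List (Gen n) → Set
  AscWord List.[]       = ⊤
  AscWord (g List.∷ ws) = AscWord ws × Ascent g (val (evalWord n ws))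

  ascents? : ∀ {w} → IsAff w → (Σ (Gen n) λ g → Descent g (val w)) ⊎ (∀ g → Ascent g (val w))
  ascents? {w} G with descent⊎ascent nothing G | Finₚ.any? (λ s → ℤₚ._≤?_ (1ℤ + val w (highPos (just s))) (val w (lowPos (just s)) + off {n} (just s)))
  ... | inj₁ d | _           = inj₁ (nothing , d)
  ... | inj₂ a | yes (s , d) = inj₁ (just s , d)
  ... | inj₂ a | no ¬d       = inj₂ λ { nothing → a ; (just s) → case s (descent⊎ascent (just s) G) }
    where
    case : ∀ s → Descent (just s) (val w) ⊎ Ascent (just s) (val w) → Ascent (just s) (val w)
    case s (inj₁ d) = ⊥-elim (¬d (s , d))
    case s (inj₂ a) = a

  ascWord : ∀ w → IsAff w → Σ (List (Gen n)) λ ws → AscWord ws × evalWord n ws ≡ w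
  ascWord w G = go ℤ.∣ energy (val w) ∣ w G (≤-reflexive (sym (0≤i⇒+∣i∣≡i (energy-nonneg (val w)))))
    where
    go : ∀ k w → IsAff w → energy (val w) ≤ + k → Σ (List (Gen n)) λ ws → AscWord ws × evalWord n ws ≡ w
    go k w G b with ascents? G
    go k w G b | inj₂ a = List.[] , tt , sym (noDescent⇒id G a)
    go k w G b | inj₁ (g , d) = step k b
      where
      w' = gen n g ∘ₑ w
      drop : 1ℤ + energy (val w') ≤ energy (val w)
      drop = subst (λ e → 1ℤ + e ≤ energy (val w)) (sym (sum-≡ (λ t → cong (λ a → (a - + toℕ t) * (a - + toℕ t)) (val-gen g w t)))) (energy-drop g (val w) d)
      step : ∀ k → energy (val w) ≤ + k → Σ (List (Gen n)) λ ws → AscWord ws × evalWord n ws ≡ w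
      step zero b = ⊥-elim (1+a≰a (≤-trans (≤-trans drop b) (energy-nonneg (val w'))))
      step (suc k) b = extend (go k w' (isAff-gen g G) (lin (≤-trans drop b) (e (+ k) (energy (val w')))))
        where
        e : ∀ k a → k - a ≡ 1ℤ + k - (1ℤ + a)
        e = solve-∀
        extend : (Σ (List (Gen n)) λ ws → AscWord ws × evalWord n ws ≡ w') → Σ (List (Gen n)) λ ws → AscWord ws × evalWord n ws ≡ w
        extend (ws , asc , ev) = g List.∷ ws ,
            (asc , subst (λ v → Ascent g (val v)) (sym ev) (Ascent-cong g (λ t → sym (val-gen g w t)) (swap-Descent g (val w) d))) ,
            trans (cong (gen n g ∘ₑ_) ev) (gen-invol g w)

-- The exchange property

module _ {n : ℕ} (1≤n : 1 ℕ.≤ n) where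

  perm-gen-inj : ∀ (g : Gen n) s t → perm (gen n g) s ≡ perm (gen n g) t → s ≡ t
  perm-gen-inj g s t e = inj (isAff-gen 1≤n g isAff-id) s t (trans (pe s) (trans e (sym (pe t))))
    where
    pe : ∀ t → perm (gen n g ∘ₑ idₑ n) t ≡ perm (gen n g) t
    pe t = trans (perm-∘ (gen n g) (idₑ n) t) (Vecₚ.lookup∘tabulate (λ i → i) (perm (gen n g) t))

  data GenView (g : Gen n) (t : Fin (suc n)) : Set where
    isLow  : t ≡ lowPos g → val (gen n g) t ≡ 1ℤ + + toℕ t → GenView g t
    isHigh : 1ℤ + val (gen n g) t ≡ + toℕ t → GenView g t
    fixed  : val (gen n g) t ≡ + toℕ t → GenView g t

  genView : ∀ g t → GenView g t
  genView g t = view (updView (lowPos g) (highPos g) t)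
    where
    P : Fin (suc n) → ℤ
    P t = + toℕ t
    vg : val (gen n g) t ≡ swapVal g P t
    vg = trans (trans (cong (_+ (N n * shift (gen n g) t)) (sym (val-id (perm (gen n g) t)))) (sym (val-∘ (gen n g) (idₑ n) t)))
               (trans (val-gen 1≤n g (idₑ n) t) (swapVal-cong 1≤n g val-id t))
    e₁ : ∀ h l o → h ≡ 1ℤ + l + o → h - o ≡ 1ℤ + l
    e₁ h l o ≡.refl = e l o
      where
      e : ∀ l o → 1ℤ + l + o - o ≡ 1ℤ + l
      e = solve-∀
    e₂ : ∀ l o → 1ℤ + (l + o) ≡ 1ℤ + l + o
    e₂ = solve-∀
    view : UpdView (lowPos g) (highPos g) t → GenView g t
    view (at-i ≡.refl) = isLow ≡.refl (trans vg (trans (swapVal-low 1≤n g P) (e₁ (P (highPos g)) (P (lowPos g)) (off g) (pos-high g))))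
    view (at-j _ ≡.refl) = isHigh (trans (cong (_+_ 1ℤ) (trans vg (swapVal-high 1≤n g P))) (trans (e₂ (P (lowPos g)) (off g)) (sym (pos-high g))))
    view (other p q) = fixed (trans vg (upd-other {f = P} p q))

  pos-low : ∀ (g : Gen n) → 1ℤ + + toℕ (lowPos g) ≡ + toℕ (highPos g) + N n * (- wrap g)
  pos-low g = sym (trans (cong (_+ (N n * (- wrap g))) (pos-high g)) (eq (+ toℕ (lowPos g)) (N n) (wrap g)))
    where
    eq : ∀ l N w → 1ℤ + l + N * w + N * (- w) ≡ 1ℤ + l
    eq = solve-∀

  gen≡refl : ∀ (g : Gen n) w → refl n (lowPos g) (highPos g) (- wrap g) ∘ₑ w ≡ gen n g ∘ₑ w
  gen≡refl g w = val-injective λ t → trans (val-refl (lowPos g) (highPos g) (- wrap g) w t) (trans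
    (cong₂ (λ a b → upd (lowPos g) (highPos g) a b (val w) t) (e₁ (val w (highPos g)) (N n) (wrap g)) (e₂ (val w (lowPos g)) (N n) (wrap g)))
    (sym (val-gen 1≤n g w t)))
    where
    e₁ : ∀ a N k → a + N * (- k) ≡ a - N * k
    e₁ = solve-∀
    e₂ : ∀ a N k → a - N * (- k) ≡ a + N * k
    e₂ = solve-∀

  -- Conjugation by `u` carries the reflection exchanging the positions i and j + N k to the one
  -- exchanging their images under `u`; the third index is the difference of the periods of these
  -- images.
  refl-conj : ∀ (u : Elt n) → (∀ s t → perm u s ≡ perm u t → s ≡ t) → ∀ {i j} k w → i ≢ j →
    u ∘ₑ (refl n (perm u i) (perm u j) (k + shift u j - shift u i) ∘ₑ w) ≡ refl n i j k ∘ₑ (u ∘ₑ w)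
  refl-conj u u-inj {i} {j} k w i≢j = val-injective λ t → trans (val-∘ u (refl n (perm u i) (perm u j) k₁ ∘ₑ w) t) (trans (cong (_+ (N n * shift u t)) (val-refl (perm u i) (perm u j) k₁ w (perm u t)))
      (trans (pt (updView i j t)) (sym (val-refl i j k (u ∘ₑ w) t))))
    where
    X = val w
    Y = val (u ∘ₑ w)
    k₁ = k + shift u j - shift u i
    e₁ : ∀ x N k a b → x + N * (k + a - b) + N * b ≡ x + N * a + N * k
    e₁ = solve-∀
    e₂ : ∀ x N k a b → x - N * (k + a - b) + N * a ≡ x + N * b - N * k
    e₂ = solve-∀
    pt : ∀ {t} → UpdView i j t → reflVal (perm u i) (perm u j) k₁ X (perm u t) + N n * shift u t ≡ reflVal i j k Y t
    pt (at-i ≡.refl) = trans (cong (_+ (N n * shift u i)) (upd-i (perm u i) (perm u j) {f = X}))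
      (trans (e₁ (X (perm u j)) (N n) k (shift u j) (shift u i)) (trans (cong (_+ (N n * k)) (sym (val-∘ u w j))) (sym (upd-i i j {f = Y}))))
    pt (at-j _ ≡.refl) = trans (cong (_+ (N n * shift u j)) (upd-j {f = X} (λ e → i≢j (u-inj _ _ e))))
      (trans (e₂ (X (perm u i)) (N n) k (shift u j) (shift u i)) (trans (cong (_- (N n * k)) (sym (val-∘ u w i))) (sym (upd-j {f = Y} i≢j))))
    pt {t} (other p q) = trans (cong (_+ (N n * shift u t)) (upd-other {f = X} (λ e → p (u-inj _ _ e)) (λ e → q (u-inj _ _ e))))
      (trans (sym (val-∘ u w t)) (sym (upd-other {f = Y} p q)))

  -- A generator moves every position by at most 1, so reversing i < j + N k forces j + N k = i + 1.
  -- This is the fact that a simple reflection makes only one positive root negative.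
  gen-inverts : ∀ (g : Gen n) i j k → i ≢ j → 1ℤ + + toℕ i ≤ + toℕ j + N n * k →
                val (gen n g) j + N n * k ≤ val (gen n g) i → i ≡ lowPos g × j ≡ highPos g × k ≡ - wrap g
  gen-inverts g i j k i≢j lt ge = go (genView g i)
    where
    γ = gen n g
    a = + toℕ i
    b = + toℕ j + N n * k
    ne : 1ℤ + (val γ j + N n * k) ≤ val γ i
    ne = ≤∧≢⇒1+≤ ge (λ e → i≢j (perm-gen-inj g i j (sym (proj₁ (digit-inj {m = shift γ j + k} {shift γ i} (trans (eq (+ toℕ (perm γ j)) (N n) (shift γ j) k) e))))))
      where
      eq : ∀ a N s k → a + N * (s + k) ≡ a + N * s + N * k
      eq = solve-∀
    low-bound : + toℕ j ≤ 1ℤ + val γ j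
    low-bound = lb (genView g j)
      where
      e' : ∀ a → 1ℤ + (1ℤ + a) - a ≡ + 2 - 0ℤ
      e' = solve-∀
      lb : GenView g j → + toℕ j ≤ 1ℤ + val γ j
      lb (isLow _ e) = subst (λ v → + toℕ j ≤ 1ℤ + v) (sym e) (lin {p = 0ℤ} {q = + 2} (+≤+ ℕ.z≤n) (e' (+ toℕ j)))
      lb (isHigh e) = ≤-reflexive (sym e)
      lb (fixed e) = subst (λ v → + toℕ j ≤ 1ℤ + v) (sym e) (i≤suc[i] (+ toℕ j))
    b≤ : b ≤ val γ i
    b≤ = lin (low-bound ⊕ ne) (eq (+ toℕ j) (N n * k) (val γ j) (val γ i))
      where
      eq : ∀ a k v w → w - (a + k) ≡ 1ℤ + v + w - (a + (1ℤ + (v + k)))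
      eq = solve-∀
    go : GenView g i → i ≡ lowPos g × j ≡ highPos g × k ≡ - wrap g
    go (isHigh e) = ⊥-elim (1+a≰a (≤-trans lt (≤-trans b≤ (1+≤⇒≤ (≤-reflexive e)))))
    go (fixed e) = ⊥-elim (1+a≰a (≤-trans lt (≤-trans b≤ (≤-reflexive e))))
    go (isLow p e) = p , digit-inj {m = k} { - wrap g} (trans b≡ (trans (cong (λ i → 1ℤ + + toℕ i) p) (pos-low g)))
      where
      b≡ : b ≡ 1ℤ + + toℕ i
      b≡ = ≤-antisym (subst (b ≤_) e b≤) lt

  -- The strong exchange property. The inverted pair i < j + N k is followed through the word; the
  -- identity does not invert it, so some letter does, and deleting that letter amounts to
  -- multiplying by the reflection.
  exchange : ∀ (ws : List (Gen n)) i j k → i ≢ j → 1ℤ + + toℕ i ≤ + toℕ j + N n * k →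
             1ℤ + (val (evalWord n ws) j + N n * k) ≤ val (evalWord n ws) i →
             Σ (List (Gen n)) λ us → suc (length us) ≡ length ws × evalWord n us ≡ refl n i j k ∘ₑ evalWord n ws
  exchange List.[] i j k i≢j lt gt = ⊥-elim (1+a≰a (≤-trans gt' (1+≤⇒≤ lt)))
    where
    gt' : 1ℤ + (+ toℕ j + N n * k) ≤ + toℕ i
    gt' = subst₂ (λ a b → 1ℤ + (a + N n * k) ≤ b) (val-id j) (val-id i) gt
  exchange (g List.∷ ws) i j k i≢j lt gt = go (≤⊎> (+ toℕ j₁ + N n * k₁) (+ toℕ i₁))
    where
    γ = gen n g
    w = evalWord n ws
    i₁ = perm γ i
    j₁ = perm γ j
    k₁ = k + shift γ j - shift γ i
    gt₁ : 1ℤ + (val w j₁ + N n * k₁) ≤ val w i₁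
    gt₁ = lin (subst₂ (λ a b → 1ℤ + (a + N n * k) ≤ b) (val-∘ γ w j) (val-∘ γ w i) gt) (eq (val w i₁) (val w j₁) (N n) k (shift γ j) (shift γ i))
      where
      eq : ∀ x y N k a b → x - (1ℤ + (y + N * (k + a - b))) ≡ x + N * b - (1ℤ + (y + N * a + N * k))
      eq = solve-∀
    go : + toℕ j₁ + N n * k₁ ≤ + toℕ i₁ ⊎ 1ℤ + + toℕ i₁ ≤ + toℕ j₁ + N n * k₁ →
         Σ (List (Gen n)) λ us → suc (length us) ≡ suc (length ws) × evalWord n us ≡ refl n i j k ∘ₑ (γ ∘ₑ w)
    -- The pair is reversed by `g` itself, so `g` is the reflection and is the letter to delete.
    go (inj₁ ge) = delete (gen-inverts g i j k i≢j lt (lin ge (eq (+ toℕ i₁) (+ toℕ j₁) (N n) k (shift γ j) (shift γ i))))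
      where
      eq : ∀ x y N k a b → x + N * b - (y + N * a + N * k) ≡ x - (y + N * (k + a - b))
      eq = solve-∀
      delete : i ≡ lowPos g × j ≡ highPos g × k ≡ - wrap g → _
      delete (≡.refl , ≡.refl , ≡.refl) = ws , ≡.refl , sym (trans (gen≡refl g (γ ∘ₑ w)) (gen-invol 1≤n g w))
    -- The image of the pair under `g` is still in order, so the inversion comes from a letter of
    -- `ws`.
    go (inj₂ lt₁) = keep (exchange ws i₁ j₁ k₁ (λ e → i≢j (perm-gen-inj g i j e)) lt₁ gt₁)
      where
      keep : (Σ (List (Gen n)) λ us → suc (length us) ≡ length ws × evalWord n us ≡ refl n i₁ j₁ k₁ ∘ₑ w) → _
      keep (us , l , e) = g List.∷ us , cong suc l , trans (cong (γ ∘ₑ_) e) (refl-conj γ (perm-gen-inj g) k w i≢j)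

  exchange-descent : ∀ (ws : List (Gen n)) g → Descent g (val (evalWord n ws)) →
    Σ (List (Gen n)) λ us → suc (length us) ≡ length ws × evalWord n us ≡ gen n g ∘ₑ evalWord n ws
  exchange-descent ws g d = finish (exchange ws (lowPos g) (highPos g) (- wrap g) (low≢high 1≤n g)
      (≤-reflexive (pos-low g))
      (lin d (e₂ (val (evalWord n ws) (lowPos g)) (val (evalWord n ws) (highPos g)) (N n) (wrap g))))
    where
    e₂ : ∀ l h N w → l - (1ℤ + (h + N * (- w))) ≡ l + N * w - (1ℤ + h)
    e₂ = solve-∀
    finish : (Σ (List (Gen n)) λ us → suc (length us) ≡ length ws × evalWord n us ≡ refl n (lowPos g) (highPos g) (- wrap g) ∘ₑ evalWord n ws) → _
    finish (us , l , e) = us , l , trans e (gen≡refl g (evalWord n ws))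

  -- Any other expression `us` of the element has the descent `g`, so exchange cancels `g` by
  -- deleting one letter of `us`.
  AscWord⇒minimal : ∀ ws → AscWord 1≤n ws → ∀ us → evalWord n us ≡ evalWord n ws → length ws ℕ.≤ length us
  AscWord⇒minimal List.[]       _         us e = ℕ.z≤n
  AscWord⇒minimal (g List.∷ ws) (aw , a) us e = finish (exchange-descent us g
      (subst (λ v → Descent g (val v)) (sym e) (Descent-cong g (λ t → sym (val-gen 1≤n g (evalWord n ws) t)) (swap-Ascent 1≤n g (val (evalWord n ws)) a))))
    where
    finish : (Σ (List (Gen n)) λ us' → suc (length us') ≡ length us × evalWord n us' ≡ gen n g ∘ₑ evalWord n us) → suc (length ws) ℕ.≤ length us
    finish (us' , l , e') = subst (suc (length ws) ℕ.≤_) l (ℕ.s≤s (AscWord⇒minimal ws aw us'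
      (trans e' (trans (cong (gen n g ∘ₑ_) e) (gen-invol 1≤n g (evalWord n ws))))))

  minimal⇒AscWord : ∀ ws → (∀ us → evalWord n us ≡ evalWord n ws → length ws ℕ.≤ length us) → AscWord 1≤n ws
  minimal⇒AscWord List.[]       m = tt
  minimal⇒AscWord (g List.∷ ws) m =
    minimal⇒AscWord ws (λ us e → ℕ.s≤s⁻¹ (m (g List.∷ us) (cong (gen n g ∘ₑ_) e))) ,
    asc (descent⊎ascent 1≤n g (isAff-word 1≤n ws))
    where
    asc : Descent g (val (evalWord n ws)) ⊎ Ascent g (val (evalWord n ws)) → Ascent g (val (evalWord n ws))
    asc (inj₂ a) = a
    asc (inj₁ d) = shorter (exchange-descent ws g d)
      where
      shorter : (Σ (List (Gen n)) λ us → suc (length us) ≡ length ws × evalWord n us ≡ gen n g ∘ₑ evalWord n ws) → _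
      shorter (us , l , e) = ⊥-elim (ℕₚ.1+n≰n (ℕₚ.≤-trans (m us e) (subst (length us ℕ.≤_) l (ℕₚ.n≤1+n (length us)))))

  reduced-word : ∀ w → IsAff w → Σ (List (Gen n)) λ ws → AscWord 1≤n ws × Reduced n ws w
  reduced-word w G = go (ascWord 1≤n w G)
    where
    go : (Σ (List (Gen n)) λ ws → AscWord 1≤n ws × evalWord n ws ≡ w) → Σ (List (Gen n)) λ ws → AscWord 1≤n ws × Reduced n ws w
    go (ws , aw , e) = ws , aw , e , λ us e' → AscWord⇒minimal ws aw us (trans e' (sym e))

-- The rank criterion for the Bruhat order

abstract

  -- The number of m ≥ 1 with N m ≤ z: the contribution of one residue class to the rank function.
  ψ : ℕ → ℤ → ℤ
  ψ n z = 0ℤ ⊔ fl n z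

  ψ-nonneg : ∀ {n} z → 0ℤ ≤ ψ n z
  ψ-nonneg {n} z = i≤i⊔j 0ℤ (fl n z)

  fl≤ψ : ∀ {n} z → fl n z ≤ ψ n z
  fl≤ψ {n} z = i≤j⊔i 0ℤ (fl n z)

  ψ-pos : ∀ {n z} → 0ℤ ≤ fl n z → ψ n z ≡ fl n z
  ψ-pos = i≤j⇒i⊔j≡j

  ψ-neg : ∀ {n z} → fl n z ≤ 0ℤ → ψ n z ≡ 0ℤ
  ψ-neg = i≥j⇒i⊔j≡i

module _ {n : ℕ} where

  fl-+N : ∀ z → fl n (z + N n) ≡ 1ℤ + fl n z
  fl-+N z = trans (cong (λ q → fl n (z + q)) (sym (*-identityʳ (N n)))) (trans (fl-shift z 1ℤ) (+-comm (fl n z) 1ℤ))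

  ψ-step : ∀ z → (0ℤ ≤ fl n z × ψ n (z + N n) ≡ 1ℤ + ψ n z) ⊎ (1ℤ + fl n z ≤ 0ℤ × ψ n (z + N n) ≡ ψ n z)
  ψ-step z = go (≤⊎> 0ℤ (fl n z))
    where
    go : 0ℤ ≤ fl n z ⊎ 1ℤ + fl n z ≤ 0ℤ → _
    go (inj₁ p) = inj₁ (p , trans (ψ-pos (subst (0ℤ ≤_) (sym (fl-+N z)) (≤-trans p (i≤suc[i] (fl n z))))) (trans (fl-+N z) (cong (_+_ 1ℤ) (sym (ψ-pos p)))))
    go (inj₂ p) = inj₂ (p , trans (ψ-neg (subst (_≤ 0ℤ) (sym (fl-+N z)) p)) (sym (ψ-neg (1+≤⇒≤ p))))

  ψ≤ψ+N : ∀ z → ψ n z ≤ ψ n (z + N n)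
  ψ≤ψ+N z = go (ψ-step z)
    where
    go : _ → ψ n z ≤ ψ n (z + N n)
    go (inj₁ (_ , e)) = subst (ψ n z ≤_) (sym e) (i≤suc[i] (ψ n z))
    go (inj₂ (_ , e)) = ≤-reflexive (sym e)

  ψ+N≤1+ψ : ∀ z → ψ n (z + N n) ≤ 1ℤ + ψ n z
  ψ+N≤1+ψ z = go (ψ-step z)
    where
    go : _ → ψ n (z + N n) ≤ 1ℤ + ψ n z
    go (inj₁ (_ , e)) = ≤-reflexive e
    go (inj₂ (_ , e)) = subst (_≤ 1ℤ + ψ n z) (sym e) (i≤suc[i] (ψ n z))

  -- A residue class t < k has the position t itself below the cutoff k, one more than a class t ≥
  -- k; adding N to its argument counts it.
  bump : ℕ → Fin (suc n) → ℤ
  bump k t = if ⌊ toℕ t ℕ.<? k ⌋ then N n else 0ℤ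

  bump-< : ∀ {k} t → toℕ t ℕ.< k → bump k t ≡ N n
  bump-< {k} t p with toℕ t ℕ.<? k
  ... | yes _ = ≡.refl
  ... | no ¬p = ⊥-elim (¬p p)

  bump-≥ : ∀ {k} t → k ℕ.≤ toℕ t → bump k t ≡ 0ℤ
  bump-≥ {k} t p with toℕ t ℕ.<? k
  ... | yes q = ⊥-elim (ℕₚ.<⇒≱ q p)
  ... | no _  = ≡.refl

  -- lev x k j below is #{i ∈ ℤ : i < k, x i ≥ j} for the periodic extension of the window x.
  mass : (Fin (suc n) → ℤ) → (Fin (suc n) → ℤ) → ℤ → ℤ
  mass β x j = sum (λ t → ψ n (x t + β t - j))

  lev : (Fin (suc n) → ℤ) → ℕ → ℤ → ℤ
  lev x k j = mass (bump k) x j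

  lev-cong : ∀ {x y} → (∀ t → x t ≡ y t) → ∀ k j → lev x k j ≡ lev y k j
  lev-cong h k j = sum-≡ (λ t → cong (λ a → ψ n (a + bump k t - j)) (h t))

  lev-top : ∀ x j → lev x (suc n) j ≡ lev x 0 (j - N n)
  lev-top x j = sum-≡ λ t → cong (ψ n) (trans (cong (λ b → x t + b - j) (bump-< t (toℕ<n t)))
                   (trans (eq (x t) (N n) j) (cong (λ b → x t + b - (j - N n)) (sym (bump-≥ {0} t ℕ.z≤n)))))
    where
    eq : ∀ x N j → x + N - j ≡ x + 0ℤ - (j - N)
    eq = solve-∀

  -- The cutoffs 0, ..., n determine the others: by `lev-top` a period in the cutoff is a period in
  -- the threshold.
  _⊴_ : (Fin (suc n) → ℤ) → (Fin (suc n) → ℤ) → Set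
  x ⊴ y = ∀ k j → k ℕ.≤ n → lev x k j ≤ lev y k j

  ⊴-top : ∀ {x y} → x ⊴ y → ∀ j → lev x (suc n) j ≤ lev y (suc n) j
  ⊴-top {x} {y} h j = subst₂ _≤_ (sym (lev-top x j)) (sym (lev-top y j)) (h 0 (j - N n) ℕ.z≤n)

  -- The one cutoff in 0, ..., n that separates the two positions swapped by `g`; at the other ones
  -- `g` preserves the rank function (`lev-swap`).
  level : Gen n → ℕ
  level (just s) = suc (toℕ s)
  level nothing  = 0

  -- The cutoffs one below and one above `level g`. They are given as functions because they may be
  -- -1 or n + 1, outside the range of `⊴`; the cutoff -1 is n - N.
  β-lo β-hi : Gen n → Fin (suc n) → ℤ
  β-lo (just s) = bump (toℕ s)
  β-lo nothing t = bump n t - N n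
  β-hi (just s) = bump (suc (suc (toℕ s)))
  β-hi nothing  = bump 1

  OffLevel : Gen n → (Fin (suc n) → ℤ) → (Fin (suc n) → ℤ) → Set
  OffLevel g x y = ∀ k j → k ℕ.≤ n → k ≢ level g → lev x k j ≤ lev y k j

  level≤n : ∀ g → level g ℕ.≤ n
  level≤n (just s) = toℕ<n s
  level≤n nothing  = ℕ.z≤n

module _ {n : ℕ} (1≤n : 1 ℕ.≤ n) where

  private
    mass-shift : ∀ (x : Fin (suc n) → ℤ) k j → mass (λ t → bump k t - N n) x j ≡ lev x k (j + N n)
    mass-shift x k j = sum-≡ λ t → cong (ψ n) (eq (x t) (bump k t) (N n) j)
      where
      eq : ∀ x b N j → x + (b - N) - j ≡ x + b - (j + N)
      eq = solve-∀

  offLevel-lo : ∀ g x y → OffLevel {n} g x y → ∀ j → mass (β-lo g) x j ≤ mass (β-lo g) y j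
  offLevel-lo (just s) x y h j = h (toℕ s) j (ℕₚ.<⇒≤ (toℕ<n s)) (λ e → ℕₚ.1+n≢n (sym e))
  offLevel-lo nothing x y h j = subst₂ _≤_ (sym (mass-shift x n j)) (sym (mass-shift y n j))
    (h n (j + N n) ℕₚ.≤-refl (λ e → ℕₚ.1+n≰n (subst (1 ℕ.≤_) e 1≤n)))

  offLevel-hi : ∀ g x y → OffLevel {n} g x y → ∀ j → mass (β-hi g) x j ≤ mass (β-hi g) y j
  offLevel-hi (just s) x y h j = go (ℕₚ.m≤n⇒m<n∨m≡n (toℕ<n s))
    where
    go : suc (toℕ s) ℕ.< n ⊎ suc (toℕ s) ≡ n → lev x (suc (suc (toℕ s))) j ≤ lev y (suc (suc (toℕ s))) j
    go (inj₁ p) = h _ j p (λ e → ℕₚ.1+n≢n e)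
    go (inj₂ p) = subst (λ m → lev x (suc m) j ≤ lev y (suc m) j) (sym p)
                    (subst₂ _≤_ (sym (lev-top x j)) (sym (lev-top y j)) (h 0 (j - N n) ℕ.z≤n (λ ())))
  offLevel-hi nothing x y h j = h 1 j 1≤n (λ ())

  -- The three neighbouring cutoffs differ only at the swapped positions, where (u , v) is (0 , 0)
  -- for `β-lo`, (N , 0) for `level g` and (N , N) for `β-hi`.
  record Profile (g : Gen n) (β : Fin (suc n) → ℤ) (u v : ℤ) : Set where
    field
      at-low  : β (lowPos g) ≡ off g + u
      at-high : β (highPos g) ≡ v
      away    : ∀ t → t ≢ lowPos g → t ≢ highPos g → β t ≡ bump (level g) t

  private
    off0 : ∀ (s : Fin n) u → u ≡ off {n} (just s) + u
    off0 s u = eq (N n) u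
      where
      eq : ∀ N u → u ≡ N * 0ℤ + u
      eq = solve-∀

    offN : N n + off {n} nothing ≡ 0ℤ
    offN = eq (N n)
      where
      eq : ∀ N → N + N * (- 1ℤ) ≡ 0ℤ
      eq = solve-∀

    adjacent : ∀ (s : Fin n) t → t ≢ inject₁ s → t ≢ suc s → toℕ t ℕ.< toℕ s ⊎ suc (suc (toℕ s)) ℕ.≤ toℕ t
    adjacent s t p q = go (ℕₚ.<-cmp (toℕ t) (toℕ s))
      where
      go : _ → toℕ t ℕ.< toℕ s ⊎ suc (suc (toℕ s)) ℕ.≤ toℕ t
      go (tri< a _ _) = inj₁ a
      go (tri≈ _ b _) = ⊥-elim (p (toℕ-injective (trans b (sym (toℕ-inject₁ s)))))
      go (tri> _ _ c) = inj₂ (ℕₚ.≤∧≢⇒< c (λ e → q (toℕ-injective (sym e))))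

    middle : ∀ t → t ≢ fromℕ n → t ≢ zero → 1 ℕ.≤ toℕ t × toℕ t ℕ.< n
    middle t p q = ℕₚ.n≢0⇒n>0 (λ e → q (toℕ-injective e)) ,
                   ℕₚ.≤∧≢⇒< (toℕ≤pred[n] t) (λ e → p (toℕ-injective (trans e (sym (toℕ-fromℕ n)))))

    wrapN : ∀ {b u} → b ≡ 0ℤ → u ≡ N n → b ≡ off {n} nothing + u
    wrapN ≡.refl ≡.refl = trans (sym offN) (+-comm (N n) (off {n} nothing))

  profile-level : ∀ g → Profile g (bump (level g)) (N n) 0ℤ
  profile-level (just s) = record
    { at-low  = trans (bump-< (inject₁ s) (ℕ.s≤s (ℕₚ.≤-reflexive (toℕ-inject₁ s)))) (off0 s (N n))
    ; at-high = bump-≥ (suc s) ℕₚ.≤-refl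
    ; away    = λ _ _ _ → ≡.refl }
  profile-level nothing = record
    { at-low  = wrapN (bump-≥ (fromℕ n) ℕ.z≤n) ≡.refl
    ; at-high = bump-≥ {n} {0} zero ℕ.z≤n
    ; away    = λ _ _ _ → ≡.refl }

  profile-lo : ∀ g → Profile g (β-lo g) 0ℤ 0ℤ
  profile-lo (just s) = record
    { at-low  = trans (bump-≥ (inject₁ s) (ℕₚ.≤-reflexive (sym (toℕ-inject₁ s)))) (off0 s 0ℤ)
    ; at-high = bump-≥ (suc s) (ℕₚ.n≤1+n _)
    ; away    = λ t p q → aw t (adjacent s t p q) }
    where
    aw : ∀ t → toℕ t ℕ.< toℕ s ⊎ suc (suc (toℕ s)) ℕ.≤ toℕ t → bump (toℕ s) t ≡ bump (suc (toℕ s)) t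
    aw t (inj₁ p) = trans (bump-< t p) (sym (bump-< t (ℕₚ.m≤n⇒m≤1+n p)))
    aw t (inj₂ p) = trans (bump-≥ t (ℕₚ.≤-trans (ℕₚ.n≤1+n _) (ℕₚ.≤-trans (ℕₚ.n≤1+n _) p))) (sym (bump-≥ t (ℕₚ.≤-trans (ℕₚ.n≤1+n _) p)))
  profile-lo nothing = record
    { at-low  = trans (cong (_- (N n)) (bump-≥ (fromℕ n) (ℕₚ.≤-reflexive (sym (toℕ-fromℕ n))))) (eq (N n))
    ; at-high = trans (cong (_- (N n)) (bump-< {n} {n} zero 1≤n)) (i≡j⇒i-j≡0 {N n} ≡.refl)
    ; away    = λ t p q → trans (trans (cong (_- (N n)) (bump-< t (proj₂ (middle t p q)))) (i≡j⇒i-j≡0 {N n} ≡.refl)) (sym (bump-≥ {n} {0} t ℕ.z≤n)) }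
    where
    eq : ∀ N → 0ℤ - N ≡ N * (- 1ℤ) + 0ℤ
    eq = solve-∀

  profile-hi : ∀ g → Profile g (β-hi g) (N n) (N n)
  profile-hi (just s) = record
    { at-low  = trans (bump-< (inject₁ s) (ℕₚ.m≤n⇒m≤1+n (ℕ.s≤s (ℕₚ.≤-reflexive (toℕ-inject₁ s))))) (off0 s (N n))
    ; at-high = bump-< (suc s) ℕₚ.≤-refl
    ; away    = λ t p q → aw t (adjacent s t p q) }
    where
    aw : ∀ t → toℕ t ℕ.< toℕ s ⊎ suc (suc (toℕ s)) ℕ.≤ toℕ t → bump (suc (suc (toℕ s))) t ≡ bump (suc (toℕ s)) t
    aw t (inj₁ p) = trans (bump-< t (ℕₚ.m≤n⇒m≤1+n (ℕₚ.m≤n⇒m≤1+n p))) (sym (bump-< t (ℕₚ.m≤n⇒m≤1+n p)))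
    aw t (inj₂ p) = trans (bump-≥ t p) (sym (bump-≥ t (ℕₚ.≤-trans (ℕₚ.n≤1+n _) p)))
  profile-hi nothing = record
    { at-low  = wrapN (bump-≥ (fromℕ n) (subst (1 ℕ.≤_) (sym (toℕ-fromℕ n)) 1≤n)) ≡.refl
    ; at-high = bump-< {n} {1} zero ℕₚ.≤-refl
    ; away    = λ t p q → trans (bump-≥ t (proj₁ (middle t p q))) (sym (bump-≥ {n} {0} t ℕ.z≤n)) }

  private
    rest : Gen n → (Fin (suc n) → ℤ) → ℤ → ℤ
    rest g x j = sum (upd (lowPos g) (highPos g) 0ℤ 0ℤ (λ t → ψ n (x t + bump (level g) t - j)))

  mass-profile : ∀ {g β u v} → Profile g β u v → ∀ x j →
    mass β x j ≡ ψ n (x (lowPos g) + off g - j + u) + ψ n (x (highPos g) - j + v) + rest g x j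
  mass-profile {g} {β} {u} {v} pr x j = trans (sum-split (λ t → ψ n (x t + β t - j)) (low≢high 1≤n g)) (cong₂ _+_ (cong₂ _+_
      (cong (ψ n) (trans (cong (λ b → x (lowPos g) + b - j) at-low) (e₁ (x (lowPos g)) (off g) u j)))
      (cong (ψ n) (trans (cong (λ b → x (highPos g) + b - j) at-high) (e₂ (x (highPos g)) v j))))
      (sum-≡ rs))
    where
    open Profile pr
    e₁ : ∀ x o u j → x + (o + u) - j ≡ x + o - j + u
    e₁ = solve-∀
    e₂ : ∀ x v j → x + v - j ≡ x - j + v
    e₂ = solve-∀
    rs : ∀ t → upd (lowPos g) (highPos g) 0ℤ 0ℤ (λ t → ψ n (x t + β t - j)) t ≡ upd (lowPos g) (highPos g) 0ℤ 0ℤ (λ t → ψ n (x t + bump (level g) t - j)) t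
    rs t with t Fin.≟ lowPos g
    ... | yes _ = ≡.refl
    ... | no p with t Fin.≟ highPos g
    ...   | yes _ = ≡.refl
    ...   | no q  = cong (λ b → ψ n (x t + b - j)) (away t p q)

  module _ (g : Gen n) (x : Fin (suc n) → ℤ) (j : ℤ) where

    private
      a = x (lowPos g) + off g - j
      b = x (highPos g) - j
      ψa = ψ n a
      ψa⁺ = ψ n (a + N n)
      ψb = ψ n b
      ψb⁺ = ψ n (b + N n)
      r = rest g x j
      +0 : ∀ z → ψ n (z + 0ℤ) ≡ ψ n z
      +0 z = cong (ψ n) (+-identityʳ z)

      L≡ : lev x (level g) j ≡ ψa⁺ + ψb + r
      L≡ = trans (mass-profile (profile-level g) x j) (cong (λ q → ψa⁺ + q + r) (+0 b))
      lo≡ : mass (β-lo g) x j ≡ ψa + ψb + r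
      lo≡ = trans (mass-profile (profile-lo g) x j) (cong₂ (λ p q → p + q + r) (+0 a) (+0 b))
      hi≡ : mass (β-hi g) x j ≡ ψa⁺ + ψb⁺ + r
      hi≡ = mass-profile (profile-hi g) x j

    lev≤1+lo : lev x (level g) j ≤ 1ℤ + mass (β-lo g) x j
    lev≤1+lo = subst₂ (λ p q → p ≤ 1ℤ + q) (sym L≡) (sym lo≡) (lin (ψ+N≤1+ψ a) (eq ψa ψa⁺ ψb r))
      where
      eq : ∀ a a' b r → 1ℤ + (a + b + r) - (a' + b + r) ≡ 1ℤ + a - a'
      eq = solve-∀

    lev≤hi : lev x (level g) j ≤ mass (β-hi g) x j
    lev≤hi = subst₂ _≤_ (sym L≡) (sym hi≡) (lin (ψ≤ψ+N b) (eq ψa⁺ ψb ψb⁺ r))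
      where
      eq : ∀ a b b' r → a + b' + r - (a + b + r) ≡ b' - b
      eq = solve-∀

    lo≤lev : mass (β-lo g) x j ≤ lev x (level g) j
    lo≤lev = subst₂ _≤_ (sym lo≡) (sym L≡) (lin (ψ≤ψ+N a) (eq ψa ψa⁺ ψb r))
      where
      eq : ∀ a a' b r → a' + b + r - (a + b + r) ≡ a' - a
      eq = solve-∀

    hi≤1+lev : mass (β-hi g) x j ≤ 1ℤ + lev x (level g) j
    hi≤1+lev = subst₂ (λ p q → p ≤ 1ℤ + q) (sym hi≡) (sym L≡) (lin (ψ+N≤1+ψ b) (eq ψa⁺ ψb ψb⁺ r))
      where
      eq : ∀ a b b' r → 1ℤ + (a + b + r) - (a + b' + r) ≡ 1ℤ + b - b'
      eq = solve-∀

    -- lev is min (1 + lo) hi at a descent and max lo (hi - 1) at an ascent, so that the lifting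
    -- property of the rank comparison is a matter of monotonicity.
    descent-lev : Descent g x → 1ℤ + mass (β-lo g) x j ≤ lev x (level g) j ⊎ mass (β-hi g) x j ≤ lev x (level g) j
    descent-lev d = go (ψ-step a)
      where
      b≤a : b ≤ a
      b≤a = +-monoˡ-≤ (- j) (1+≤⇒≤ {x (highPos g)} {x (lowPos g) + off g} d)
      eq : ∀ a b r → 1ℤ + (a + b + r) ≡ 1ℤ + a + b + r
      eq = solve-∀
      go : _ → 1ℤ + mass (β-lo g) x j ≤ lev x (level g) j ⊎ mass (β-hi g) x j ≤ lev x (level g) j
      go (inj₁ (_ , e)) = inj₁ (≤-reflexive (trans (cong (_+_ 1ℤ) lo≡) (trans (eq ψa ψb r) (trans (cong (λ q → q + ψb + r) (sym e)) (sym L≡)))))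
      go (inj₂ (p , _)) = inj₂ (go' (ψ-step b))
        where
        go' : _ → mass (β-hi g) x j ≤ lev x (level g) j
        go' (inj₁ (q , _)) = ⊥-elim (1+a≰a (≤-trans p (≤-trans q (fl-mono b≤a))))
        go' (inj₂ (_ , e)) = ≤-reflexive (trans hi≡ (trans (cong (λ q → ψa⁺ + q + r) e) (sym L≡)))

    ascent-lev : Ascent g x → lev x (level g) j ≤ mass (β-lo g) x j ⊎ 1ℤ + lev x (level g) j ≤ mass (β-hi g) x j
    ascent-lev d = go (ψ-step a)
      where
      a≤b : a ≤ b
      a≤b = +-monoˡ-≤ (- j) (1+≤⇒≤ {x (lowPos g) + off g} {x (highPos g)} d)
      eq : ∀ a b r → 1ℤ + (a + b + r) ≡ a + (1ℤ + b) + r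
      eq = solve-∀
      go : _ → lev x (level g) j ≤ mass (β-lo g) x j ⊎ 1ℤ + lev x (level g) j ≤ mass (β-hi g) x j
      go (inj₂ (_ , e)) = inj₁ (≤-reflexive (trans L≡ (trans (cong (λ q → q + ψb + r) e) (sym lo≡))))
      go (inj₁ (p , _)) = inj₂ (go' (ψ-step b))
        where
        go' : _ → 1ℤ + lev x (level g) j ≤ mass (β-hi g) x j
        go' (inj₂ (q , _)) = ⊥-elim (1+a≰a (≤-trans q (≤-trans p (fl-mono a≤b))))
        go' (inj₁ (_ , e)) = ≤-reflexive (trans (cong (_+_ 1ℤ) L≡) (trans (eq ψa⁺ ψb r) (trans (cong (λ q → ψa⁺ + q + r) (sym e)) (sym hi≡))))

  private
    fill : ∀ g x y → OffLevel {n} g x y → (∀ j → lev x (level g) j ≤ lev y (level g) j) → x ⊴ y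
    fill g x y h at k j k≤n = go (k ℕ.≟ level g)
      where
      go : Dec (k ≡ level g) → lev x k j ≤ lev y k j
      go (yes ≡.refl) = at j
      go (no ¬p) = h k j k≤n ¬p

  -- For every `x` the value at `level g` is at most 1 + lo and at most hi; for `y`, at a descent,
  -- it reaches one of these two bounds.
  ⊴-descent : ∀ g x y → Descent g y → OffLevel {n} g x y → x ⊴ y
  ⊴-descent g x y d h = fill g x y h λ j → go j (descent-lev g y j d)
    where
    go : ∀ j → _ → lev x (level g) j ≤ lev y (level g) j
    go j (inj₁ p) = ≤-trans (lev≤1+lo g x j) (≤-trans (+-monoʳ-≤ 1ℤ (offLevel-lo g x y h j)) p)
    go j (inj₂ p) = ≤-trans (lev≤hi g x j) (≤-trans (offLevel-hi g x y h j) p)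

  -- Dual: for `y` the value is at least lo and at least hi - 1, and for `x`, at an ascent, it does
  -- not exceed one of these.
  ⊴-ascent : ∀ g x y → Ascent g x → OffLevel {n} g x y → x ⊴ y
  ⊴-ascent g x y d h = fill g x y h λ j → go j (ascent-lev g x j d)
    where
    eq : ∀ a b → b - a ≡ 1ℤ + b - (1ℤ + a)
    eq = solve-∀
    go : ∀ j → _ → lev x (level g) j ≤ lev y (level g) j
    go j (inj₁ p) = ≤-trans p (≤-trans (offLevel-lo g x y h j) (lo≤lev g y j))
    go j (inj₂ p) = lin (≤-trans p (≤-trans (offLevel-hi g x y h j) (hi≤1+lev g y j))) (eq (lev x (level g) j) (lev y (level g) j))

  bump-swap : ∀ (g : Gen n) {k} → k ℕ.≤ n → k ≢ level g → bump k (lowPos g) ≡ bump k (highPos g) + off g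
  bump-swap (just s) {k} k≤n k≢ = trans (go (ℕₚ.<-cmp k (suc (toℕ s)))) (eq (bump k (suc s)) (N n))
    where
    eq : ∀ b N → b ≡ b + N * 0ℤ
    eq = solve-∀
    go : _ → bump k (inject₁ s) ≡ bump k (suc s)
    go (tri< (ℕ.s≤s p) _ _) = trans (bump-≥ (inject₁ s) (subst (k ℕ.≤_) (sym (toℕ-inject₁ s)) p)) (sym (bump-≥ (suc s) (ℕₚ.m≤n⇒m≤1+n p)))
    go (tri≈ _ p _) = ⊥-elim (k≢ p)
    go (tri> _ _ p) = trans (bump-< (inject₁ s) (ℕₚ.≤-trans (ℕ.s≤s (ℕₚ.≤-reflexive (toℕ-inject₁ s))) (ℕₚ.<⇒≤ p))) (sym (bump-< (suc s) p))
  bump-swap nothing {k} k≤n k≢ = trans (bump-≥ (fromℕ n) (subst (k ℕ.≤_) (sym (toℕ-fromℕ n)) k≤n))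
    (trans (sym offN) (cong (_+ off {n} nothing) (sym (bump-< {n} {k} zero (ℕₚ.n≢0⇒n>0 k≢)))))

  lev-swap : ∀ (g : Gen n) x {k} j → k ℕ.≤ n → k ≢ level g → lev (swapVal g x) k j ≡ lev x k j
  lev-swap g x {k} j k≤n k≢ = trans (sum-φ-upd φ (x h - o) (x l + o) x (low≢high 1≤n g)) (trans
      (cong (_+ s) (trans (cong₂ _+_ (cong (ψ n) (e₁ (x h) (bump k h) o j (bump k l) bs)) (cong (ψ n) (e₂ (x l) (bump k h) o j (bump k l) bs))) (+-comm (φ h (x h)) (φ l (x l)))))
      (sym (sum-split (λ t → φ t (x t)) (low≢high 1≤n g))))
    where
    l = lowPos g
    h = highPos g
    o = off g
    bs = bump-swap g k≤n k≢
    φ : Fin (suc n) → ℤ → ℤ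
    φ t a = ψ n (a + bump k t - j)
    s = sum (upd l h 0ℤ 0ℤ (λ t → φ t (x t)))
    e₁ : ∀ x b o j c → c ≡ b + o → x - o + c - j ≡ x + b - j
    e₁ x b o j c ≡.refl = e x b o j
      where
      e : ∀ x b o j → x - o + (b + o) - j ≡ x + b - j
      e = solve-∀
    e₂ : ∀ x b o j c → c ≡ b + o → x + o + b - j ≡ x + c - j
    e₂ x b o j c ≡.refl = e' x b o j
      where
      e' : ∀ x b o j → x + o + b - j ≡ x + (b + o) - j
      e' = solve-∀

  lev-gen : ∀ (g : Gen n) w {k} j → k ℕ.≤ n → k ≢ level g → lev (val (gen n g ∘ₑ w)) k j ≡ lev (val w) k j
  lev-gen g w {k} j p q = trans (lev-cong (val-gen 1≤n g w) k j) (lev-swap g (val w) j p q)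

  descent-gen : ∀ g w → Ascent g (val {n} w) → Descent g (val (gen n g ∘ₑ w))
  descent-gen g w a = Descent-cong g (λ t → sym (val-gen 1≤n g w t)) (swap-Ascent 1≤n g (val w) a)

  ascent-gen : ∀ g w → Descent g (val {n} w) → Ascent g (val (gen n g ∘ₑ w))
  ascent-gen g w a = Ascent-cong g (λ t → sym (val-gen 1≤n g w t)) (swap-Descent 1≤n g (val w) a)

  -- Prepending `g`, to both words or to the larger one, keeps all ranks off `level g`; the descent
  -- of the larger word at `g` supplies the missing level.
  subword⇒⊴ : ∀ {us ws : List (Gen n)} → us ⊆ ws → AscWord 1≤n ws → val (evalWord n us) ⊴ val (evalWord n ws)
  subword⇒⊴ [] _ k j _ = ≤-refl
  subword⇒⊴ {us} {g List.∷ ws} (_ ∷ʳ p) (aw , a) = ⊴-descent g (val (evalWord n us)) (val (evalWord n (g List.∷ ws))) (descent-gen g (evalWord n ws) a)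
    (λ k j k≤n k≢ → subst (lev (val (evalWord n us)) k j ≤_) (sym (lev-gen g (evalWord n ws) j k≤n k≢)) (subword⇒⊴ p aw k j k≤n))
  subword⇒⊴ {.g List.∷ us} {g List.∷ ws} (≡.refl ∷ p) (aw , a) = ⊴-descent g (val (evalWord n (g List.∷ us))) (val (evalWord n (g List.∷ ws))) (descent-gen g (evalWord n ws) a)
    (λ k j k≤n k≢ → subst₂ _≤_ (sym (lev-gen g (evalWord n us) j k≤n k≢)) (sym (lev-gen g (evalWord n ws) j k≤n k≢)) (subword⇒⊴ p aw k j k≤n))

  lev-id : ∀ k → k ℕ.≤ suc n → lev (val (idₑ n)) k (+ k) ≡ 0ℤ
  lev-id k k≤N = trans (sum-≡ zr) (sum-0 (suc n))
    where
    fl≤0 : ∀ {z} → 1ℤ + z ≤ N n → fl n z ≤ 0ℤ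
    fl≤0 {z} p = go (≤⊎> (fl n z) 0ℤ)
      where
      go : _ → fl n z ≤ 0ℤ
      go (inj₁ q) = q
      go (inj₂ q) = ⊥-elim (1+a≰a (≤-trans (≤-trans p (subst (_≤ N n * fl n z) (*-identityʳ (N n)) (N-mono {n} q))) (fl-lower z)))
    e₁ : ∀ t N k → N - (1ℤ + (t + N - k)) ≡ k - (1ℤ + t)
    e₁ = solve-∀
    e₂ : ∀ t N k → N - (1ℤ + (t + 0ℤ - k)) ≡ N + k - (1ℤ + t + 0ℤ)
    e₂ = solve-∀
    zr' : ∀ t → Dec (toℕ t ℕ.< k) → ψ n (+ toℕ t + bump k t - + k) ≡ 0ℤ
    zr' t (yes p) = trans (cong (λ b → ψ n (+ toℕ t + b - + k)) (bump-< t p)) (ψ-neg (fl≤0 (lin (+≤+ p) (e₁ (+ toℕ t) (N n) (+ k)))))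
    zr' t (no ¬p) = trans (cong (λ b → ψ n (+ toℕ t + b - + k)) (bump-≥ t (ℕₚ.≮⇒≥ ¬p))) (ψ-neg (fl≤0 (lin (+≤+ (toℕ<n t) ⊕ +≤+ ℕ.z≤n) (e₂ (+ toℕ t) (N n) (+ k)))))
    zr : ∀ t → ψ n (val (idₑ n) t + bump k t - + k) ≡ 0ℤ
    zr t = trans (cong (λ a → ψ n (a + bump k t - + k)) (val-id t)) (zr' t (toℕ t ℕ.<? k))

  -- For the identity no position below t + 1 has a value ≥ t + 1. Hence x t ≤ t for every `t`, and
  -- equality of the sums makes these equalities.
  ⊴-id : ∀ {x} → IsAff x → val x ⊴ val (idₑ n) → x ≡ idₑ n
  ⊴-id {x} G h = val-injective λ t → trans (sum-mono-≡ bound (≤-reflexive (sym (tot G))) t) (sym (val-id t))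
    where
    all-levels : ∀ k → k ℕ.≤ suc n → ∀ j → lev (val x) k j ≤ lev (val (idₑ n)) k j
    all-levels k k≤N j = go (ℕₚ.m≤n⇒m<n∨m≡n k≤N)
      where
      go : _ → lev (val x) k j ≤ lev (val (idₑ n)) k j
      go (inj₁ (ℕ.s≤s p)) = h k j p
      go (inj₂ ≡.refl) = ⊴-top {x = val x} {val (idₑ n)} h j
    bound : ∀ t → val x t ≤ + toℕ t
    bound t = lin (≤-trans (fl-upper z) (≤-trans (N-mono {n} (+-monoʳ-≤ 1ℤ fz)) (≤-reflexive (*-identityʳ (N n)))))
                  (eq (val x t) (N n) (+ toℕ t))
      where
      k = suc (toℕ t)
      z = val x t + N n - + k
      eq : ∀ v N t → t - v ≡ N - (1ℤ + (v + N - (1ℤ + t)))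
      eq = solve-∀
      f : Fin (suc n) → ℤ
      f s = ψ n (val x s + bump k s - + k)
      f0 : f t ≡ 0ℤ
      f0 = sym (sum-mono-≡ {f = λ _ → 0ℤ} {g = f} (λ s → ψ-nonneg _)
             (≤-trans (all-levels k (toℕ<n t) (+ k)) (≤-reflexive (trans (lev-id k (toℕ<n t)) (sym (sum-0 (suc n)))))) t)
      fz : fl n z ≤ 0ℤ
      fz = ≤-trans (fl≤ψ z) (≤-reflexive (trans (cong (λ b → ψ n (val x t + b - + k)) (sym (bump-< {n} {k} t ℕₚ.≤-refl))) f0))

  -- The letter `g` is skipped if `x` ascends at `g` and used if `x` descends. In both cases the
  -- element compared with `ws` ascends at `g`, so `⊴-ascent` restores the level of `g`.
  ⊴⇒subword : ∀ (ws : List (Gen n)) → AscWord 1≤n ws → ∀ x → IsAff x → val x ⊴ val (evalWord n ws) →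
    Σ (List (Gen n)) λ us → us ⊆ ws × evalWord n us ≡ x
  ⊴⇒subword List.[] _ x G h = List.[] , [] , sym (⊴-id G h)
  ⊴⇒subword (g List.∷ ws) (aw , a) x G h = go (descent⊎ascent 1≤n g G)
    where
    Goal : Set
    Goal = Σ (List (Gen n)) λ us → us ⊆ (g List.∷ ws) × evalWord n us ≡ x
    off-ws : OffLevel g (val x) (val (evalWord n ws))
    off-ws k j k≤n k≢ = subst (lev (val x) k j ≤_) (lev-gen g (evalWord n ws) j k≤n k≢) (h k j k≤n)
    go : Descent g (val x) ⊎ Ascent g (val x) → Goal
    go (inj₂ ax) = skip (⊴⇒subword ws aw x G (⊴-ascent g (val x) (val (evalWord n ws)) ax off-ws))
      where
      skip : (Σ (List (Gen n)) λ us → us ⊆ ws × evalWord n us ≡ x) → Goal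
      skip (us , p , e) = us , g ∷ʳ p , e
    go (inj₁ dx) = take (⊴⇒subword ws aw (gen n g ∘ₑ x) (isAff-gen 1≤n g G) (⊴-ascent g (val (gen n g ∘ₑ x)) (val (evalWord n ws)) (ascent-gen g x dx)
        (λ k j k≤n k≢ → subst (_≤ lev (val (evalWord n ws)) k j) (sym (lev-gen g x j k≤n k≢)) (off-ws k j k≤n k≢))))
      where
      take : (Σ (List (Gen n)) λ us → us ⊆ ws × evalWord n us ≡ gen n g ∘ₑ x) → Goal
      take (us , p , e) = g List.∷ us , ≡.refl ∷ p , trans (cong (gen n g ∘ₑ_) e) (gen-invol 1≤n g x)

-- Comparison with a dominant alcove

argmax : ∀ {m} (x : Fin (suc m) → ℤ) → Σ (Fin (suc m)) λ i → ∀ j → x j ≤ x i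
argmax {zero}  x = zero , λ { zero → ≤-refl }
argmax {suc m} x with argmax (λ i → x (suc i))
... | i , h with ≤⊎> (x zero) (x (suc i))
...   | inj₁ p = suc i , λ { zero → p ; (suc j) → h j }
...   | inj₂ p = zero , λ { zero → ≤-refl ; (suc j) → ≤-trans (h j) (1+≤⇒≤ p) }

Decreasing : ∀ {m} → (Fin m → ℤ) → Set
Decreasing x = ∀ {s t} → toℕ s ℕ.≤ toℕ t → x t ≤ x s

decreasing : ∀ {n} (x : Fin (suc n) → ℤ) → (∀ s → x (suc s) ≤ x (inject₁ s)) → Decreasing x
decreasing x = chain {R = λ p q → q ≤ p} ≤-refl (λ p q → ≤-trans q p) x

inject₁≤suc : ∀ {n} (s : Fin n) → toℕ (inject₁ s) ℕ.≤ toℕ (suc s)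
inject₁≤suc s = ℕₚ.≤-trans (ℕₚ.≤-reflexive (toℕ-inject₁ s)) (ℕₚ.n≤1+n (toℕ s))

sorting : ∀ {m} (x : Fin m → ℤ) → Σ (Permutation′ m) λ π → Decreasing (λ t → x (π ⟨$⟩ʳ t))
sorting {zero}  x = Perm.id , λ { {()} }
sorting {suc m} x with argmax x
... | i , h with sorting (λ k → x (Fin.punchIn i k))
...   | π , dec = ρ , desc
  where
  ρ = Perm.insert zero i π
  at-suc : ∀ k → x (ρ ⟨$⟩ʳ suc k) ≡ x (Fin.punchIn i (π ⟨$⟩ʳ k))
  at-suc k = cong x (Perm.insert-punchIn zero i π k)
  desc : Decreasing (λ t → x (ρ ⟨$⟩ʳ t))
  desc {zero}  {t}         _ = h (ρ ⟨$⟩ʳ t)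
  desc {suc s} {suc t} (ℕ.s≤s p) = subst₂ _≤_ (sym (at-suc t)) (sym (at-suc s)) (dec p)

last : ∀ {m} {P : Fin m → Set} → (∀ t → Dec (P t)) → (∀ t → ¬ P t) ⊎ (Σ (Fin m) λ t → P t × ∀ s → toℕ t ℕ.< toℕ s → ¬ P s)
last {zero}  P? = inj₁ λ ()
last {suc m} P? with last (λ t → P? (suc t))
... | inj₂ (t , p , h) = inj₂ (suc t , p , λ { (suc s) (ℕ.s≤s q) → h s q })
... | inj₁ h with P? zero
...   | yes p = inj₂ (zero , p , λ { (suc s) _ → h s })
...   | no ¬p = inj₁ λ { zero → ¬p ; (suc s) → h s }

upTo : ∀ {m} → Fin m → (Fin m → ℤ) → Fin m → ℤ
upTo t f s = if ⌊ toℕ s ℕ.≤? toℕ t ⌋ then f s else 0ℤ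

upTo-≤ : ∀ {m} {t s : Fin m} {f} → toℕ s ℕ.≤ toℕ t → upTo t f s ≡ f s
upTo-≤ {t = t} {s} p with toℕ s ℕ.≤? toℕ t
... | yes _ = ≡.refl
... | no ¬p = ⊥-elim (¬p p)

upTo-> : ∀ {m} {t s : Fin m} {f} → toℕ t ℕ.< toℕ s → upTo t f s ≡ 0ℤ
upTo-> {t = t} {s} p with toℕ s ℕ.≤? toℕ t
... | yes q = ⊥-elim (ℕₚ.<⇒≱ p q)
... | no _  = ≡.refl

upTo-+ : ∀ {m} (t : Fin m) f g s → upTo t (λ s → f s + g s) s ≡ upTo t f s + upTo t g s
upTo-+ t f g s with toℕ s ℕ.≤? toℕ t
... | yes _ = ≡.refl
... | no _  = ≡.refl

≤⊎>-Fin : ∀ {m} (s t : Fin m) → toℕ s ℕ.≤ toℕ t ⊎ toℕ t ℕ.< toℕ s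
≤⊎>-Fin s t with toℕ s ℕ.≤? toℕ t
... | yes p = inj₁ p
... | no ¬p = inj₂ (ℕₚ.≰⇒> ¬p)

partial : ∀ {m} → (Fin m → ℤ) → Fin m → ℤ
partial f t = sum (upTo t f)

partial-cong : ∀ {m} {f g : Fin m → ℤ} → (∀ s → f s ≡ g s) → ∀ t → partial f t ≡ partial g t
partial-cong {f = f} {g} h t = sum-≡ pt
  where
  pt : ∀ s → upTo t f s ≡ upTo t g s
  pt s with toℕ s ℕ.≤? toℕ t
  ... | yes _ = h s
  ... | no _  = ≡.refl

partial-+ : ∀ {m} (f g : Fin m → ℤ) t → partial (λ s → f s + g s) t ≡ partial f t + partial g t
partial-+ f g t = trans (sum-≡ (upTo-+ t f g)) (∑-distrib-+ (upTo t f) (upTo t g))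

module _ {n : ℕ} where

  floors : ℤ → (Fin (suc n) → ℤ) → Fin (suc n) → ℤ
  floors j f s = fl n (f s - j)

  _≤ᴰ_ : (Fin (suc n) → ℤ) → (Fin (suc n) → ℤ) → Set
  d ≤ᴰ y = ∀ j t → partial (floors j d) t ≤ partial (floors j y) t

  -- The rank function at cutoff 0. It is symmetric in the entries, so it can be read off the sorted
  -- window.
  bottom : (Fin (suc n) → ℤ) → ℤ → ℤ
  bottom x j = sum (λ t → ψ n (x t - j))

  lev-bottom : ∀ x j → lev x 0 j ≡ bottom x j
  lev-bottom x j = sum-≡ λ t → cong (λ a → ψ n (a - j)) (trans (cong (_+_ (x t)) (bump-≥ {n} {0} t ℕ.z≤n)) (+-identityʳ (x t)))

  bottom-perm : ∀ x (π : Permutation′ (suc n)) j → bottom (λ t → x (π ⟨$⟩ʳ t)) j ≡ bottom x j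
  bottom-perm x π j = sym (sum-permute (λ t → ψ n (x t - j)) π)

  upTo-fl≤ψ : ∀ j t f s → upTo t (floors j f) s ≤ ψ n (f s - j)
  upTo-fl≤ψ j t f s = go (≤⊎>-Fin s t)
    where
    go : _ → upTo t (floors j f) s ≤ ψ n (f s - j)
    go (inj₁ p) = subst (_≤ ψ n (f s - j)) (sym (upTo-≤ {f = floors j f} p)) (fl≤ψ (f s - j))
    go (inj₂ p) = subst (_≤ ψ n (f s - j)) (sym (upTo-> {f = floors j f} p)) (ψ-nonneg (f s - j))

  partial≤bottom : ∀ j f t → partial (floors j f) t ≤ bottom f j
  partial≤bottom j f t = sum-mono (upTo-fl≤ψ j t f)

  bottom≡partial : ∀ j f t → (∀ s → toℕ s ℕ.≤ toℕ t → 0ℤ ≤ fl n (f s - j)) → (∀ s → toℕ t ℕ.< toℕ s → fl n (f s - j) ≤ 0ℤ) →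
                   bottom f j ≡ partial (floors j f) t
  bottom≡partial j f t up down = sum-≡ λ s → go s (≤⊎>-Fin s t)
    where
    go : ∀ s → _ → ψ n (f s - j) ≡ upTo t (floors j f) s
    go s (inj₁ p) = trans (ψ-pos (up s p)) (sym (upTo-≤ {f = floors j f} p))
    go s (inj₂ p) = trans (ψ-neg (down s p)) (sym (upTo-> {f = floors j f} p))

  floors-mono : ∀ {f} j → Decreasing f → Decreasing (floors j f)
  floors-mono j dec p = fl-mono (+-monoˡ-≤ (- j) (dec p))

  floors-shift : ∀ j m f s → floors j f s ≡ floors (j + N n * m) f s + m
  floors-shift j m f s = trans (cong (fl n) (eq (f s) j (N n) m)) (fl-shift (f s - (j + N n * m)) m)
    where
    eq : ∀ a j N m → a - j ≡ a - (j + N * m) + N * m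
    eq = solve-∀

  -- Moving the threshold by N m changes all floors on both sides by m. With m chosen so that the
  -- floor of `y` at `t` becomes 0, the partial sum of `y` up to `t` is its full sum of positive
  -- parts.
  bottom⇒≤ᴰ : ∀ {d y} → Decreasing y → (∀ j → bottom d j ≤ bottom y j) → d ≤ᴰ y
  bottom⇒≤ᴰ {d} {y} dec h j t = subst₂ _≤_ (sym (sp d)) (sym (sp y)) (+-monoˡ-≤ (partial (λ _ → m) t)
      (≤-trans (partial≤bottom j' d t) (≤-trans (h j') (≤-reflexive (bottom≡partial j' y t
        (λ s p → ≤-trans (≤-reflexive (sym at-t)) (floors-mono j' dec p))
        (λ s p → ≤-trans (floors-mono j' dec (ℕₚ.<⇒≤ p)) (≤-reflexive at-t)))))))
    where
    m = fl n (y t - j)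
    j' = j + N n * m
    sp : ∀ f → partial (floors j f) t ≡ partial (floors j' f) t + partial (λ _ → m) t
    sp f = trans (partial-cong (floors-shift j m f) t) (partial-+ (floors j' f) (λ _ → m) t)
    eq : ∀ m a → a - 0ℤ ≡ a + m - m
    eq = solve-∀
    at-t : floors j' y t ≡ 0ℤ
    at-t = lin≡ (sym (floors-shift j m y t)) (eq m (floors j' y t))

  -- As `d` decreases, its sum of positive parts is the partial sum up to the last nonnegative
  -- floor.
  ≤ᴰ⇒bottom : ∀ {d y} → Decreasing d → d ≤ᴰ y → ∀ j → bottom d j ≤ bottom y j
  ≤ᴰ⇒bottom {d} {y} dec h j = go (last (λ t → ℤₚ._≤?_ 0ℤ (fl n (d t - j))))
    where
    neg : ∀ {t} → ¬ (0ℤ ≤ fl n (d t - j)) → fl n (d t - j) ≤ 0ℤ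
    neg ¬p = <⇒≤ (≰⇒> ¬p)
    go : _ → bottom d j ≤ bottom y j
    go (inj₁ none) = ≤-trans (≤-reflexive (trans (sum-≡ (λ t → ψ-neg (neg {t} (none t)))) (sum-0 (suc n)))) (sum-nonneg (λ t → ψ-nonneg {n} (y t - j)))
    go (inj₂ (t , p , q)) = ≤-trans (≤-reflexive (bottom≡partial j d t (λ s s≤t → ≤-trans p (floors-mono j dec s≤t)) (λ s t<s → neg (q s t<s))))
                              (≤-trans (h j t) (partial≤bottom j y t))

  ind : ℕ → Fin (suc n) → ℤ
  ind k t = if ⌊ toℕ t ℕ.<? k ⌋ then 1ℤ else 0ℤ

  -- For decreasing `y` the cutoff 0 controls all others; the case distinction is whether the entry
  -- of `y` at position k reaches the threshold.
  bottom⇒⊴ : ∀ {x y} → Decreasing y → (∀ j → bottom x j ≤ bottom y j) → x ⊴ y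
  bottom⇒⊴ {x} {y} dec h k j k≤n = go (≤⊎> 0ℤ (fl n (y t₀ - j)))
    where
    t₀ = Fin.fromℕ< (ℕ.s≤s k≤n)
    t₀≡k : toℕ t₀ ≡ k
    t₀≡k = toℕ-fromℕ< (ℕ.s≤s k≤n)
    h₀ : ∀ j → lev x 0 j ≤ lev y 0 j
    h₀ j = subst₂ _≤_ (sym (lev-bottom x j)) (sym (lev-bottom y j)) (h j)
    term : (Fin (suc n) → ℤ) → ℕ → Fin (suc n) → ℤ
    term f k t = ψ n (f t + bump k t - j)
    e₁ : ∀ a N j → a + N - j ≡ a - j + N
    e₁ = solve-∀
    term-< : ∀ f {k} t → toℕ t ℕ.< k → term f k t ≡ ψ n (f t - j + N n)
    term-< f t p = cong (ψ n) (trans (cong (λ b → f t + b - j) (bump-< t p)) (e₁ (f t) (N n) j))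
    term-≥ : ∀ f {k} t → k ℕ.≤ toℕ t → term f k t ≡ ψ n (f t - j)
    term-≥ f t p = cong (λ a → ψ n (a - j)) (trans (cong (_+_ (f t)) (bump-≥ t p)) (+-identityʳ (f t)))
    ind-< : ∀ t → toℕ t ℕ.< k → ind k t ≡ 1ℤ
    ind-< t p with toℕ t ℕ.<? k
    ... | yes _ = ≡.refl
    ... | no ¬p = ⊥-elim (¬p p)
    ind-≥ : ∀ t → k ℕ.≤ toℕ t → ind k t ≡ 0ℤ
    ind-≥ t p with toℕ t ℕ.<? k
    ... | yes q = ⊥-elim (ℕₚ.<⇒≱ q p)
    ... | no _ = ≡.refl
    x-ind : ∀ t → term x k t ≤ ind k t + term x 0 t
    x-ind t = case (toℕ t ℕ.<? k)
      where
      case : Dec (toℕ t ℕ.< k) → term x k t ≤ ind k t + term x 0 t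
      case (yes p) = subst₃' (sym (term-< x t p)) (sym (ind-< t p)) (sym (term-≥ x {0} t ℕ.z≤n)) (ψ+N≤1+ψ (x t - j))
        where
        subst₃' : ∀ {a a' b b' c c'} → a ≡ a' → b ≡ b' → c ≡ c' → a ≤ b + c → a' ≤ b' + c'
        subst₃' ≡.refl ≡.refl ≡.refl z = z
      case (no ¬p) = ≤-reflexive (trans (term-≥ x t (ℕₚ.≮⇒≥ ¬p)) (sym (trans (cong₂ _+_ (ind-≥ t (ℕₚ.≮⇒≥ ¬p)) (term-≥ x {0} t ℕ.z≤n)) (+-identityˡ _))))
    x-top : ∀ t → term x k t ≤ term x (suc n) t
    x-top t = case (toℕ t ℕ.<? k)
      where
      case : Dec (toℕ t ℕ.< k) → term x k t ≤ term x (suc n) t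
      case (yes p) = ≤-reflexive (trans (term-< x t p) (sym (term-< x t (toℕ<n t))))
      case (no ¬p) = subst₂ _≤_ (sym (term-≥ x t (ℕₚ.≮⇒≥ ¬p))) (sym (term-< x t (toℕ<n t))) (ψ≤ψ+N (x t - j))
    go : 0ℤ ≤ fl n (y t₀ - j) ⊎ 1ℤ + fl n (y t₀ - j) ≤ 0ℤ → lev x k j ≤ lev y k j
    -- Here y k ≥ j, so all positions 0, ..., k - 1 count for `y`, while at most k of them can count
    -- for `x`.
    go (inj₁ pos) = ≤-trans (sum-mono x-ind) (≤-trans (≤-reflexive (∑-distrib-+ (ind k) (term x 0)))
        (≤-trans (+-monoʳ-≤ (sum (ind k)) (h₀ j)) (≤-reflexive (sym (trans (sum-≡ y-ind) (∑-distrib-+ (ind k) (term y 0)))))))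
      where
      y-ind : ∀ t → term y k t ≡ ind k t + term y 0 t
      y-ind t = case (toℕ t ℕ.<? k)
        where
        step : toℕ t ℕ.< k → _ → ψ n (y t - j + N n) ≡ 1ℤ + ψ n (y t - j)
        step p (inj₁ (_ , e)) = e
        step p (inj₂ (q , _)) = ⊥-elim (1+a≰a (≤-trans q (≤-trans pos (floors-mono j dec (subst (toℕ t ℕ.≤_) (sym t₀≡k) (ℕₚ.<⇒≤ p))))))
        case : Dec (toℕ t ℕ.< k) → term y k t ≡ ind k t + term y 0 t
        case (yes p) = trans (term-< y t p) (trans (step p (ψ-step (y t - j))) (sym (cong₂ _+_ (ind-< t p) (term-≥ y {0} t ℕ.z≤n))))
        case (no ¬p) = trans (term-≥ y t (ℕₚ.≮⇒≥ ¬p)) (sym (trans (cong₂ _+_ (ind-≥ t (ℕₚ.≮⇒≥ ¬p)) (term-≥ y {0} t ℕ.z≤n)) (+-identityˡ _)))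
    -- Here y k < j, so none of the positions k, ..., n counts for `y`; the cutoff may be raised to
    -- n + 1, which is cutoff 0 with threshold j - N.
    go (inj₂ neg) = ≤-trans (sum-mono x-top) (≤-trans (subst₂ _≤_ (sym (lev-top x j)) (sym (lev-top y j)) (h₀ (j - N n)))
        (≤-reflexive (sym (sum-≡ y-top))))
      where
      y-top : ∀ t → term y k t ≡ term y (suc n) t
      y-top t = case (toℕ t ℕ.<? k)
        where
        step : k ℕ.≤ toℕ t → _ → ψ n (y t - j + N n) ≡ ψ n (y t - j)
        step p (inj₂ (_ , e)) = e
        step p (inj₁ (q , _)) = ⊥-elim (1+a≰a (≤-trans neg (≤-trans q (floors-mono j dec (subst (ℕ._≤ toℕ t) (sym t₀≡k) p)))))
        case : Dec (toℕ t ℕ.< k) → term y k t ≡ term y (suc n) t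
        case (yes p) = trans (term-< y t p) (sym (term-< y t (toℕ<n t)))
        case (no ¬p) = trans (term-≥ y t (ℕₚ.≮⇒≥ ¬p)) (trans (sym (step (ℕₚ.≮⇒≥ ¬p) (ψ-step (y t - j)))) (sym (term-< y t (toℕ<n t))))

  ⊴⇒≤ᴰ : ∀ x y (π : Permutation′ (suc n)) → Decreasing y → x ⊴ y → (λ t → x (π ⟨$⟩ʳ t)) ≤ᴰ y
  ⊴⇒≤ᴰ x y π dec h = bottom⇒≤ᴰ {λ t → x (π ⟨$⟩ʳ t)} {y} dec λ j → ≤-trans (≤-reflexive (bottom-perm x π j))
                        (subst₂ _≤_ (lev-bottom x j) (lev-bottom y j) (h 0 j ℕ.z≤n))

  ≤ᴰ⇒⊴ : ∀ x y (π : Permutation′ (suc n)) → Decreasing (λ t → x (π ⟨$⟩ʳ t)) → Decreasing y → (λ t → x (π ⟨$⟩ʳ t)) ≤ᴰ y → x ⊴ y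
  ≤ᴰ⇒⊴ x y π dx dec h = bottom⇒⊴ {x} {y} dec λ j → ≤-trans (≤-reflexive (sym (bottom-perm x π j)))
                        (≤ᴰ⇒bottom {λ t → x (π ⟨$⟩ʳ t)} {y} dx h j)

module _ {n : ℕ} (1≤n : 1 ℕ.≤ n) where

  ≤B⇒⊴ : ∀ {x y : Elt n} → x ≤B y → IsAff x × val x ⊴ val y
  ≤B⇒⊴ (ws , (≡.refl , m) , us , p , ≡.refl) = isAff-word 1≤n us , subword⇒⊴ 1≤n p (minimal⇒AscWord 1≤n ws m)

-- Rational points and their periodic extension

private
  toℚᵘ-/1 : ∀ z → ℚ.toℚᵘ (ℤtoℚ z) ℚᵘ.≃ mkℚᵘ z 0
  toℚᵘ-/1 z = ℚₚ.toℚᵘ-fromℚᵘ (mkℚᵘ z 0)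

ℤtoℚ-+ : ∀ a b → ℤtoℚ (a + b) ≡ ℤtoℚ a ℚ.+ ℤtoℚ b
ℤtoℚ-+ a b = ℚₚ.toℚᵘ-injective (begin
  ℚ.toℚᵘ (ℤtoℚ (a + b))                        ≈⟨ toℚᵘ-/1 (a + b) ⟩
  mkℚᵘ (a + b) 0                               ≈⟨ *≡* (eq a b) ⟩
  mkℚᵘ a 0 ℚᵘ.+ mkℚᵘ b 0                       ≈⟨ ℚᵘₚ.+-cong (toℚᵘ-/1 a) (toℚᵘ-/1 b) ⟨
  ℚ.toℚᵘ (ℤtoℚ a) ℚᵘ.+ ℚ.toℚᵘ (ℤtoℚ b)         ≈⟨ ℚₚ.toℚᵘ-homo-+ (ℤtoℚ a) (ℤtoℚ b) ⟨
  ℚ.toℚᵘ (ℤtoℚ a ℚ.+ ℤtoℚ b)                   ∎)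
  where
  open ℚᵘₚ.≃-Reasoning
  eq : ∀ a b → (a + b) * 1ℤ ≡ (a * 1ℤ + b * 1ℤ) * 1ℤ
  eq = solve-∀

ℤtoℚ-* : ∀ a b → ℤtoℚ (a * b) ≡ ℤtoℚ a ℚ.* ℤtoℚ b
ℤtoℚ-* a b = ℚₚ.toℚᵘ-injective (begin
  ℚ.toℚᵘ (ℤtoℚ (a * b))                        ≈⟨ toℚᵘ-/1 (a * b) ⟩
  mkℚᵘ (a * b) 0                               ≈⟨ *≡* ≡.refl ⟩
  mkℚᵘ a 0 ℚᵘ.* mkℚᵘ b 0                       ≈⟨ ℚᵘₚ.*-cong (toℚᵘ-/1 a) (toℚᵘ-/1 b) ⟨
  ℚ.toℚᵘ (ℤtoℚ a) ℚᵘ.* ℚ.toℚᵘ (ℤtoℚ b)         ≈⟨ ℚₚ.toℚᵘ-homo-* (ℤtoℚ a) (ℤtoℚ b) ⟨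
  ℚ.toℚᵘ (ℤtoℚ a ℚ.* ℤtoℚ b)                   ∎)
  where open ℚᵘₚ.≃-Reasoning

ℤtoℚ-neg : ∀ a → ℤtoℚ (- a) ≡ ℚ.- ℤtoℚ a
ℤtoℚ-neg a = ℚₚ.toℚᵘ-injective (begin
  ℚ.toℚᵘ (ℤtoℚ (- a))                          ≈⟨ toℚᵘ-/1 (- a) ⟩
  ℚᵘ.- mkℚᵘ a 0                                ≈⟨ ℚᵘₚ.-‿cong (toℚᵘ-/1 a) ⟨
  ℚᵘ.- ℚ.toℚᵘ (ℤtoℚ a)                         ≈⟨ ℚₚ.toℚᵘ-homo‿- (ℤtoℚ a) ⟨
  ℚ.toℚᵘ (ℚ.- ℤtoℚ a)                          ∎)
  where open ℚᵘₚ.≃-Reasoning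

ℤtoℚ-- : ∀ a b → ℤtoℚ (a - b) ≡ ℤtoℚ a ℚ.- ℤtoℚ b
ℤtoℚ-- a b = trans (ℤtoℚ-+ a (- b)) (cong (ℤtoℚ a ℚ.+_) (ℤtoℚ-neg b))

ℤtoℚ-injective : ∀ {a b} → ℤtoℚ a ≡ ℤtoℚ b → a ≡ b
ℤtoℚ-injective {a} {b} e = drop (ℚᵘₚ.≃-trans (ℚᵘₚ.≃-sym (toℚᵘ-/1 a)) (ℚᵘₚ.≃-trans (ℚᵘₚ.≃-reflexive (cong ℚ.toℚᵘ e)) (toℚᵘ-/1 b)))
  where
  drop : mkℚᵘ a 0 ℚᵘ.≃ mkℚᵘ b 0 → a ≡ b
  drop (*≡* p) = trans (sym (*-identityʳ a)) (trans p (*-identityʳ b))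

ℤtoℚ-mono : ∀ {a b} → a ≤ b → ℤtoℚ a ℚ.≤ ℤtoℚ b
ℤtoℚ-mono {a} {b} p = ℚₚ.toℚᵘ-cancel-≤ (ℚᵘₚ.≤-respˡ-≃ (ℚᵘₚ.≃-sym (toℚᵘ-/1 a)) (ℚᵘₚ.≤-respʳ-≃ (ℚᵘₚ.≃-sym (toℚᵘ-/1 b))
  (*≤* (subst₂ _≤_ (sym (*-identityʳ a)) (sym (*-identityʳ b)) p))))

abstract

  -- Opaque, so that the ring solver sees a variable ν with N ν = 1; `/N` rewrites the fractions in
  -- `ϖ` in terms of it.
  1/N : ℕ → ℚ
  1/N n = (+ 1) ℚ./ suc n

  /N : ∀ n k → (+ k) ℚ./ suc n ≡ ℤtoℚ (+ k) ℚ.* 1/N n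
  /N n k = ℚₚ.toℚᵘ-injective (begin
    ℚ.toℚᵘ ((+ k) ℚ./ suc n)                     ≈⟨ ℚₚ.toℚᵘ-fromℚᵘ (mkℚᵘ (+ k) n) ⟩
    mkℚᵘ (+ k) n                                 ≈⟨ *≡* (trans (cong (λ d → + k * + d) (ℕₚ.+-identityʳ (suc n))) (cong (_* + suc n) (sym (*-identityʳ (+ k))))) ⟩
    mkℚᵘ (+ k) 0 ℚᵘ.* mkℚᵘ (+ 1) n               ≈⟨ ℚᵘₚ.*-cong (toℚᵘ-/1 (+ k)) (ℚₚ.toℚᵘ-fromℚᵘ (mkℚᵘ (+ 1) n)) ⟨
    ℚ.toℚᵘ (ℤtoℚ (+ k)) ℚᵘ.* ℚ.toℚᵘ (1/N n)      ≈⟨ ℚₚ.toℚᵘ-homo-* (ℤtoℚ (+ k)) (1/N n) ⟨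
    ℚ.toℚᵘ (ℤtoℚ (+ k) ℚ.* 1/N n)                ∎)
    where open ℚᵘₚ.≃-Reasoning

  N*1/N : ∀ n → ℤtoℚ (N n) ℚ.* 1/N n ≡ 1ℚ
  N*1/N n = ℚₚ.toℚᵘ-injective (begin
    ℚ.toℚᵘ (ℤtoℚ (N n) ℚ.* 1/N n)                ≈⟨ ℚₚ.toℚᵘ-homo-* (ℤtoℚ (N n)) (1/N n) ⟩
    ℚ.toℚᵘ (ℤtoℚ (N n)) ℚᵘ.* ℚ.toℚᵘ (1/N n)      ≈⟨ ℚᵘₚ.*-cong (toℚᵘ-/1 (N n)) (ℚₚ.toℚᵘ-fromℚᵘ (mkℚᵘ (+ 1) n)) ⟩
    mkℚᵘ (N n) 0 ℚᵘ.* mkℚᵘ (+ 1) n               ≈⟨ *≡* (eq (N n) ≡.refl) ⟩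
    ℚ.toℚᵘ 1ℚ                                    ∎)
    where
    open ℚᵘₚ.≃-Reasoning
    eq : ∀ z → z ≡ + suc n → z * 1ℤ * 1ℤ ≡ 1ℤ * (+ suc (n ℕ.+ 0))
    eq z ≡.refl = trans (trans (*-identityʳ (z * 1ℤ)) (*-identityʳ z))
                        (sym (trans (*-identityˡ (+ suc (n ℕ.+ 0))) (cong (λ m → + suc m) (ℕₚ.+-identityʳ n))))

  1/N-positive : ∀ n → ℚ.Positive (1/N n)
  1/N-positive n = ℚₚ.normalize-pos 1 (suc n)

sumℚ-cong : ∀ m {f g : Fin m → ℚ} → (∀ i → f i ≡ g i) → sumℚ m f ≡ sumℚ m g
sumℚ-cong zero    h = ≡.refl
sumℚ-cong (suc m) h = cong₂ ℚ._+_ (h zero) (sumℚ-cong m (λ i → h (suc i)))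

sumℚ-+ : ∀ m (f g : Fin m → ℚ) → sumℚ m (λ i → f i ℚ.+ g i) ≡ sumℚ m f ℚ.+ sumℚ m g
sumℚ-+ zero    f g = ≡.refl
sumℚ-+ (suc m) f g = trans (cong ((f zero ℚ.+ g zero) ℚ.+_) (sumℚ-+ m _ _)) (eq (f zero) (g zero) _ _)
  where
  open +-*-Solver
  eq : ∀ a b c d → (a ℚ.+ b) ℚ.+ (c ℚ.+ d) ≡ (a ℚ.+ c) ℚ.+ (b ℚ.+ d)
  eq = solve 4 (λ a b c d → (a :+ b) :+ (c :+ d) := (a :+ c) :+ (b :+ d)) ≡.refl

sumℚ-* : ∀ m (f : Fin m → ℚ) c → sumℚ m (λ i → f i ℚ.* c) ≡ sumℚ m f ℚ.* c
sumℚ-* zero    f c = sym (ℚₚ.*-zeroˡ c)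
sumℚ-* (suc m) f c = trans (cong (f zero ℚ.* c ℚ.+_) (sumℚ-* m _ c)) (sym (ℚₚ.*-distribʳ-+ c (f zero) _))

sumℚ-ℤ : ∀ m (f : Fin m → ℤ) → sumℚ m (λ i → ℤtoℚ (f i)) ≡ ℤtoℚ (sum f)
sumℚ-ℤ zero    f = ≡.refl
sumℚ-ℤ (suc m) f = trans (cong (ℤtoℚ (f zero) ℚ.+_) (sumℚ-ℤ m (λ i → f (suc i)))) (sym (ℤtoℚ-+ (f zero) _))

sumℚ-const : ∀ m c → sumℚ m (λ _ → c) ≡ ℤtoℚ (+ m) ℚ.* c
sumℚ-const zero    c = sym (ℚₚ.*-zeroˡ c)
sumℚ-const (suc m) c = trans (cong (c ℚ.+_) (sumℚ-const m c)) (trans (eq c (ℤtoℚ (+ m))) (cong (ℚ._* c) (sym (ℤtoℚ-+ 1ℤ (+ m)))))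
  where
  open +-*-Solver
  eq : ∀ c a → c ℚ.+ a ℚ.* c ≡ (1ℚ ℚ.+ a) ℚ.* c
  eq = solve 2 (λ c a → c :+ a :* c := (con 1ℚ :+ a) :* c) ≡.refl

module _ {n : ℕ} where

  -- Satisfies `ext q (z + N) = ext q z + 1`; acting by an element means evaluating at its window
  -- (`act-ext`).
  ext : Pt n → ℤ → ℚ
  ext q z = q (proj₁ (digits {n} z)) ℚ.+ ℤtoℚ (fl n z)

  ext-digit : ∀ q i m → ext q (+ toℕ i + N n * m) ≡ q i ℚ.+ ℤtoℚ m
  ext-digit q i m = cong₂ (λ i m → q i ℚ.+ ℤtoℚ m) (sym (proj₁ dg)) (fl-digit i m)
    where
    z = + toℕ i + N n * m
    dg : i ≡ proj₁ (digits z) × m ≡ fl n z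
    dg = digit-inj {n} {i} {proj₁ (digits z)} {m} {fl n z} (proj₂ (digits z))

  act-ext : ∀ w q t → act n w q t ≡ ext q (val w t)
  act-ext w q t = sym (ext-digit q (perm w t) (shift w t))

  ext-pos : ∀ q i → ext q (+ toℕ i) ≡ q i
  ext-pos q i = trans (cong (ext q) (eq (+ toℕ i) (N n))) (trans (ext-digit q i 0ℤ) (ℚₚ.+-identityʳ (q i)))
    where
    eq : ∀ a N → a ≡ a + N * 0ℤ
    eq = solve-∀

  ext-period : ∀ q z m → ext q (z + N n * m) ≡ ext q z ℚ.+ ℤtoℚ m
  ext-period q z m = trans (cong (ext q) (trans (cong (_+ (N n * m)) (proj₂ (digits z))) (eq (+ toℕ i) (N n) (fl n z) m)))
    (trans (ext-digit q i (fl n z + m)) (trans (cong (q i ℚ.+_) (ℤtoℚ-+ (fl n z) m)) (sym (ℚₚ.+-assoc (q i) (ℤtoℚ (fl n z)) (ℤtoℚ m)))))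
    where
    i = proj₁ (digits {n} z)
    eq : ∀ a N f m → a + N * f + N * m ≡ a + N * (f + m)
    eq = solve-∀

  private
    0<y-x : ∀ {x y} → x ℚ.- y ℚ.< 0ℚ → x ℚ.< y
    0<y-x {x} {y} p = subst₂ ℚ._<_ (eq x y) (ℚₚ.+-identityˡ y) (ℚₚ.+-monoˡ-< y p)
      where
      open +-*-Solver
      eq : ∀ x y → (x ℚ.- y) ℚ.+ y ≡ x
      eq = solve 2 (λ x y → (x :- y) :+ y := x) ≡.refl
    y<x+1 : ∀ {x y} → (ℚ.- 1ℚ) ℚ.< x ℚ.- y → y ℚ.< x ℚ.+ 1ℚ
    y<x+1 {x} {y} p = subst₂ ℚ._<_ (eq₁ y) (eq₂ x y) (ℚₚ.+-monoˡ-< (y ℚ.+ 1ℚ) p)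
      where
      open +-*-Solver
      eq₁ : ∀ y → (ℚ.- 1ℚ) ℚ.+ (y ℚ.+ 1ℚ) ≡ y
      eq₁ = solve 1 (λ y → (:- con 1ℚ) :+ (y :+ con 1ℚ) := y) ≡.refl
      eq₂ : ∀ x y → (x ℚ.- y) ℚ.+ (y ℚ.+ 1ℚ) ≡ x ℚ.+ 1ℚ
      eq₂ = solve 2 (λ x y → (x :- y) :+ (y :+ con 1ℚ) := x :+ con 1ℚ) ≡.refl

  Aid-< : ∀ {q} → InAid n q → ∀ i j → toℕ i ℕ.< toℕ j → q i ℚ.< q j
  Aid-< {q} (_ , A) i j p = 0<y-x (proj₂ (A i j p))

  Aid-<+1 : ∀ {q} → InAid n q → ∀ i j → q i ℚ.< q j ℚ.+ 1ℚ
  Aid-<+1 {q} (E , A) i j = go (ℕₚ.<-cmp (toℕ i) (toℕ j))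
    where
    up : ∀ x → x ℚ.< x ℚ.+ 1ℚ
    up x = subst (ℚ._< x ℚ.+ 1ℚ) (ℚₚ.+-identityʳ x) (ℚₚ.+-monoʳ-< x (ℚ.*<* (ℤ.+<+ (ℕ.s≤s ℕ.z≤n))))
    go : _ → q i ℚ.< q j ℚ.+ 1ℚ
    go (tri< p _ _) = ℚₚ.<-trans (Aid-< {q} (E , A) i j p) (up (q j))
    go (tri≈ _ p _) = subst (λ k → q i ℚ.< q k ℚ.+ 1ℚ) (toℕ-injective p) (up (q i))
    go (tri> _ _ p) = y<x+1 {q j} {q i} (proj₁ (A j i p))

  -- The inequalities of A_id say q 0 < ... < q n < q 0 + 1, so the extension also increases from
  -- one period to the next.
  ext-mono-< : ∀ {q} → InAid n q → ∀ {z z'} → 1ℤ + z ≤ z' → ext q z ℚ.< ext q z'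
  ext-mono-< {q} A {z} {z'} p = go (ℤₚ.<-cmp (fl n z) (fl n z'))
    where
    i = proj₁ (digits {n} z)
    j = proj₁ (digits {n} z')
    open +-*-Solver
    eq : ∀ a b → a ℚ.+ 1ℚ ℚ.+ b ≡ a ℚ.+ (1ℚ ℚ.+ b)
    eq = solve 2 (λ a b → a :+ con 1ℚ :+ b := a :+ (con 1ℚ :+ b)) ≡.refl
    e₁ : ∀ i j m → j - (1ℤ + i) ≡ j + m - (1ℤ + (i + m))
    e₁ = solve-∀
    go : _ → ext q z ℚ.< ext q z'
    go (tri< m<m' _ _) = ℚₚ.<-≤-trans (ℚₚ.+-monoˡ-< (ℤtoℚ (fl n z)) (Aid-<+1 {q} A i j))
      (ℚₚ.≤-trans (ℚₚ.≤-reflexive (trans (eq (q j) (ℤtoℚ (fl n z))) (cong (q j ℚ.+_) (sym (ℤtoℚ-+ 1ℤ (fl n z))))))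
        (ℚₚ.+-monoʳ-≤ (q j) (ℤtoℚ-mono (i<j⇒suc[i]≤j m<m'))))
    go (tri≈ _ m≡m' _) = subst (λ m → ext q z ℚ.< q j ℚ.+ ℤtoℚ m) m≡m' (ℚₚ.+-monoˡ-< (ℤtoℚ (fl n z)) (Aid-< {q} A i j
      (drop‿+≤+ (lin (subst₂ (λ a b → 1ℤ + a ≤ b) (proj₂ (digits z)) (trans (proj₂ (digits z')) (cong (λ m → + toℕ j + N n * m) (sym m≡m'))) p)
        (e₁ (+ toℕ i) (+ toℕ j) (N n * fl n z))))))
    go (tri> _ _ m'<m) = ⊥-elim (<⇒≱ m'<m (fl-mono (1+≤⇒≤ p)))

  ext-cancel-≤ : ∀ {q} → InAid n q → ∀ {z z'} → ext q z ℚ.≤ ext q z' → z ≤ z'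
  ext-cancel-≤ {q} A {z} {z'} p = go (≤⊎> z z')
    where
    go : _ → z ≤ z'
    go (inj₁ r) = r
    go (inj₂ r) = ⊥-elim (ℚₚ.<-irrefl ≡.refl (ℚₚ.<-≤-trans (ext-mono-< {q} A r) p))

  ℤ-invariant : (G : ℤ → ℚ) → (∀ z → G (1ℤ + z) ≡ G z) → ∀ z → G z ≡ G 0ℤ
  ℤ-invariant G h (+ zero)         = ≡.refl
  ℤ-invariant G h (+ suc k)        = trans (h (+ k)) (ℤ-invariant G h (+ k))
  ℤ-invariant G h ℤ.-[1+ zero ]    = sym (h ℤ.-[1+ 0 ])
  ℤ-invariant G h ℤ.-[1+ suc k ]   = trans (sym (h ℤ.-[1+ suc k ])) (ℤ-invariant G h ℤ.-[1+ k ])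

  sumℚ-telescope : ∀ m (h : ℤ → ℚ) κ → h κ ℚ.+ sumℚ m (λ i → h (+ toℕ i + (1ℤ + κ))) ≡ sumℚ m (λ i → h (+ toℕ i + κ)) ℚ.+ h (+ m + κ)
  sumℚ-telescope zero h κ = trans (ℚₚ.+-identityʳ (h κ)) (trans (cong h (sym (+-identityˡ κ))) (sym (ℚₚ.+-identityˡ _)))
  sumℚ-telescope (suc m) h κ = trans (cong₂ ℚ._+_ (cong h (sym (+-identityˡ κ)))
      (trans (cong₂ ℚ._+_ (cong h (+-identityˡ (1ℤ + κ))) (sumℚ-cong m (λ i → cong h (eq (+ toℕ i) κ)))) (sumℚ-telescope m h (1ℤ + κ))))
    (trans (sym (ℚₚ.+-assoc (h (0ℤ + κ)) _ _)) (cong₂ ℚ._+_ (cong (h (0ℤ + κ) ℚ.+_) (sumℚ-cong m (λ i → cong h (eq' (+ toℕ i) κ)))) (cong h (eq' (+ m) κ))))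
    where
    eq : ∀ t κ → 1ℤ + t + (1ℤ + κ) ≡ t + (1ℤ + (1ℤ + κ))
    eq = solve-∀
    eq' : ∀ t κ → t + (1ℤ + κ) ≡ 1ℤ + t + κ
    eq' = solve-∀

  -- Moving the range of summation by one trades `ext q κ` for `ext q (κ + N)`, which is larger by
  -- 1.
  ext-sum : ∀ {q} → InE n q → ∀ κ → sumℚ (suc n) (λ i → ext q (+ toℕ i + κ)) ≡ ℤtoℚ κ
  ext-sum {q} E κ = trans (eq₃ (Θ κ) (ℤtoℚ κ) (ℤ-invariant (λ κ → Θ κ ℚ.- ℤtoℚ κ) step κ)) (trans (cong (ℤtoℚ κ ℚ.+_) Θ0) (ℚₚ.+-identityʳ (ℤtoℚ κ)))
    where
    open +-*-Solver
    Θ : ℤ → ℚ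
    Θ κ = sumℚ (suc n) (λ i → ext q (+ toℕ i + κ))
    eq₀ : ∀ t k c → (t ℚ.+ (c ℚ.+ 1ℚ)) ℚ.- c ℚ.- (1ℚ ℚ.+ k) ≡ t ℚ.- k
    eq₀ = solve 3 (λ t k c → (t :+ (c :+ con 1ℚ)) :- c :- (con 1ℚ :+ k) := t :- k) ≡.refl
    eq₁ : ∀ c t k → t ℚ.- k ≡ (c ℚ.+ t) ℚ.- c ℚ.- k
    eq₁ = solve 3 (λ c t k → t :- k := (c :+ t) :- c :- k) ≡.refl
    eq₂ : ∀ N κ → N + κ ≡ κ + N * 1ℤ
    eq₂ = solve-∀
    eq₄ : ∀ t k → t ≡ k ℚ.+ (t ℚ.- k)
    eq₄ = solve 2 (λ t k → t := k :+ (t :- k)) ≡.refl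
    eq₃ : ∀ t k → t ℚ.- k ≡ Θ 0ℤ ℚ.- ℤtoℚ 0ℤ → t ≡ k ℚ.+ (Θ 0ℤ ℚ.- ℤtoℚ 0ℤ)
    eq₃ t k e = trans (eq₄ t k) (cong (k ℚ.+_) e)
    step : ∀ κ → Θ (1ℤ + κ) ℚ.- ℤtoℚ (1ℤ + κ) ≡ Θ κ ℚ.- ℤtoℚ κ
    step κ = trans (eq₁ (ext q κ) (Θ (1ℤ + κ)) (ℤtoℚ (1ℤ + κ))) (trans (cong₂ (λ a b → a ℚ.- ext q κ ℚ.- b)
      (trans (sumℚ-telescope (suc n) (ext q) κ) (cong (Θ κ ℚ.+_) (trans (cong (ext q) (eq₂ (N n) κ)) (ext-period q κ 1ℤ)))) (ℤtoℚ-+ 1ℤ κ)) (eq₀ (Θ κ) (ℤtoℚ κ) (ext q κ)))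
    Θ0 : Θ 0ℤ ℚ.- ℤtoℚ 0ℤ ≡ 0ℚ
    Θ0 = trans (ℚₚ.+-identityʳ (Θ 0ℤ)) (trans (sumℚ-cong (suc n) (λ i → trans (cong (ext q) (+-identityʳ (+ toℕ i))) (ext-pos q i))) E)

-- Alcoves

module _ {n : ℕ} where

  -- A symmetry of A_id, coming from the length-zero elements of the extended affine Weyl group: the
  -- index moves by κ and the point is recentred to sum 0. It accounts for weights outside the root
  -- lattice.
  rot : ℤ → Pt n → Pt n
  rot κ q k = ext q (+ toℕ k + κ) ℚ.- ℤtoℚ κ ℚ.* 1/N n

  ext-rot : ∀ κ q z → ext (rot κ q) z ≡ ext q (z + κ) ℚ.- ℤtoℚ κ ℚ.* 1/N n
  ext-rot κ q z = trans (eq₁ (ext q (+ toℕ i + κ)) c (ℤtoℚ (fl n z))) (cong (ℚ._- c)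
      (trans (sym (ext-period q (+ toℕ i + κ) (fl n z))) (cong (ext q) (trans (eq₂ (+ toℕ i) κ (N n * fl n z)) (cong (_+ κ) (sym (proj₂ (digits z))))))))
    where
    i = proj₁ (digits {n} z)
    c = ℤtoℚ κ ℚ.* 1/N n
    open +-*-Solver
    eq₁ : ∀ a c m → (a ℚ.- c) ℚ.+ m ≡ (a ℚ.+ m) ℚ.- c
    eq₁ = solve 3 (λ a c m → (a :- c) :+ m := (a :+ m) :- c) ≡.refl
    eq₂ : ∀ i κ m → i + κ + m ≡ i + m + κ
    eq₂ = solve-∀

  rot-Aid : ∀ κ {q} → InAid n q → InAid n (rot κ q)
  rot-Aid κ {q} A = E' , λ i j p → lower i j p , upper i j p
    where
    open +-*-Solver
    c = ℤtoℚ κ ℚ.* 1/N n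
    eq₀ : ∀ k ν N → N ℚ.* ν ≡ 1ℚ → k ℚ.+ N ℚ.* (ℚ.- (k ℚ.* ν)) ≡ 0ℚ
    eq₀ k ν N e = trans (l k ν N) (trans (cong (λ z → k ℚ.- k ℚ.* z) e) (l' k))
      where
      l : ∀ k ν N → k ℚ.+ N ℚ.* (ℚ.- (k ℚ.* ν)) ≡ k ℚ.- k ℚ.* (N ℚ.* ν)
      l = solve 3 (λ k ν N → k :+ N :* (:- (k :* ν)) := k :- k :* (N :* ν)) ≡.refl
      l' : ∀ k → k ℚ.- k ℚ.* 1ℚ ≡ 0ℚ
      l' = solve 1 (λ k → k :- k :* con 1ℚ := con 0ℚ) ≡.refl
    E' : InE n (rot κ q)
    E' = trans (sumℚ-+ (suc n) (λ k → ext q (+ toℕ k + κ)) (λ _ → ℚ.- c)) (trans (cong₂ ℚ._+_ (ext-sum {n} {q} (proj₁ A) κ) (sumℚ-const (suc n) (ℚ.- c)))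
           (eq₀ (ℤtoℚ κ) (1/N n) (ℤtoℚ (N n)) (N*1/N n)))
    upper : ∀ i j → toℕ i ℕ.< toℕ j → pair n (rot κ q) i j ℚ.< 0ℚ
    upper i j p = subst₂ ℚ._<_ (eq (ext q (+ toℕ i + κ)) (ext q (+ toℕ j + κ)) c) (ℚₚ.+-inverseʳ (ext q (+ toℕ j + κ)))
        (ℚₚ.+-monoˡ-< (ℚ.- ext q (+ toℕ j + κ)) (ext-mono-< {n} {q} A (lin (+≤+ p) (e (+ toℕ i) (+ toℕ j) κ))))
      where
      e : ∀ i j κ → j + κ - (1ℤ + (i + κ)) ≡ j - (1ℤ + i)
      e = solve-∀
      eq : ∀ a b c → a ℚ.- b ≡ (a ℚ.- c) ℚ.- (b ℚ.- c)
      eq = solve 3 (λ a b c → a :- b := (a :- c) :- (b :- c)) ≡.refl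
    lower : ∀ i j → toℕ i ℕ.< toℕ j → (ℚ.- 1ℚ) ℚ.< pair n (rot κ q) i j
    lower i j p = subst₂ ℚ._<_ (eq₁ b) (eq₂ a b c) (ℚₚ.+-monoˡ-< (ℚ.- b ℚ.- 1ℚ)
        (subst (b ℚ.<_) (ext-period q (+ toℕ i + κ) 1ℤ) (ext-mono-< {n} {q} A
          (lin (+≤+ (ℕₚ.≤-trans (toℕ<n j) (ℕₚ.m≤m+n (suc n) (toℕ i)))) (e (+ toℕ i) (+ toℕ j) κ (N n) _ (pos-+ (suc n) (toℕ i)))))))
      where
      a = ext q (+ toℕ i + κ)
      b = ext q (+ toℕ j + κ)
      e' : ∀ i j κ N → i + κ + N * 1ℤ - (1ℤ + (j + κ)) ≡ N + i - (1ℤ + j)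
      e' = solve-∀
      e : ∀ i j κ N s → s ≡ N + i → i + κ + N * 1ℤ - (1ℤ + (j + κ)) ≡ s - (1ℤ + j)
      e i j κ N s ≡.refl = e' i j κ N
      eq₁ : ∀ b → b ℚ.+ (ℚ.- b ℚ.- 1ℚ) ≡ ℚ.- 1ℚ
      eq₁ = solve 1 (λ b → b :+ (:- b :- con 1ℚ) := :- con 1ℚ) ≡.refl
      eq₂ : ∀ a b c → (a ℚ.+ 1ℚ) ℚ.+ (ℚ.- b ℚ.- 1ℚ) ≡ (a ℚ.- c) ℚ.- (b ℚ.- c)
      eq₂ = solve 3 (λ a b c → (a :+ con 1ℚ) :+ (:- b :- con 1ℚ) := (a :- c) :- (b :- c)) ≡.refl

  -- The interior point -ρ/(n + 1) of A_id, at which alcoves are tested.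
  center : Pt n
  center k = ℤtoℚ (+ toℕ k) ℚ.* 1/N n ℚ.- sumℚ (suc n) (λ k → ℤtoℚ (+ toℕ k) ℚ.* 1/N n) ℚ.* 1/N n

  center-Aid : InAid n center
  center-Aid = E' , λ i j p → lower i j p , upper i j p
    where
    open +-*-Solver
    ν = 1/N n
    m = sumℚ (suc n) (λ k → ℤtoℚ (+ toℕ k) ℚ.* ν)
    instance
      ν>0 : ℚ.Positive ν
      ν>0 = 1/N-positive n
    l : ∀ k ν N → k ℚ.+ N ℚ.* (ℚ.- (k ℚ.* ν)) ≡ k ℚ.- k ℚ.* (N ℚ.* ν)
    l = solve 3 (λ k ν N → k :+ N :* (:- (k :* ν)) := k :- k :* (N :* ν)) ≡.refl
    l' : ∀ k → k ℚ.- k ℚ.* 1ℚ ≡ 0ℚ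
    l' = solve 1 (λ k → k :- k :* con 1ℚ := con 0ℚ) ≡.refl
    E' : InE n center
    E' = trans (sumℚ-+ (suc n) (λ k → ℤtoℚ (+ toℕ k) ℚ.* ν) (λ _ → ℚ.- (m ℚ.* ν))) (trans (cong (m ℚ.+_) (sumℚ-const (suc n) (ℚ.- (m ℚ.* ν))))
          (trans (l m ν (ℤtoℚ (N n))) (trans (cong (λ z → m ℚ.- m ℚ.* z) (N*1/N n)) (l' m))))
    strict : ∀ {a b} → 1ℤ + a ≤ b → ℤtoℚ a ℚ.* ν ℚ.< ℤtoℚ b ℚ.* ν
    strict {a} {b} p = ℚₚ.*-monoˡ-<-pos ν (ℚₚ.<-≤-trans (subst₂' (ℚₚ.+-monoˡ-< (ℤtoℚ a) {0ℚ} {1ℚ} (ℚ.*<* (ℤ.+<+ (ℕ.s≤s ℕ.z≤n))))) (ℤtoℚ-mono p))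
      where
      subst₂' : 0ℚ ℚ.+ ℤtoℚ a ℚ.< 1ℚ ℚ.+ ℤtoℚ a → ℤtoℚ a ℚ.< ℤtoℚ (1ℤ + a)
      subst₂' = subst₂ ℚ._<_ (ℚₚ.+-identityˡ (ℤtoℚ a)) (sym (ℤtoℚ-+ 1ℤ a))
    upper : ∀ i j → toℕ i ℕ.< toℕ j → pair n center i j ℚ.< 0ℚ
    upper i j p = subst₂ ℚ._<_ (eq a b (m ℚ.* ν)) (ℚₚ.+-inverseʳ b) (ℚₚ.+-monoˡ-< (ℚ.- b) (strict {+ toℕ i} {+ toℕ j} (+≤+ p)))
      where
      a = ℤtoℚ (+ toℕ i) ℚ.* ν
      b = ℤtoℚ (+ toℕ j) ℚ.* ν
      eq : ∀ a b c → a ℚ.- b ≡ (a ℚ.- c) ℚ.- (b ℚ.- c)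
      eq = solve 3 (λ a b c → a :- b := (a :- c) :- (b :- c)) ≡.refl
    lower : ∀ i j → toℕ i ℕ.< toℕ j → (ℚ.- 1ℚ) ℚ.< pair n center i j
    lower i j p = subst₂ ℚ._<_ (eq₁ b) (eq₂ a b (m ℚ.* ν)) (ℚₚ.+-monoˡ-< (ℚ.- b ℚ.- 1ℚ) (subst (b ℚ.<_) eq₃
                    (strict {+ toℕ j} {+ toℕ i + N n} (+≤+ (ℕₚ.≤-trans (toℕ<n j) (ℕₚ.m≤n+m (suc n) (toℕ i)))))))
      where
      a = ℤtoℚ (+ toℕ i) ℚ.* ν
      b = ℤtoℚ (+ toℕ j) ℚ.* ν
      eq₃ : ℤtoℚ (+ toℕ i + N n) ℚ.* ν ≡ a ℚ.+ 1ℚ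
      eq₃ = trans (cong (ℚ._* ν) (ℤtoℚ-+ (+ toℕ i) (N n))) (trans (ℚₚ.*-distribʳ-+ ν (ℤtoℚ (+ toℕ i)) (ℤtoℚ (N n))) (cong (a ℚ.+_) (N*1/N n)))
      eq₁ : ∀ b → b ℚ.+ (ℚ.- b ℚ.- 1ℚ) ≡ ℚ.- 1ℚ
      eq₁ = solve 1 (λ b → b :+ (:- b :- con 1ℚ) := :- con 1ℚ) ≡.refl
      eq₂ : ∀ a b c → (a ℚ.+ 1ℚ) ℚ.+ (ℚ.- b ℚ.- 1ℚ) ≡ (a ℚ.- c) ℚ.- (b ℚ.- c)
      eq₂ = solve 3 (λ a b c → (a :+ con 1ℚ) :+ (:- b :- con 1ℚ) := (a :- c) :- (b :- c)) ≡.refl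

  act-∘ : ∀ u w q t → act n (u ∘ₑ w) q t ≡ act n w q (perm u t) ℚ.+ ℤtoℚ (shift u t)
  act-∘ u w q t = trans (act-ext (u ∘ₑ w) q t) (trans (cong (ext q) (val-∘ u w t))
    (trans (ext-period q (val w (perm u t)) (shift u t)) (cong (ℚ._+ ℤtoℚ (shift u t)) (sym (act-ext w q (perm u t))))))

-- An alcove determines its element

module _ {n : ℕ} (1≤n : 1 ℕ.≤ n) where

  -- Stated for a word so that its letters move to the other side one by one. Once the word is
  -- empty, a descent of `y` would contradict that the extensions of both points increase.
  sameAlcove : ∀ ws {y q q'} → IsAff {n} y → InAid n q → InAid n q' → (∀ t → act n (evalWord n ws) q t ≡ act n y q' t) → evalWord n ws ≡ y
  sameAlcove List.[] {y} {q} {q'} G A A' h = sym (noDescent⇒id 1≤n G (λ g → asc g (descent⊎ascent 1≤n g G)))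
    where
    pt : ∀ t → ext q (+ toℕ t) ≡ ext q' (val y t)
    pt t = trans (cong (ext q) (sym (val-id t))) (trans (sym (act-ext (idₑ n) q t)) (trans (h t) (act-ext y q' t)))
    asc : ∀ g → Descent g (val y) ⊎ Ascent g (val y) → Ascent g (val y)
    asc g (inj₂ a) = a
    asc g (inj₁ d) = ⊥-elim (ℚₚ.<-irrefl ≡.refl (ℚₚ.<-trans
        (subst₂ ℚ._<_ (sym (pt (highPos g))) (trans (ext-period q' (val y (lowPos g)) (wrap g)) (trans (cong (ℚ._+ ℤtoℚ (wrap g)) (sym (pt (lowPos g)))) (sym (ext-period q (+ toℕ (lowPos g)) (wrap g)))))
          (ext-mono-< {n} {q'} A' d))
        (ext-mono-< {n} {q} A (≤-reflexive (trans (sym (+-assoc 1ℤ (+ toℕ (lowPos g)) (off g))) (sym (pos-high g)))))))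
  sameAlcove (g List.∷ ws) {y} {q} {q'} G A A' h = trans (cong (gen n g ∘ₑ_) (sameAlcove ws {gen n g ∘ₑ y} {q} {q'} (isAff-gen 1≤n g G) A A' h')) (gen-invol 1≤n g y)
    where
    γ = gen n g
    w = evalWord n ws
    h' : ∀ t → act n w q t ≡ act n (γ ∘ₑ y) q' t
    h' t = trans (cong (λ v → act n v q t) (sym (gen-invol 1≤n g w))) (trans (act-∘ γ (γ ∘ₑ w) q t)
             (trans (cong (ℚ._+ ℤtoℚ (shift γ t)) (h (perm γ t))) (sym (act-∘ γ y q' t))))

  word⇒InWaff : ∀ ws → InWaff n (evalWord n ws)
  word⇒InWaff List.[] = List.[] , ≡.refl
  word⇒InWaff (just s List.∷ ws) = mkAR (inject₁ s) (suc s) (+ 0) (low≢high 1≤n (just s)) List.∷ proj₁ (word⇒InWaff ws) , cong (refl n (inject₁ s) (suc s) (+ 0) ∘ₑ_) (proj₂ (word⇒InWaff ws))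
  word⇒InWaff (nothing List.∷ ws) = mkAR zero (fromℕ n) (- (+ 1)) (λ e → low≢high 1≤n nothing (sym e)) List.∷ proj₁ (word⇒InWaff ws) , cong (refl n zero (fromℕ n) (- (+ 1)) ∘ₑ_) (proj₂ (word⇒InWaff ws))

  IsAff⇒InWaff : ∀ {w} → IsAff {n} w → InWaff n w
  IsAff⇒InWaff {w} G = subst (InWaff n) (proj₂ (proj₂ (ascWord 1≤n w G))) (word⇒InWaff (proj₁ (ascWord 1≤n w G)))

  alcove-unique : ∀ {y y' q q'} → IsAff {n} y → IsAff {n} y' → InAid n q → InAid n q' → (∀ t → act n y q t ≡ act n y' q' t) → y ≡ y'
  alcove-unique {y} {y'} {q} {q'} G G' A A' h = trans (sym ev) (sameAlcove ws {y'} {q} {q'} G' A A' (λ t → trans (cong (λ v → act n v q t) ev) (h t)))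
    where
    ws = proj₁ (ascWord 1≤n y G)
    ev : evalWord n ws ≡ y
    ev = proj₂ (proj₂ (ascWord 1≤n y G))

-- Translated and reversed windows

module _ {n : ℕ} where

  translate : Elt n → (Fin (suc n) → ℤ) → Elt n
  translate x h = fromVal (λ t → val x t + h t)

  -- A function that is constant mod N changes all residues by the same amount, so they stay
  -- distinct.
  isAff-translate : ∀ {x h} (g : Fin (suc n) → ℤ) h₀ → IsAff x → (∀ t → h t ≡ N n * g t + h₀) → sum h ≡ 0ℤ → IsAff (translate x h)
  isAff-translate {x} {h} g h₀ G he s0 .inj s t e = go (s Fin.≟ t)
    where
    y = translate x h
    eq₁ : ∀ p N a xs gs h → xs + (N * gs + h) ≡ p + N * a → xs ≡ p + N * a - (N * gs + h)
    eq₁ p N a xs gs h e = trans (l xs (N * gs + h)) (cong (_- (N * gs + h)) e)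
      where
      l : ∀ x y → x ≡ x + y - y
      l = solve-∀
    eq₂ : ∀ p N a b xt gs gt h → p ≡ xt + (N * gt + h) - N * b → p + N * a - (N * gs + h) ≡ xt + N * (gt - gs + a - b)
    eq₂ p N a b xt gs gt h ≡.refl = l N a b xt gs gt h
      where
      l : ∀ N a b xt gs gt h → (xt + (N * gt + h) - N * b) + N * a - (N * gs + h) ≡ xt + N * (gt - gs + a - b)
      l = solve-∀
    eq₃ : ∀ z p q → z ≡ p + q → p ≡ z - q
    eq₃ z p q ≡.refl = l p q
      where
      l : ∀ p q → p ≡ p + q - q
      l = solve-∀
    vy : ∀ t → val y t ≡ val x t + (N n * g t + h₀)
    vy t = trans (val-fromVal (λ t → val x t + h t) t) (cong (_+_ (val x t)) (he t))
    pt : + toℕ (perm y s) ≡ val x t + (N n * g t + h₀) - N n * shift y t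
    pt = trans (cong (λ i → + toℕ i) e) (eq₃ (val x t + (N n * g t + h₀)) (+ toℕ (perm y t)) (N n * shift y t) (sym (vy t)))
    go : Dec (s ≡ t) → s ≡ t
    go (yes p) = p
    go (no ¬p) = ⊥-elim (val-≢ (g t - g s + shift y s - shift y t) G ¬p
      (trans (eq₁ (+ toℕ (perm y s)) (N n) (shift y s) (val x s) (g s) h₀ (sym (vy s)))
        (eq₂ (+ toℕ (perm y s)) (N n) (shift y s) (shift y t) (val x t) (g s) (g t) h₀ pt)))
  isAff-translate {x} {h} g h₀ G he s0 .tot = trans (sum-≡ (val-fromVal (λ t → val x t + h t))) (trans (∑-distrib-+ (val x) h)
    (trans (cong (_+_ (sum (val x))) s0) (trans (+-identityʳ (sum (val x))) (tot G))))

  val-w₀ : ∀ a t → val (w₀ n ∘ₑ a) t ≡ val a (Fin.opposite t)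
  val-w₀ a t = trans (val-∘ (w₀ n) a t) (trans (cong₂ (λ i m → val a i + N n * m) (Vecₚ.lookup∘tabulate Fin.opposite t) (Vecₚ.lookup∘tabulate (λ _ → + 0) t)) (eq (val a (Fin.opposite t)) (N n)))
    where
    eq : ∀ a N → a + N * 0ℤ ≡ a
    eq = solve-∀

  isAff-w₀ : ∀ {a} → IsAff a → IsAff (w₀ n ∘ₑ a)
  isAff-w₀ {a} G .inj s t e = opp-inj (inj G _ _ (trans (sym (pe s)) (trans e (pe t))))
    where
    pe : ∀ t → perm (w₀ n ∘ₑ a) t ≡ perm a (Fin.opposite t)
    pe t = trans (perm-∘ (w₀ n) a t) (cong (perm a) (Vecₚ.lookup∘tabulate Fin.opposite t))
    opp-inj : Fin.opposite s ≡ Fin.opposite t → s ≡ t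
    opp-inj e = trans (sym (opposite-involutive s)) (trans (cong Fin.opposite e) (opposite-involutive t))
  isAff-w₀ {a} G .tot = trans (sum-≡ (val-w₀ a)) (trans (sym (sum-permute (val a) Perm.reverse)) (tot G))

  -- Tested at the image of `center`: its w₀-image is dominant, and since the extension of `center`
  -- is strictly increasing, the order of the coordinates is the order of the window.
  InF⇒decreasing : ∀ {a} → InF n a → Decreasing (val (w₀ n ∘ₑ a))
  InF⇒decreasing {a} (_ , F) = decreasing (val b) step
    where
    b = w₀ n ∘ₑ a
    Π : InΠ⁻ n (act n a center)
    Π = F (act n a center) (center , center-Aid , λ _ → ≡.refl)
    q = proj₁ Π
    q-act : ∀ t → q t ≡ ext center (val b t)
    q-act t = trans (cong q (sym (opposite-involutive t))) (trans (sym (w₀-act (Fin.opposite t))) (trans (proj₂ (proj₂ Π) (Fin.opposite t))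
                (trans (act-ext a center (Fin.opposite t)) (cong (ext center) (sym (val-w₀ a t))))))
      where
      w₀-act : ∀ t → act n (w₀ n) q t ≡ q (Fin.opposite t)
      w₀-act t = trans (cong₂ (λ i m → q i ℚ.+ ℤtoℚ m) (Vecₚ.lookup∘tabulate Fin.opposite t) (Vecₚ.lookup∘tabulate (λ _ → + 0) t)) (ℚₚ.+-identityʳ (q (Fin.opposite t)))
    step : ∀ s → val b (suc s) ≤ val b (inject₁ s)
    step s = ext-cancel-≤ {n} {center} center-Aid (subst₂ ℚ._≤_ (trans (ℚₚ.+-identityˡ (q (suc s))) (q-act (suc s))) (trans (eq (q (inject₁ s)) (q (suc s))) (q-act (inject₁ s)))
               (ℚₚ.+-monoˡ-≤ (q (suc s)) (proj₁ (proj₂ (proj₁ (proj₂ Π)) s))))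
      where
      open +-*-Solver
      eq : ∀ x y → (x ℚ.- y) ℚ.+ y ≡ x
      eq = solve 2 (λ x y → (x :- y) :+ y := x) ≡.refl

-- Weights and the dominance order

ind≤ : ℕ → ℕ → ℤ
ind≤ a b = if a ℕ.≤ᵇ b then 1ℤ else 0ℤ

ind≤-yes : ∀ {a b} → a ℕ.≤ b → ind≤ a b ≡ 1ℤ
ind≤-yes {a} {b} p with a ℕ.≤ᵇ b | ℕₚ.≤⇒≤ᵇ p
... | true | _ = ≡.refl

ind≤-no : ∀ {a b} → b ℕ.< a → ind≤ a b ≡ 0ℤ
ind≤-no {a} {b} p with a ℕ.≤ᵇ b | ℕₚ.≤ᵇ⇒≤ a b
... | true  | q = ⊥-elim (ℕₚ.<⇒≱ p (q tt))
... | false | _ = ≡.refl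

ind≤-suc : ∀ a b → ind≤ (suc a) (suc b) ≡ ind≤ a b
ind≤-suc a b = go (a ℕ.≤? b)
  where
  go : Dec (a ℕ.≤ b) → ind≤ (suc a) (suc b) ≡ ind≤ a b
  go (yes p) = trans (ind≤-yes (ℕ.s≤s p)) (sym (ind≤-yes p))
  go (no ¬p) = trans (ind≤-no (ℕ.s≤s (ℕₚ.≰⇒> ¬p))) (sym (ind≤-no (ℕₚ.≰⇒> ¬p)))

sum-ind≤ : ∀ {m k} → k ℕ.< m → sum {m} (λ t → ind≤ (toℕ t) k) ≡ + suc k
sum-ind≤ {suc m} {zero}  p = cong (_+_ 1ℤ) (trans (sum-≡ {m} (λ t → ind≤-no {suc (toℕ t)} {0} (ℕ.s≤s ℕ.z≤n))) (sum-0 m))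
sum-ind≤ {suc m} {suc k} (ℕ.s≤s p) = cong (_+_ 1ℤ) (trans (sum-≡ {m} (λ t → ind≤-suc (toℕ t) k)) (sum-ind≤ {m} {k} p))

sum-pick : ∀ {m} (f : Fin m → ℤ) i → sum (λ t → if ⌊ t Fin.≟ i ⌋ then f t else 0ℤ) ≡ f i
sum-pick f i = trans (sum-≡ same) (sum-single i (f i))
  where
  same : ∀ t → (if ⌊ t Fin.≟ i ⌋ then f t else 0ℤ) ≡ (if ⌊ t Fin.≟ i ⌋ then f i else 0ℤ)
  same t with t Fin.≟ i
  ... | yes ≡.refl = ≡.refl
  ... | no _ = ≡.refl

partial-zero : ∀ {n} (f : Fin (suc n) → ℤ) → partial f zero ≡ f zero
partial-zero {n} f = trans (cong (_+_ (f zero)) (trans (sum-≡ {n} (λ s → upTo-> {t = zero} {suc s} {f} (ℕ.s≤s ℕ.z≤n))) (sum-0 n))) (+-identityʳ (f zero))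

partial-suc : ∀ {n} (f : Fin (suc n) → ℤ) s → partial f (suc s) ≡ partial f (inject₁ s) + f (suc s)
partial-suc {n} f s = trans (sum-≡ pt) (trans (∑-distrib-+ (upTo (inject₁ s) f) δ) (cong (_+_ (partial f (inject₁ s))) (sum-pick f (suc s))))
  where
  δ : Fin (suc n) → ℤ
  δ u = if ⌊ u Fin.≟ suc s ⌋ then f u else 0ℤ
  δ-no : ∀ {u} → u ≢ suc s → δ u ≡ 0ℤ
  δ-no {u} p with u Fin.≟ suc s
  ... | yes q = ⊥-elim (p q)
  ... | no _ = ≡.refl
  δ-yes : δ (suc s) ≡ f (suc s)
  δ-yes with s Fin.≟ s
  ... | yes q = ≡.refl
  ... | no ¬p = ⊥-elim (¬p ≡.refl)
  i₁ : toℕ (inject₁ s) ≡ toℕ s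
  i₁ = toℕ-inject₁ s
  pt : ∀ u → upTo (suc s) f u ≡ upTo (inject₁ s) f u + δ u
  pt u = go (ℕₚ.<-cmp (toℕ u) (suc (toℕ s)))
    where
    go : _ → upTo (suc s) f u ≡ upTo (inject₁ s) f u + δ u
    go (tri< (ℕ.s≤s p) ne _) = trans (upTo-≤ {t = suc s} {u} {f} (ℕₚ.m≤n⇒m≤1+n p)) (sym (trans (cong₂ _+_ (upTo-≤ {t = inject₁ s} {u} {f} (subst (toℕ u ℕ.≤_) (sym i₁) p)) (δ-no (λ e → ne (cong toℕ e)))) (+-identityʳ (f u))))
    go (tri≈ _ e _) = at (toℕ-injective {i = u} {suc s} e)
      where
      at : u ≡ suc s → upTo (suc s) f u ≡ upTo (inject₁ s) f u + δ u
      at ≡.refl = trans (upTo-≤ {t = suc s} {suc s} {f} ℕₚ.≤-refl) (sym (trans (cong₂ _+_ (upTo-> {t = inject₁ s} {suc s} {f} (ℕ.s≤s (ℕₚ.≤-reflexive i₁))) δ-yes) (+-identityˡ (f (suc s)))))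
    go (tri> _ ne p) = trans (upTo-> {t = suc s} {u} {f} p) (sym (cong₂ _+_ (upTo-> {t = inject₁ s} {u} {f} (subst (ℕ._< toℕ u) (sym i₁) (ℕₚ.<⇒≤ p))) (δ-no (λ e → ne (cong toℕ e)))))

partial-last : ∀ {n} (f : Fin (suc n) → ℤ) → partial f (fromℕ n) ≡ sum f
partial-last {n} f = sum-≡ (λ s → upTo-≤ {t = fromℕ n} {s} {f} (subst (toℕ s ℕ.≤_) (sym (toℕ-fromℕ n)) (toℕ≤pred[n] s)))

-- The ε-coordinates of Σ κ_s α_s when κ vanishes at the last index; inverse to `partial`.
grad : ∀ {n} → (Fin (suc n) → ℤ) → Fin (suc n) → ℤ
grad κ zero    = κ zero
grad κ (suc s) = κ (suc s) - κ (inject₁ s)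

partial-grad : ∀ {n} (κ : Fin (suc n) → ℤ) t → partial (grad κ) t ≡ κ t
partial-grad κ = FinInd.<-weakInduction (λ t → partial (grad κ) t ≡ κ t) (partial-zero (grad κ))
  (λ s e → trans (partial-suc (grad κ) s) (trans (cong (_+ (κ (suc s) - κ (inject₁ s))) e) (eq (κ (inject₁ s)) (κ (suc s)))))
  where
  eq : ∀ a b → a + (b - a) ≡ b
  eq = solve-∀

grad-cong : ∀ {n} {κ κ' : Fin (suc n) → ℤ} → (∀ t → κ t ≡ κ' t) → ∀ t → grad κ t ≡ grad κ' t
grad-cong h zero    = h zero
grad-cong h (suc s) = cong₂ _-_ (h (suc s)) (h (inject₁ s))

grad-0 : ∀ {n} t → grad {n} (λ _ → 0ℤ) t ≡ 0ℤ
grad-0 zero    = ≡.refl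
grad-0 (suc _) = ≡.refl

grad-- : ∀ {n} (κ κ' : Fin (suc n) → ℤ) t → grad (λ t → κ t - κ' t) t ≡ grad κ t - grad κ' t
grad-- κ κ' zero    = ≡.refl
grad-- κ κ' (suc s) = eq (κ (suc s)) (κ' (suc s)) (κ (inject₁ s)) (κ' (inject₁ s))
  where
  eq : ∀ a b c d → (a - b) - (c - d) ≡ (a - c) - (b - d)
  eq = solve-∀

module _ {n : ℕ} where

  -- The partition Σ_{s ≥ t} c_s attached to the weight; `charge` is its size, and the weight is the
  -- partition minus its mean.
  height : Wt n → Fin (suc n) → ℤ
  height c t = sum {n} (λ s → lookup c s * ind≤ (toℕ t) (toℕ s))

  charge : Wt n → ℤ
  charge c = sum {n} (λ s → lookup c s * + suc (toℕ s))

  -- N λ in ε-coordinates, which is integral.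
  scaled : Wt n → Fin (suc n) → ℤ
  scaled c t = N n * height c t + - charge c

  toE≡ : ∀ c t → toE n c t ≡ ℤtoℚ (height c t) ℚ.- ℤtoℚ (charge c) ℚ.* 1/N n
  toE≡ c t = trans (sumℚ-cong n term) (trans (sumℚ-+ n (λ s → ℤtoℚ (A s)) (λ s → ℤtoℚ (B s) ℚ.* (ℚ.- ν)))
      (cong₂ ℚ._+_ (sumℚ-ℤ n A) (trans (sumℚ-* n (λ s → ℤtoℚ (B s)) (ℚ.- ν)) (trans (cong (ℚ._* (ℚ.- ν)) (sumℚ-ℤ n B)) (eq₂ (ℤtoℚ (charge c)) ν)))))
    where
    open +-*-Solver
    ν = 1/N n
    A B : Fin n → ℤ
    A s = lookup c s * ind≤ (toℕ t) (toℕ s)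
    B s = lookup c s * + suc (toℕ s)
    eq₂ : ∀ a ν → a ℚ.* (ℚ.- ν) ≡ ℚ.- (a ℚ.* ν)
    eq₂ = solve 2 (λ a ν → a :* (:- ν) := :- (a :* ν)) ≡.refl
    eq₁ : ∀ c i k ν → c ℚ.* (i ℚ.- k ℚ.* ν) ≡ c ℚ.* i ℚ.+ (c ℚ.* k) ℚ.* (ℚ.- ν)
    eq₁ = solve 4 (λ c i k ν → c :* (i :- k :* ν) := c :* i :+ (c :* k) :* (:- ν)) ≡.refl
    bool : ∀ b → (if b then 1ℚ else 0ℚ) ≡ ℤtoℚ (if b then 1ℤ else 0ℤ)
    bool true  = ≡.refl
    bool false = ≡.refl
    term : ∀ s → ℤtoℚ (lookup c s) ℚ.* ϖ n s t ≡ ℤtoℚ (A s) ℚ.+ ℤtoℚ (B s) ℚ.* (ℚ.- ν)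
    term s = trans (cong₂ (λ x y → ℤtoℚ (lookup c s) ℚ.* (x ℚ.- y)) (bool (toℕ t ℕ.≤ᵇ toℕ s)) (/N n (suc (toℕ s))))
      (trans (eq₁ (ℤtoℚ (lookup c s)) (ℤtoℚ (ind≤ (toℕ t) (toℕ s))) (ℤtoℚ (+ suc (toℕ s))) ν)
        (sym (cong₂ (λ x y → x ℚ.+ y ℚ.* (ℚ.- ν)) (ℤtoℚ-* (lookup c s) (ind≤ (toℕ t) (toℕ s))) (ℤtoℚ-* (lookup c s) (+ suc (toℕ s))))))

  scaled-toE : ∀ c t → ℤtoℚ (N n) ℚ.* toE n c t ≡ ℤtoℚ (scaled c t)
  scaled-toE c t = trans (cong (ℤtoℚ (N n) ℚ.*_) (toE≡ c t)) (trans (l (ℤtoℚ (N n)) (ℤtoℚ (height c t)) (ℤtoℚ (charge c)) (1/N n))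
      (trans (cong (λ z → ℤtoℚ (N n) ℚ.* ℤtoℚ (height c t) ℚ.- ℤtoℚ (charge c) ℚ.* z) (N*1/N n))
        (trans (cong (λ z → ℤtoℚ (N n) ℚ.* ℤtoℚ (height c t) ℚ.- z) (ℚₚ.*-identityʳ (ℤtoℚ (charge c))))
          (sym (trans (ℤtoℚ-- (N n * height c t) (charge c)) (cong (ℚ._- ℤtoℚ (charge c)) (ℤtoℚ-* (N n) (height c t))))))))
    where
    open +-*-Solver
    l : ∀ N s k ν → N ℚ.* (s ℚ.- k ℚ.* ν) ≡ N ℚ.* s ℚ.- k ℚ.* (N ℚ.* ν)
    l = solve 4 (λ N s k ν → N :* (s :- k :* ν) := N :* s :- k :* (N :* ν)) ≡.refl

  toE-scaled : ∀ c t → toE n c t ≡ ℤtoℚ (scaled c t) ℚ.* 1/N n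
  toE-scaled c t = sym (trans (cong (ℚ._* 1/N n) (sym (scaled-toE c t))) (trans (l (ℤtoℚ (N n)) (toE n c t) (1/N n))
      (trans (cong (toE n c t ℚ.*_) (N*1/N n)) (ℚₚ.*-identityʳ (toE n c t)))))
    where
    open +-*-Solver
    l : ∀ N e ν → N ℚ.* e ℚ.* ν ≡ e ℚ.* (N ℚ.* ν)
    l = solve 3 (λ N e ν → N :* e :* ν := e :* (N :* ν)) ≡.refl

  height-step : ∀ c s → height c (inject₁ s) ≡ height c (suc s) + lookup c s
  height-step c s = trans (sum-≡ pt) (trans (∑-distrib-+ (λ r → lookup c r * ind≤ (suc (toℕ s)) (toℕ r)) δ) (cong (_+_ (height c (suc s))) (sum-pick (lookup c) s)))
    where
    δ : Fin n → ℤ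
    δ r = if ⌊ r Fin.≟ s ⌋ then lookup c r else 0ℤ
    δ-no : ∀ {r} → r ≢ s → δ r ≡ 0ℤ
    δ-no {r} p with r Fin.≟ s
    ... | yes q = ⊥-elim (p q)
    ... | no _ = ≡.refl
    δ-yes : ∀ {r} → r ≡ s → δ r ≡ lookup c r
    δ-yes {r} p with r Fin.≟ s
    ... | yes q = ≡.refl
    ... | no ¬p = ⊥-elim (¬p p)
    e₀ : ∀ c → c * 0ℤ ≡ c * 0ℤ + 0ℤ
    e₀ = solve-∀
    e₁ : ∀ c → c * 1ℤ ≡ c * 0ℤ + c
    e₁ = solve-∀
    e₂ : ∀ c → c * 1ℤ ≡ c * 1ℤ + 0ℤ
    e₂ = solve-∀
    three : ∀ {a a' b b' d d'} → a ≡ a' → b ≡ b' → d ≡ d' → ∀ c → c * a' ≡ c * b' + d' → c * a ≡ c * b + d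
    three ≡.refl ≡.refl ≡.refl c e = e
    i₁ : toℕ (inject₁ s) ≡ toℕ s
    i₁ = toℕ-inject₁ s
    pt : ∀ r → lookup c r * ind≤ (toℕ (inject₁ s)) (toℕ r) ≡ lookup c r * ind≤ (suc (toℕ s)) (toℕ r) + δ r
    pt r = go (ℕₚ.<-cmp (toℕ s) (toℕ r))
      where
      go : _ → lookup c r * ind≤ (toℕ (inject₁ s)) (toℕ r) ≡ lookup c r * ind≤ (suc (toℕ s)) (toℕ r) + δ r
      go (tri< p ne _) = three (trans (cong (λ k → ind≤ k (toℕ r)) i₁) (ind≤-yes (ℕₚ.<⇒≤ p))) (ind≤-yes p) (δ-no (λ e → ne (cong toℕ (sym e)))) (lookup c r) (e₂ (lookup c r))
      go (tri≈ _ e _) = three (trans (cong (λ k → ind≤ k (toℕ r)) i₁) (ind≤-yes (ℕₚ.≤-reflexive e))) (ind≤-no (ℕ.s≤s (ℕₚ.≤-reflexive (sym e)))) (δ-yes (toℕ-injective (sym e))) (lookup c r) (e₁ (lookup c r))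
      go (tri> _ ne p) = three (trans (cong (λ k → ind≤ k (toℕ r)) i₁) (ind≤-no p)) (ind≤-no (ℕₚ.m≤n⇒m≤1+n p)) (δ-no (λ e → ne (cong toℕ (sym e)))) (lookup c r) (e₀ (lookup c r))

  scaled-step : ∀ c s → scaled c (inject₁ s) ≡ scaled c (suc s) + N n * lookup c s
  scaled-step c s = trans (cong (λ h → N n * h + - charge c) (height-step c s)) (eq (N n) (height c (suc s)) (lookup c s) (charge c))
    where
    eq : ∀ N h c k → N * (h + c) + - k ≡ N * h + - k + N * c
    eq = solve-∀

  scaled-sum : ∀ c → sum (scaled c) ≡ 0ℤ
  scaled-sum c = trans (∑-distrib-+ (λ t → N n * height c t) (λ _ → - charge c)) (trans (cong₂ _+_ (trans (*-distribˡ-sum (N n) (height c)) (cong (λ h → N n * h) Σh)) (sum-const (suc n) (- charge c))) (eq (N n) (charge c)))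
    where
    eq : ∀ N k → N * k + N * (- k) ≡ 0ℤ
    eq = solve-∀
    Σh : sum (height c) ≡ charge c
    Σh = trans (∑-comm {suc n} {n} (λ t s → lookup c s * ind≤ (toℕ t) (toℕ s)))
          (sum-≡ {n} (λ s → trans (*-distribˡ-sum {suc n} (lookup c s) (λ t → ind≤ (toℕ t) (toℕ s))) (cong (λ z → lookup c s * z) (sum-ind≤ {suc n} {toℕ s} (ℕₚ.m≤n⇒m≤1+n (toℕ<n s))))))

  scaled-unique : ∀ c h → (∀ s → h (inject₁ s) ≡ h (suc s) + N n * lookup c s) → sum h ≡ 0ℤ → ∀ t → h t ≡ scaled c t
  scaled-unique c h st s0 t = lin≡ (cyclic-monotone⇒0 d (λ s → ≤-reflexive (ds s)) wr dsum t) (eq₀ (h t) (scaled c t))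
    where
    d : Fin (suc n) → ℤ
    d t = h t - scaled c t
    eq₀ : ∀ a b → a - b ≡ a - b - 0ℤ
    eq₀ = solve-∀
    eq₁ : ∀ a b k → a + k - (b + k) ≡ a - b
    eq₁ = solve-∀
    ds : ∀ s → d (inject₁ s) ≡ d (suc s)
    ds s = trans (cong₂ _-_ (st s) (scaled-step c s)) (eq₁ (h (suc s)) (scaled c (suc s)) (N n * lookup c s))
    wr : d (fromℕ n) ≤ d zero
    wr = decreasing d (λ s → ≤-reflexive (sym (ds s))) {zero} {fromℕ n} ℕ.z≤n
    dsum : sum d ≡ 0ℤ
    dsum = trans (sum-sub h (scaled c)) (cong₂ _-_ s0 (scaled-sum c))

  scaled-injective : ∀ {c c'} → (∀ t → scaled c t ≡ scaled c' t) → c ≡ c'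
  scaled-injective {c} {c'} h = vec-ext {n} (λ s → *-cancelˡ-≡ (N n) (lookup c s) (lookup c' s)
      (lin≡ (trans (sym (scaled-step c s)) (trans (h (inject₁ s)) (trans (scaled-step c' s) (cong (_+ (N n * lookup c' s)) (sym (h (suc s))))))) (eq (scaled c (suc s)) (N n * lookup c s) (N n * lookup c' s))))
    where
    eq : ∀ a b c → b - c ≡ a + b - (a + c)
    eq = solve-∀

  -- c - c' = Σ_s κ_s α_s; the index set of κ is enlarged by a last entry 0.
  record Drop (c c' : Wt n) : Set where
    field
      κ       : Fin (suc n) → ℤ
      κ≥0     : ∀ t → 0ℤ ≤ κ t
      κ-last  : κ (fromℕ n) ≡ 0ℤ
      descend : ∀ t → scaled c t ≡ scaled c' t + N n * grad κ t
  open Drop public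

  -- Written as a sum of indicators, so that `sum-αs` compares it term by term with Σ k_s α_s.
  extend : Vec ℕ n → Fin (suc n) → ℤ
  extend k t = sum {n} (λ s → if ⌊ t Fin.≟ inject₁ s ⌋ then + lookup k s else 0ℤ)

  extend-inject₁ : ∀ k s → extend k (inject₁ s) ≡ + lookup k s
  extend-inject₁ k s = trans (sum-≡ same) (sum-pick (λ r → + lookup k r) s)
    where
    same : ∀ r → (if ⌊ inject₁ s Fin.≟ inject₁ r ⌋ then + lookup k r else 0ℤ) ≡ (if ⌊ r Fin.≟ s ⌋ then + lookup k r else 0ℤ)
    same r with inject₁ s Fin.≟ inject₁ r | r Fin.≟ s
    ... | yes _ | yes _ = ≡.refl
    ... | yes p | no ¬q = ⊥-elim (¬q (sym (inject₁-injective p)))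
    ... | no ¬p | yes q = ⊥-elim (¬p (cong inject₁ (sym q)))
    ... | no _  | no _  = ≡.refl

  extend-last : ∀ k → extend k (fromℕ n) ≡ 0ℤ
  extend-last k = trans (sum-≡ none) (sum-0 n)
    where
    none : ∀ r → (if ⌊ fromℕ n Fin.≟ inject₁ r ⌋ then + lookup k r else 0ℤ) ≡ 0ℤ
    none r with fromℕ n Fin.≟ inject₁ r
    ... | yes p = ⊥-elim (fromℕ≢inject₁ p)
    ... | no _  = ≡.refl

  extend≥0 : ∀ k t → 0ℤ ≤ extend k t
  extend≥0 k t = sum-nonneg {n} pt
    where
    pt : ∀ s → 0ℤ ≤ (if ⌊ t Fin.≟ inject₁ s ⌋ then + lookup k s else 0ℤ)
    pt s with t Fin.≟ inject₁ s
    ... | yes _ = +≤+ ℕ.z≤n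
    ... | no _  = ≤-refl

  sum-αs : ∀ k t → sumℚ n (λ s → ℕtoℚ (lookup k s) ℚ.* αs n s t) ≡ ℤtoℚ (grad (extend k) t)
  sum-αs k t = trans (sumℚ-cong n term) (trans (sumℚ-ℤ n (λ s → A s - B s)) (cong ℤtoℚ (trans (sum-sub A B) (gr t))))
    where
    open +-*-Solver
    A B : Fin n → ℤ
    A s = if ⌊ t Fin.≟ inject₁ s ⌋ then + lookup k s else 0ℤ
    B s = if ⌊ t Fin.≟ suc s ⌋ then + lookup k s else 0ℤ
    eq : ∀ k a b → k ℚ.* (a ℚ.- b) ≡ k ℚ.* a ℚ.- k ℚ.* b
    eq = solve 3 (λ k a b → k :* (a :- b) := k :* a :- k :* b) ≡.refl
    bool : ∀ m b → ℕtoℚ m ℚ.* (if b then 1ℚ else 0ℚ) ≡ ℤtoℚ (if b then + m else 0ℤ)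
    bool m true  = ℚₚ.*-identityʳ (ℕtoℚ m)
    bool m false = ℚₚ.*-zeroʳ (ℕtoℚ m)
    term : ∀ s → ℕtoℚ (lookup k s) ℚ.* αs n s t ≡ ℤtoℚ (A s - B s)
    term s = trans (eq (ℕtoℚ (lookup k s)) (if ⌊ t Fin.≟ inject₁ s ⌋ then 1ℚ else 0ℚ) (if ⌊ t Fin.≟ suc s ⌋ then 1ℚ else 0ℚ))
      (trans (cong₂ ℚ._-_ (bool (lookup k s) ⌊ t Fin.≟ inject₁ s ⌋) (bool (lookup k s) ⌊ t Fin.≟ suc s ⌋)) (sym (ℤtoℚ-- (A s) (B s))))
    gr : ∀ t → sum {n} (λ s → if ⌊ t Fin.≟ inject₁ s ⌋ then + lookup k s else 0ℤ) - sum {n} (λ s → if ⌊ t Fin.≟ suc s ⌋ then + lookup k s else 0ℤ) ≡ grad (extend k) t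
    gr zero = trans (cong (λ z → extend k zero - z) (sum-0 n)) (+-identityʳ (extend k zero))
    gr (suc s) = cong (λ z → extend k (suc s) - z) (trans (sum-≡ same) (trans (sum-pick (λ r → + lookup k r) s) (sym (extend-inject₁ k s))))
      where
      same : ∀ r → (if ⌊ suc s Fin.≟ suc r ⌋ then + lookup k r else 0ℤ) ≡ (if ⌊ r Fin.≟ s ⌋ then + lookup k r else 0ℤ)
      same r with s Fin.≟ r | r Fin.≟ s
      ... | yes _ | yes _ = ≡.refl
      ... | yes p | no ¬q = ⊥-elim (¬q (sym p))
      ... | no ¬p | yes q = ⊥-elim (¬p (sym q))
      ... | no _  | no _  = ≡.refl

  ≼⇒Drop : ∀ {c c'} → c' ≼ c → Drop c c'
  ≼⇒Drop {c} {c'} (k , h) = record { κ = extend k ; κ≥0 = extend≥0 k ; κ-last = extend-last k ; descend = desc }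
    where
    open +-*-Solver
    l : ∀ N a b → N ℚ.* (a ℚ.- b) ≡ N ℚ.* a ℚ.- N ℚ.* b
    l = solve 3 (λ N a b → N :* (a :- b) := N :* a :- N :* b) ≡.refl
    e₀ : ∀ a b g → a - (b + g) ≡ a - b - g
    e₀ = solve-∀
    desc : ∀ t → scaled c t ≡ scaled c' t + N n * grad (extend k) t
    desc t = lin≡ {p = scaled c t - scaled c' t} {q = N n * grad (extend k) t} (ℤtoℚ-injective (trans (ℤtoℚ-- (scaled c t) (scaled c' t)) (trans (cong₂ ℚ._-_ (sym (scaled-toE c t)) (sym (scaled-toE c' t)))
       (trans (sym (l (ℤtoℚ (N n)) (toE n c t) (toE n c' t))) (trans (cong (ℤtoℚ (N n) ℚ.*_) (trans (h t) (sum-αs k t))) (sym (ℤtoℚ-* (N n) (grad (extend k) t))))))))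
       (e₀ (scaled c t) (scaled c' t) (N n * grad (extend k) t))

  Drop⇒≼ : ∀ {c c'} → Drop c c' → c' ≼ c
  Drop⇒≼ {c} {c'} D = k , λ t → trans (cong₂ ℚ._-_ (toE-scaled c t) (toE-scaled c' t)) (trans (l (ℤtoℚ (scaled c t)) (ℤtoℚ (scaled c' t)) ν)
      (trans (cong (ℚ._* ν) (trans (sym (ℤtoℚ-- (scaled c t) (scaled c' t))) (cong ℤtoℚ (diff t))))
        (trans (cong (ℚ._* ν) (ℤtoℚ-* (N n) (grad (κ D) t))) (trans (l' (ℤtoℚ (N n)) (ℤtoℚ (grad (κ D) t)) ν)
          (trans (cong (ℤtoℚ (grad (κ D) t) ℚ.*_) (N*1/N n)) (trans (ℚₚ.*-identityʳ (ℤtoℚ (grad (κ D) t)))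
            (sym (trans (sum-αs k t) (cong ℤtoℚ (grad-cong same t))))))))))
    where
    open +-*-Solver
    ν = 1/N n
    k : Vec ℕ n
    k = tabulate (λ s → ℤ.∣ κ D (inject₁ s) ∣)
    l : ∀ a b ν → a ℚ.* ν ℚ.- b ℚ.* ν ≡ (a ℚ.- b) ℚ.* ν
    l = solve 3 (λ a b ν → a :* ν :- b :* ν := (a :- b) :* ν) ≡.refl
    l' : ∀ N g ν → N ℚ.* g ℚ.* ν ≡ g ℚ.* (N ℚ.* ν)
    l' = solve 3 (λ N g ν → N :* g :* ν := g :* (N :* ν)) ≡.refl
    e₀ : ∀ a g → a + g - a ≡ g
    e₀ = solve-∀
    diff : ∀ t → scaled c t - scaled c' t ≡ N n * grad (κ D) t
    diff t = trans (cong (_- scaled c' t) (descend D t)) (e₀ (scaled c' t) (N n * grad (κ D) t))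
    same : ∀ t → extend k t ≡ κ D t
    same t with topView t
    ... | ‵fromℕ = trans (extend-last k) (sym (κ-last D))
    ... | ‵inject₁ s = trans (extend-inject₁ k s) (trans (cong +_ (Vecₚ.lookup∘tabulate (λ s → ℤ.∣ κ D (inject₁ s) ∣) s)) (0≤i⇒+∣i∣≡i (κ≥0 D (inject₁ s))))

  lower : Wt n → (Fin (suc n) → ℤ) → Wt n
  lower c κ = tabulate (λ s → lookup c s - (grad κ (inject₁ s) - grad κ (suc s)))

  lower-Drop : ∀ c κ → (∀ t → 0ℤ ≤ κ t) → κ (fromℕ n) ≡ 0ℤ → Drop c (lower c κ)
  lower-Drop c κ p l0 = record { κ = κ ; κ≥0 = p ; κ-last = l0 ; descend = λ t → lin≡ (scaled-unique (lower c κ) h st s0 t) (e₁ (scaled c t) (N n * grad κ t) (scaled (lower c κ) t)) }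
    where
    h : Fin (suc n) → ℤ
    h t = scaled c t - N n * grad κ t
    e₁ : ∀ a g b → a - (b + g) ≡ a - g - b
    e₁ = solve-∀
    e₂ : ∀ a N c g g' → a + N * c - N * g ≡ a - N * g' + N * (c - (g - g'))
    e₂ = solve-∀
    st : ∀ s → h (inject₁ s) ≡ h (suc s) + N n * lookup (lower c κ) s
    st s = trans (cong (_- (N n * grad κ (inject₁ s))) (scaled-step c s)) (trans (e₂ (scaled c (suc s)) (N n) (lookup c s) (grad κ (inject₁ s)) (grad κ (suc s)))
             (cong (λ z → h (suc s) + N n * z) (sym (Vecₚ.lookup∘tabulate (λ s → lookup c s - (grad κ (inject₁ s) - grad κ (suc s))) s))))
    s0 : sum h ≡ 0ℤ
    s0 = trans (sum-sub (scaled c) (λ t → N n * grad κ t)) (cong₂ _-_ (scaled-sum c)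
          (trans (*-distribˡ-sum (N n) (grad κ)) (trans (cong (λ z → N n * z) (trans (sym (partial-last (grad κ))) (trans (partial-grad κ (fromℕ n)) l0))) (*-zeroʳ (N n)))))

  Drop-sub : ∀ {c c₁ c₂} (D₁ : Drop c c₁) (D₂ : Drop c c₂) → (∀ t → κ D₁ t ≤ κ D₂ t) → Drop c₁ c₂
  Drop-sub {c} {c₁} {c₂} D₁ D₂ h = record
    { κ = λ t → κ D₂ t - κ D₁ t
    ; κ≥0 = λ t → i≤j⇒0≤j-i (h t)
    ; κ-last = cong₂ _-_ (κ-last D₂) (κ-last D₁)
    ; descend = λ t → trans (lin≡ (trans (sym (descend D₁ t)) (descend D₂ t)) (eq (scaled c₁ t) (scaled c₂ t) (N n) (grad (κ D₁) t) (grad (κ D₂) t)))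
                            (cong (λ z → scaled c₂ t + N n * z) (sym (grad-- (κ D₂) (κ D₁) t))) }
    where
    eq : ∀ a b N g h → a - (b + N * (h - g)) ≡ a + N * g - (b + N * h)
    eq = solve-∀

  Drop-refl : ∀ c → Drop c c
  Drop-refl c = record { κ = λ _ → 0ℤ ; κ≥0 = λ _ → ≤-refl ; κ-last = ≡.refl ; descend = λ t → sym (trans (cong (λ z → scaled c t + N n * z) (grad-0 t)) (eq (scaled c t) (N n))) }
    where
    eq : ∀ a N → a + N * 0ℤ ≡ a
    eq = solve-∀

  Drop-trans : ∀ {c c₁ c₂} → Drop c c₁ → Drop c₁ c₂ → Drop c c₂
  Drop-trans {c} {c₁} {c₂} D₁ D₂ = record
    { κ = λ t → κ D₁ t + κ D₂ t
    ; κ≥0 = λ t → κ≥0 D₁ t ⊕ κ≥0 D₂ t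
    ; κ-last = cong₂ _+_ (κ-last D₁) (κ-last D₂)
    ; descend = λ t → trans (descend D₁ t) (trans (cong (_+ (N n * grad (κ D₁) t)) (descend D₂ t)) (trans (eq (scaled c₂ t) (N n) (grad (κ D₁) t) (grad (κ D₂) t)) (cong (λ z → scaled c₂ t + N n * z) (sym (grad-+ t))))) }
    where
    eq : ∀ a N g h → a + N * h + N * g ≡ a + N * (g + h)
    eq = solve-∀
    e' : ∀ a b c d → (a + b) - (c + d) ≡ (a - c) + (b - d)
    e' = solve-∀
    grad-+ : ∀ t → grad (λ t → κ D₁ t + κ D₂ t) t ≡ grad (κ D₁) t + grad (κ D₂) t
    grad-+ zero = ≡.refl
    grad-+ (suc s) = e' (κ D₁ (suc s)) (κ D₂ (suc s)) (κ D₁ (inject₁ s)) (κ D₂ (inject₁ s))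

  Drop-zero : ∀ {c c'} (D : Drop c c') → (∀ t → κ D t ≡ 0ℤ) → c ≡ c'
  Drop-zero {c} {c'} D z = scaled-injective λ t → trans (descend D t) (trans (cong (λ g → scaled c' t + N n * g) (trans (grad-cong z t) (grad-0 t))) (eq (scaled c' t) (N n)))
    where
    eq : ∀ a N → a + N * 0ℤ ≡ a
    eq = solve-∀

  partial-scaled : ∀ {c c'} (D : Drop c c') t → partial (scaled c) t ≡ partial (scaled c') t + N n * κ D t
  partial-scaled {c} {c'} D t = trans (partial-cong (descend D) t) (trans (partial-+ (scaled c') (λ t → N n * grad (κ D) t) t)
      (cong (_+_ (partial (scaled c') t)) (trans (sum-≡ pt) (trans (*-distribˡ-sum (N n) (upTo t (grad (κ D)))) (cong (λ z → N n * z) (partial-grad (κ D) t))))))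
    where
    pt : ∀ s → upTo t (λ t → N n * grad (κ D) t) s ≡ N n * upTo t (grad (κ D)) s
    pt s with toℕ s ℕ.≤? toℕ t
    ... | yes _ = ≡.refl
    ... | no _  = sym (*-zeroʳ (N n))

  κ-unique : ∀ {c c'} (D D' : Drop c c') t → κ D t ≡ κ D' t
  κ-unique {c} {c'} D D' t = *-cancelˡ-≡ (N n) (κ D t) (κ D' t) (lin≡ (trans (sym (partial-scaled D t)) (partial-scaled D' t)) (eq (partial (scaled c') t) (N n * κ D t) (N n * κ D' t)))
    where
    eq : ∀ a b c → b - c ≡ a + b - (a + c)
    eq = solve-∀

-- The elements θ

module Boxes {n : ℕ} (1≤n : 1 ℕ.≤ n) (a : Elt n) (F : InF n a) where

  base : Elt n
  base = w₀ n ∘ₑ a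

  base-aff : IsAff base
  base-aff = isAff-w₀ (InWaff⇒IsAff (proj₁ F))

  base-dec : Decreasing (val base)
  base-dec = InF⇒decreasing F

  abstract

    θ : Wt n → Elt n
    θ c = translate base (scaled c)

    val-θ : ∀ c t → val (θ c) t ≡ val base t + scaled c t
    val-θ c t = val-fromVal (λ t → val base t + scaled c t) t

    aff-θ : ∀ c → IsAff (θ c)
    aff-θ c = isAff-translate {x = base} {scaled c} (height c) (- charge c) base-aff (λ t → ≡.refl) (scaled-sum c)

  θ-dec : ∀ {c} → Dominant n c → Decreasing (val (θ c))
  θ-dec {c} dom = decreasing (val (θ c)) step
    where
    step : ∀ s → val (θ c) (suc s) ≤ val (θ c) (inject₁ s)
    step s = subst₂ _≤_ (sym (val-θ c (suc s))) (sym (trans (val-θ c (inject₁ s)) (cong (_+_ (val base (inject₁ s))) (scaled-step c s))))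
      (base-dec {inject₁ s} {suc s} (inject₁≤suc s) ⊕
        (≤-trans (≤-reflexive (sym (+-identityʳ (scaled c (suc s)))))
          (+-monoʳ-≤ (scaled c (suc s)) (subst (_≤ N n * lookup c s) (*-zeroʳ (N n)) (N-mono {n} (dom s))))))

  -- In N λ = N `height` - `charge` the first part is an integral translation, and the constant is
  -- absorbed by rotating the point of A_id. The two inclusions use opposite rotations.
  isTheta-θ : ∀ c → IsTheta n a c (θ c)
  isTheta-θ c = IsAff⇒InWaff 1≤n (aff-θ c) , λ p → mk⇔ (to p) (from p)
    where
    open +-*-Solver
    k = charge c
    κν = ℤtoℚ k ℚ.* 1/N n
    to : ∀ p → InAlc n (θ c) p → InAlc n base (λ t → p t ℚ.- toE n c t)
    to p (q , A , h) = rot (- k) q , rot-Aid (- k) {q} A , λ t → begin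
        act n base (rot (- k) q) t                                     ≡⟨ act-ext base (rot (- k) q) t ⟩
        ext (rot (- k) q) (val base t)                                 ≡⟨ ext-rot (- k) q (val base t) ⟩
        ext q (val base t + - k) ℚ.- ℤtoℚ (- k) ℚ.* 1/N n              ≡⟨ cong (λ z → ext q (val base t + - k) ℚ.- z ℚ.* 1/N n) (ℤtoℚ-neg k) ⟩
        ext q (val base t + - k) ℚ.- (ℚ.- ℤtoℚ k) ℚ.* 1/N n            ≡⟨ l (ext q (val base t + - k)) (ℤtoℚ k) (1/N n) (ℤtoℚ (height c t)) ⟩
        (ext q (val base t + - k) ℚ.+ ℤtoℚ (height c t)) ℚ.- (ℤtoℚ (height c t) ℚ.- κν)
          ≡⟨ cong₂ ℚ._-_ (trans (sym (ext-period q (val base t + - k) (height c t))) (trans (cong (ext q) (trans (e (val base t) k (N n * height c t)) (sym (val-θ c t)))) (trans (sym (act-ext (θ c) q t)) (h t)))) (sym (toE≡ c t)) ⟩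
        p t ℚ.- toE n c t                                              ∎
      where
      open ≡-Reasoning
      e : ∀ v k h → v + - k + h ≡ v + (h + - k)
      e = solve-∀
      l : ∀ x k ν h → x ℚ.- (ℚ.- k) ℚ.* ν ≡ (x ℚ.+ h) ℚ.- (h ℚ.- k ℚ.* ν)
      l = solve 4 (λ x k ν h → x :- (:- k) :* ν := (x :+ h) :- (h :- k :* ν)) ≡.refl
    from : ∀ p → InAlc n base (λ t → p t ℚ.- toE n c t) → InAlc n (θ c) p
    from p (q , A , h) = rot k q , rot-Aid k {q} A , λ t → begin
        act n (θ c) (rot k q) t                                        ≡⟨ act-ext (θ c) (rot k q) t ⟩
        ext (rot k q) (val (θ c) t)                                    ≡⟨ ext-rot k q (val (θ c) t) ⟩
        ext q (val (θ c) t + k) ℚ.- κν                                 ≡⟨ cong (λ z → ext q z ℚ.- κν) (trans (cong (_+ k) (val-θ c t)) (e (val base t) k (N n * height c t))) ⟩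
        ext q (val base t + N n * height c t) ℚ.- κν                   ≡⟨ cong (ℚ._- κν) (ext-period q (val base t) (height c t)) ⟩
        (ext q (val base t) ℚ.+ ℤtoℚ (height c t)) ℚ.- κν              ≡⟨ cong (λ z → (z ℚ.+ ℤtoℚ (height c t)) ℚ.- κν) (trans (sym (act-ext base q t)) (trans (h t) (cong (λ z → p t ℚ.- z) (toE≡ c t)))) ⟩
        ((p t ℚ.- (ℤtoℚ (height c t) ℚ.- κν)) ℚ.+ ℤtoℚ (height c t)) ℚ.- κν  ≡⟨ l (p t) (ℤtoℚ (height c t)) κν ⟩
        p t                                                            ∎
      where
      open ≡-Reasoning
      e : ∀ v k h → v + (h + - k) + k ≡ v + h
      e = solve-∀
      l : ∀ p h k → ((p ℚ.- (h ℚ.- k)) ℚ.+ h) ℚ.- k ≡ p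
      l = solve 3 (λ p h k → ((p :- (h :- k)) :+ h) :- k := p) ≡.refl

  isTheta-unique : ∀ {c y} → IsTheta n a c y → y ≡ θ c
  isTheta-unique {c} {y} (W , al) = go (Equivalence.from (proj₂ (isTheta-θ c) p) (Equivalence.to (al p) (center , center-Aid , λ _ → ≡.refl)))
    where
    p = act n y center
    go : InAlc n (θ c) p → y ≡ θ c
    go (q , A , h) = alcove-unique 1≤n {y} {θ c} {center} {q} (InWaff⇒IsAff W) (aff-θ c) center-Aid A (λ t → sym (h t))

  -- Membership in I_a(c) in terms of windows, free of the chosen θ and of its reduced word.
  record Mem (c : Wt n) (x : Elt n) : Set where
    constructor mem
    field
      aff   : IsAff x
      below : val x ⊴ val (θ c)
  open Mem public

  InI⇒Mem : ∀ {c x} → InI n a c x → Mem c x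
  InI⇒Mem {c} {x} (y , isθ , b) = go (≤B⇒⊴ 1≤n {x} {θ c} (subst (x ≤B_) (isTheta-unique {c} {y} isθ) b))
    where
    go : IsAff x × val x ⊴ val (θ c) → Mem c x
    go (p , q) = mem p q

  Mem⇒InI : ∀ {c x} → Mem c x → InI n a c x
  Mem⇒InI {c} {x} m = θ c , isTheta-θ c , go (reduced-word 1≤n (θ c) (aff-θ c))
    where
    go : (Σ (List (Gen n)) λ ws → AscWord 1≤n ws × Reduced n ws (θ c)) → x ≤B θ c
    go (ws , aw , r) = ws , r , ⊴⇒subword 1≤n ws aw x (aff m) (subst (λ y → val x ⊴ val y) (sym (proj₁ r)) (below m))

  desc : Elt n → Permutation′ (suc n) → Fin (suc n) → ℤ
  desc x π t = val x (π ⟨$⟩ʳ t)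

  Mem⇒≤ᴰ : ∀ {c x} π → Dominant n c → Mem c x → desc x π ≤ᴰ val (θ c)
  Mem⇒≤ᴰ {c} {x} π dom m = ⊴⇒≤ᴰ (val x) (val (θ c)) π (θ-dec dom) (below m)

  ≤ᴰ⇒Mem : ∀ {c x} π → Decreasing (desc x π) → Dominant n c → IsAff x → desc x π ≤ᴰ val (θ c) → Mem c x
  ≤ᴰ⇒Mem {c} {x} π dec dom G h = mem G (≤ᴰ⇒⊴ (val x) (val (θ c)) π dec (θ-dec dom) h)

  floors-θ : ∀ {c c'} (D : Drop c c') j t → partial (floors {n} j (val (θ c))) t ≡ partial (floors {n} j (val (θ c'))) t + κ D t
  floors-θ {c} {c'} D j t = trans (partial-cong pt t) (trans (partial-+ (floors j (val (θ c'))) (grad (κ D)) t) (cong (_+_ (partial (floors j (val (θ c'))) t)) (partial-grad (κ D) t)))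
    where
    eq : ∀ v s N g j → v + (s + N * g) - j ≡ v + s - j + N * g
    eq = solve-∀
    pt : ∀ t → floors j (val (θ c)) t ≡ floors j (val (θ c')) t + grad (κ D) t
    pt t = trans (cong (λ z → fl n (z - j)) (trans (val-θ c t) (cong (_+_ (val base t)) (descend D t))))
      (trans (cong (fl n) (eq (val base t) (scaled c' t) (N n) (grad (κ D) t) j)) (trans (fl-shift (val base t + scaled c' t - j) (grad (κ D) t))
        (cong (λ z → fl n (z - j) + grad (κ D) t) (sym (val-θ c' t)))))

  Mem-up : ∀ {c c' x} → Drop c c' → Dominant n c → Dominant n c' → Mem c' x → Mem c x
  Mem-up {c} {c'} {x} D dom dom' m = ≤ᴰ⇒Mem {c} {x} π (proj₂ (sorting (val x))) dom (aff m) λ j t →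
      ≤-trans (Mem⇒≤ᴰ {c'} {x} π dom' m j t) (≤-trans (≤-reflexive (sym (+-identityʳ (partial (floors j (val (θ c'))) t))))
        (≤-trans (+-monoʳ-≤ (partial (floors j (val (θ c'))) t) (κ≥0 D t)) (≤-reflexive (sym (floors-θ D j t)))))
    where
    π = proj₁ (sorting (val x))

-- Meets of dominant weights

module _ {n : ℕ} where

  -- The pairing ⟨Σ κ_t α_t , α_s⟩ = 2 κ_s - κ_{s-1} - κ_{s+1}, the negative of the second
  -- difference of κ.
  curv : (Fin (suc n) → ℤ) → Fin n → ℤ
  curv κ s = grad κ (inject₁ s) - grad κ (suc s)

  -- Here `κ` lies above `κ'` and touches it at `s`, so its second difference there is the larger
  -- one. For `κ` the maximum of two drops this gives dominance of the meet.
  curv-mono : ∀ κ κ' s → κ (inject₁ s) ≤ κ' (inject₁ s) → (∀ t → κ' t ≤ κ t) → curv κ s ≤ curv κ' s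
  curv-mono κ κ' zero h g = lin (h ⊕ h ⊕ g (suc zero)) (eq (κ zero) (κ (suc zero)) (κ' zero) (κ' (suc zero)))
    where
    eq : ∀ a b a' b' → a' - (b' - a') - (a - (b - a)) ≡ a' + a' + b - (a + a + b')
    eq = solve-∀
  curv-mono κ κ' (suc s) h g = lin (h ⊕ h ⊕ g (suc (suc s)) ⊕ g (inject₁ (inject₁ s)))
      (eq (κ (suc (inject₁ s))) (κ (suc (suc s))) (κ (inject₁ (inject₁ s))) (κ' (suc (inject₁ s))) (κ' (suc (suc s))) (κ' (inject₁ (inject₁ s))))
    where
    eq : ∀ a b p a' b' p' → (a' - p') - (b' - a') - ((a - p) - (b - a)) ≡ a' + a' + b + p - (a + a + b' + p')
    eq = solve-∀

  lookup-lower : ∀ c κ s → lookup (lower {n} c κ) s ≡ lookup c s - curv κ s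
  lookup-lower c κ s = Vecₚ.lookup∘tabulate (λ s → lookup c s - (grad κ (inject₁ s) - grad κ (suc s))) s

  lookup-drop : ∀ {c c'} (D : Drop {n} c c') s → lookup c s ≡ lookup c' s + curv (κ D) s
  lookup-drop {c} {c'} D s = *-cancelˡ-≡ (N n) (lookup c s) (lookup c' s + curv (κ D) s) (lin≡ {p = scaled c (inject₁ s)} {q = scaled c (inject₁ s)} ≡.refl
      (trans (eq' (N n * lookup c s) (N n) (lookup c' s) (grad (κ D) (inject₁ s)) (grad (κ D) (suc s)) (scaled c (inject₁ s)) (scaled c' (suc s))
         (trans (descend D (inject₁ s)) (cong (_+ (N n * grad (κ D) (inject₁ s))) (scaled-step c' s)))
         (trans (scaled-step c s) (cong (_+ (N n * lookup c s)) (descend D (suc s))))) (sym (+-inverseʳ (scaled c (inject₁ s))))))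
    where
    l : ∀ A N l g g' b → A - N * (l + (g - g')) ≡ (b + N * g' + A) - (b + N * l + N * g)
    l = solve-∀
    eq' : ∀ A N l g g' z b → z ≡ b + N * l + N * g → z ≡ b + N * g' + A → A - N * (l + (g - g')) ≡ 0ℤ
    eq' A N ll g g' z b e₁ e₂ = trans (l A N ll g g' b) (i≡j⇒i-j≡0 (trans (sym e₂) e₁))

module _ {n : ℕ} {1≤n : 1 ℕ.≤ n} {a : Elt n} {F : InF n a} where
  open Boxes 1≤n a F

  meet : ∀ {c c₁ c₂} → Drop c c₁ → Drop c c₂ → Wt n
  meet {c} D₁ D₂ = lower {n} c (λ t → κ D₁ t ⊔ κ D₂ t)

  meet-Drop : ∀ {c c₁ c₂} (D₁ : Drop c c₁) (D₂ : Drop c c₂) → Drop c (meet D₁ D₂)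
  meet-Drop {c} D₁ D₂ = lower-Drop c (λ t → κ D₁ t ⊔ κ D₂ t) (λ t → ≤-trans (κ≥0 D₁ t) (i≤i⊔j (κ D₁ t) (κ D₂ t))) (cong₂ _⊔_ (κ-last D₁) (κ-last D₂))

  meet-dominant : ∀ {c c₁ c₂} (D₁ : Drop c c₁) (D₂ : Drop c c₂) → Dominant n c₁ → Dominant n c₂ → Dominant n (meet D₁ D₂)
  meet-dominant {c} {c₁} {c₂} D₁ D₂ d₁ d₂ s = subst (0ℤ ≤_) (sym (lookup-lower c m s)) (go (≤-total (κ D₁ (inject₁ s)) (κ D₂ (inject₁ s))))
    where
    m : Fin (suc n) → ℤ
    m t = κ D₁ t ⊔ κ D₂ t
    e : ∀ l v w → l + v - w - 0ℤ ≡ l + v - (0ℤ + w)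
    e = solve-∀
    fin : ∀ {c'} (D : Drop c c') → Dominant n c' → curv m s ≤ curv (κ D) s → 0ℤ ≤ lookup c s - curv m s
    fin {c'} D d h = subst (λ z → 0ℤ ≤ z - curv m s) (sym (lookup-drop D s)) (lin (d s ⊕ h) (e (lookup c' s) (curv (κ D) s) (curv m s)))
    go : _ → 0ℤ ≤ lookup c s - curv m s
    go (inj₁ p) = fin D₂ d₂ (curv-mono m (κ D₂) s (≤-reflexive (i≤j⇒i⊔j≡j p)) (λ t → i≤j⊔i (κ D₁ t) (κ D₂ t)))
    go (inj₂ p) = fin D₁ d₁ (curv-mono m (κ D₁) s (≤-reflexive (i≥j⇒i⊔j≡i p)) (λ t → i≤i⊔j (κ D₁ t) (κ D₂ t)))

  -- At each `t` the larger drop is one of the two given ones, so the bound to be shown is one of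
  -- the two known bounds.
  Mem-meet : ∀ {c c₁ c₂ x} (D₁ : Drop c c₁) (D₂ : Drop c c₂) → Dominant n c₁ → Dominant n c₂ → Mem c₁ x → Mem c₂ x → Mem (meet D₁ D₂) x
  Mem-meet {c} {c₁} {c₂} {x} D₁ D₂ d₁ d₂ m₁ m₂ = ≤ᴰ⇒Mem {meet D₁ D₂} {x} π (proj₂ (sorting (val x))) (meet-dominant D₁ D₂ d₁ d₂) (aff m₁) bound
    where
    π = proj₁ (sorting (val x))
    eq : ∀ f k u → f - u ≡ f + k - (u + k)
    eq = solve-∀
    bound : desc x π ≤ᴰ val (θ (meet D₁ D₂))
    bound j t = go (≤-total (κ D₁ t) (κ D₂ t))
      where
      X = partial (floors j (desc x π)) t
      Y : Wt n → ℤ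
      Y c = partial (floors j (val (θ c))) t
      fin : ∀ {c'} (D : Drop c c') → κ D₁ t ⊔ κ D₂ t ≡ κ D t → X ≤ Y c' → X ≤ Y (meet D₁ D₂)
      fin {c'} D e h = subst (X ≤_) (lin≡ (trans (sym (floors-θ D j t)) (trans (floors-θ (meet-Drop D₁ D₂) j t) (cong (_+_ (Y (meet D₁ D₂))) e))) (eq (Y c') (κ D t) (Y (meet D₁ D₂)))) h
      go : _ → X ≤ Y (meet D₁ D₂)
      go (inj₁ p) = fin D₂ (i≤j⇒i⊔j≡j p) (Mem⇒≤ᴰ {c₂} {x} π d₂ m₂ j t)
      go (inj₂ p) = fin D₁ (i≥j⇒i⊔j≡i p) (Mem⇒≤ᴰ {c₁} {x} π d₁ m₁ j t)

-- Lowering a weight by a root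

module _ {n : ℕ} where

  -- The coefficients of the positive root α_p + ... + α_q = ε_p - ε_{q+1}.
  box : Fin n → Fin n → Fin (suc n) → ℤ
  box p q t = if ⌊ toℕ p ℕ.≤? toℕ t ⌋ then (if ⌊ toℕ t ℕ.≤? toℕ q ⌋ then 1ℤ else 0ℤ) else 0ℤ

  data BoxView (p q : Fin n) (t : Fin (suc n)) : Set where
    inside  : toℕ p ℕ.≤ toℕ t → toℕ t ℕ.≤ toℕ q → box p q t ≡ 1ℤ → BoxView p q t
    outside : (toℕ p ℕ.≤ toℕ t → toℕ t ℕ.≤ toℕ q → ⊥) → box p q t ≡ 0ℤ → BoxView p q t

  boxView : ∀ p q t → BoxView p q t
  boxView p q t with toℕ p ℕ.≤? toℕ t in e₁ | toℕ t ℕ.≤? toℕ q in e₂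
  ... | no ¬a | _     = outside (λ a _ → ¬a a) (cong (λ d → if ⌊ d ⌋ then (if ⌊ toℕ t ℕ.≤? toℕ q ⌋ then 1ℤ else 0ℤ) else 0ℤ) e₁)
  ... | yes a | yes b = inside a b (cong₂ (λ d d' → if ⌊ d ⌋ then (if ⌊ d' ⌋ then 1ℤ else 0ℤ) else 0ℤ) e₁ e₂)
  ... | yes a | no ¬b = outside (λ _ b → ¬b b) (cong₂ (λ d d' → if ⌊ d ⌋ then (if ⌊ d' ⌋ then 1ℤ else 0ℤ) else 0ℤ) e₁ e₂)

  box-in : ∀ {p q t} → toℕ p ℕ.≤ toℕ t → toℕ t ℕ.≤ toℕ q → box p q t ≡ 1ℤ
  box-in {p} {q} {t} a b = go (boxView p q t)
    where
    go : BoxView p q t → box p q t ≡ 1ℤ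
    go (inside _ _ e) = e
    go (outside ¬ab _) = ⊥-elim (¬ab a b)

  box≥0 : ∀ p q t → 0ℤ ≤ box p q t
  box≥0 p q t = go (boxView p q t)
    where
    go : BoxView p q t → 0ℤ ≤ box p q t
    go (inside _ _ e)  = subst (0ℤ ≤_) (sym e) (+≤+ ℕ.z≤n)
    go (outside _ e) = ≤-reflexive (sym e)

  box-last : ∀ p q → box p q (fromℕ n) ≡ 0ℤ
  box-last p q = go (boxView p q (fromℕ n))
    where
    go : BoxView p q (fromℕ n) → box p q (fromℕ n) ≡ 0ℤ
    go (inside _ b _) = ⊥-elim (ℕₚ.<⇒≱ (toℕ<n q) (subst (ℕ._≤ toℕ q) (toℕ-fromℕ n) b))
    go (outside _ e) = e

  -- The preceding value of κ, read as 0 at the first index.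
  before : (Fin (suc n) → ℤ) → Fin n → ℤ
  before κ s = κ (inject₁ s) - grad κ (inject₁ s)

  -- The root of `box p q` pairs to 2 with α_p if p = q, and to 1 with α_p and α_q if p < q; its
  -- other pairings with simple roots are at most 0. The thresholds 1 and 2 are those that separate
  -- the zones.
  Good : Wt n → Fin n → Fin n → Set
  Good c p q = (p ≡ q × + 2 ≤ lookup c p) ⊎ (toℕ p ℕ.< toℕ q × 1ℤ ≤ lookup c p × 1ℤ ≤ lookup c q)

  before-box : ∀ p q s → 0ℤ ≤ before (box p q) s × (toℕ p ℕ.< toℕ s → toℕ s ℕ.≤ toℕ q → before (box p q) s ≡ 1ℤ)
  before-box p q zero = subst (0ℤ ≤_) (sym (+-inverseʳ (box p q zero))) ≤-refl , λ ()
  before-box p q (suc s) = subst (0ℤ ≤_) (sym (eq (box p q (suc (inject₁ s))) (box p q (inject₁ (inject₁ s))))) (box≥0 p q (inject₁ (inject₁ s))) ,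
      λ { (ℕ.s≤s a) b → trans (eq (box p q (suc (inject₁ s))) (box p q (inject₁ (inject₁ s)))) (box-in {p} {q} {inject₁ (inject₁ s)}
            (subst (toℕ p ℕ.≤_) (sym i₂) a) (subst (ℕ._≤ toℕ q) (sym i₂) (ℕₚ.≤-trans (ℕₚ.n≤1+n (toℕ s)) b))) }
    where
    eq : ∀ a b → a - (a - b) ≡ b
    eq = solve-∀
    i₂ : toℕ (inject₁ (inject₁ s)) ≡ toℕ s
    i₂ = trans (toℕ-inject₁ (inject₁ s)) (toℕ-inject₁ s)

  curv≡ : ∀ κ s → curv {n} κ s ≡ κ (inject₁ s) + κ (inject₁ s) - before κ s - κ (suc s)
  curv≡ κ s = eq (grad κ (inject₁ s)) (κ (inject₁ s)) (κ (suc s))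
    where
    eq : ∀ g a b → g - (b - a) ≡ a + a - (a - g) - b
    eq = solve-∀

  box-dominant : ∀ {c p q} → Dominant n c → Good c p q → Dominant n (lower c (box p q))
  box-dominant {c} {p} {q} dom good s = subst (0ℤ ≤_) (sym (lookup-lower c (box p q) s)) (i≤j⇒0≤j-i (subst (_≤ lookup c s) (sym (curv≡ (box p q) s)) (go (boxView p q (inject₁ s)))))
    where
    i₁ : toℕ (inject₁ s) ≡ toℕ s
    i₁ = toℕ-inject₁ s
    B = box p q (inject₁ s)
    P = before (box p q) s
    Q = box p q (suc s)
    Q≥0 = box≥0 p q (suc s)
    P≥0 = proj₁ (before-box p q s)
    bound : ∀ {B P Q c k l m} → B ≡ k → l ≤ P → m ≤ Q → k + k - l - m ≤ c → B + B - P - Q ≤ c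
    bound {B} {P} {Q} {c} {.B} {l} {m} ≡.refl h₁ h₂ h₃ = lin (h₁ ⊕ h₂ ⊕ h₃) (eq c B P Q l m)
      where
      eq : ∀ c B P Q l m → c - (B + B - P - Q) ≡ P + Q + c - (l + m + (B + B - l - m))
      eq = solve-∀
    go : BoxView p q (inject₁ s) → B + B - P - Q ≤ lookup c s
    go (outside _ e) = bound e P≥0 Q≥0 (dom s)
    go (inside a b e) = go' good
      where
      p≤s = subst (toℕ p ℕ.≤_) i₁ a
      s≤q = subst (ℕ._≤ toℕ q) i₁ b
      go' : Good c p q → B + B - P - Q ≤ lookup c s
      go' (inj₁ (≡.refl , c2)) = bound e P≥0 Q≥0 (subst (λ r → + 2 ≤ lookup c r) (toℕ-injective (ℕₚ.≤-antisym p≤s s≤q)) c2)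
      go' (inj₂ (p<q , cp , cq)) = cases (ℕₚ.m≤n⇒m<n∨m≡n p≤s) (ℕₚ.m≤n⇒m<n∨m≡n s≤q)
        where
        P1 : toℕ p ℕ.< toℕ s → P ≡ 1ℤ
        P1 h = proj₂ (before-box p q s) h s≤q
        Q1 : toℕ s ℕ.< toℕ q → Q ≡ 1ℤ
        Q1 h = box-in {p} {q} {suc s} (ℕₚ.m≤n⇒m≤1+n p≤s) h
        cases : _ → _ → B + B - P - Q ≤ lookup c s
        cases (inj₁ h) (inj₁ h') = bound e (≤-reflexive (sym (P1 h))) (≤-reflexive (sym (Q1 h'))) (dom s)
        cases (inj₁ h) (inj₂ h') = bound e (≤-reflexive (sym (P1 h))) Q≥0 (subst (λ r → 1ℤ ≤ lookup c r) (toℕ-injective (sym h')) cq)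
        cases (inj₂ h) (inj₁ h') = bound e P≥0 (≤-reflexive (sym (Q1 h'))) (subst (λ r → 1ℤ ≤ lookup c r) (toℕ-injective h) cp)
        cases (inj₂ h) (inj₂ h') = ⊥-elim (ℕₚ.<-irrefl (trans h h') p<q)

  Under : (Fin (suc n) → ℤ) → Fin n → Fin n → Set
  Under κ p q = ∀ t → toℕ p ℕ.≤ toℕ t → toℕ t ℕ.≤ toℕ q → 1ℤ ≤ κ t

  under⇒box≤ : ∀ {κ p q} → (∀ t → 0ℤ ≤ κ t) → Under κ p q → ∀ t → box p q t ≤ κ t
  under⇒box≤ {κ} {p} {q} pos u t = go (boxView p q t)
    where
    go : BoxView p q t → box p q t ≤ κ t
    go (inside a b e) = subst (_≤ κ t) (sym e) (u t a b)
    go (outside _ e)  = subst (_≤ κ t) (sym e) (pos t)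

  module _ {c c' : Wt n} (D : Drop c c') (dom' : Dominant n c') where

    private
      Result : Set
      Result = Σ (Fin n) λ p → Σ (Fin n) λ q → Good c p q × Under (κ D) p q
      k = κ D
      g = grad (κ D)

      -- Dominance of `c'`: at `s` the increments of κ fall by at most ⟨c,α_s⟩.
      slope : ∀ s → g (inject₁ s) - lookup c s ≤ g (suc s)
      slope s = lin (dom' s) (trans (cong (λ z → g (suc s) - (g (inject₁ s) - z)) (lookup-drop D s)) (eq (g (inject₁ s)) (g (suc s)) (lookup c' s)))
        where
        eq : ∀ a b l → b - (a - (l + (a - b))) ≡ l - 0ℤ
        eq = solve-∀

      next : ∀ {s m l} → m ≤ g (inject₁ s) → lookup c s ≤ l → m - l ≤ g (suc s)
      next {s} {m} {l} h h' = ≤-trans (lin (h ⊕ h') (eq (g (inject₁ s)) (lookup c s) m l)) (slope s)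
        where
        eq : ∀ a c m l → a - c - (m - l) ≡ a + l - (m + c)
        eq = solve-∀

      rise : ∀ {s} → 1ℤ ≤ k (inject₁ s) → 0ℤ ≤ g (suc s) → 1ℤ ≤ k (suc s)
      rise {s} h h' = ≤-trans h (0≤i-j⇒j≤i h')

      -- The walk to the right must end in time because κ vanishes at the last index.
      no-last : ∀ {X : Set} → 1ℤ ≤ k (fromℕ n) → X
      no-last h = ⊥-elim (1+a≰a {0ℤ} (subst (1ℤ ≤_) (κ-last D) h))

      -- After the left end `p` has been fixed the increments are still nonnegative; they remain so
      -- across zeros of `c`, up to the next index with ⟨c,α_r⟩ ≥ 1, which becomes the right end.
      phaseB : ∀ p → 1ℤ ≤ lookup c p → ∀ t → toℕ p ℕ.< toℕ t → (∀ u → toℕ p ℕ.≤ toℕ u → toℕ u ℕ.≤ toℕ t → 1ℤ ≤ k u) → 0ℤ ≤ g t → Result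
      phaseB p cp = FinInd.>-weakInduction (λ t → toℕ p ℕ.< toℕ t → (∀ u → toℕ p ℕ.≤ toℕ u → toℕ u ℕ.≤ toℕ t → 1ℤ ≤ k u) → 0ℤ ≤ g t → Result)
        (λ p<t u _ → no-last (u (fromℕ n) (ℕₚ.<⇒≤ p<t) ℕₚ.≤-refl)) step
        where
        step : ∀ r → (toℕ p ℕ.< suc (toℕ r) → (∀ u → toℕ p ℕ.≤ toℕ u → toℕ u ℕ.≤ suc (toℕ r) → 1ℤ ≤ k u) → 0ℤ ≤ g (suc r) → Result) →
               toℕ p ℕ.< toℕ (inject₁ r) → (∀ u → toℕ p ℕ.≤ toℕ u → toℕ u ℕ.≤ toℕ (inject₁ r) → 1ℤ ≤ k u) → 0ℤ ≤ g (inject₁ r) → Result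
        step r rec p<t u g≥0 = go (≤⊎> (lookup c r) 0ℤ)
          where
          i₁ : toℕ (inject₁ r) ≡ toℕ r
          i₁ = toℕ-inject₁ r
          p<r = subst (toℕ p ℕ.<_) i₁ p<t
          go : lookup c r ≤ 0ℤ ⊎ 1ℤ ≤ lookup c r → Result
          go (inj₂ h) = p , r , inj₂ (p<r , cp , h) , λ t a b → u t a (subst (toℕ t ℕ.≤_) (sym i₁) b)
          go (inj₁ h) = rec (ℕₚ.m≤n⇒m≤1+n p<r) u' g'
            where
            g' : 0ℤ ≤ g (suc r)
            g' = next {r} g≥0 h
            u' : ∀ v → toℕ p ℕ.≤ toℕ v → toℕ v ℕ.≤ suc (toℕ r) → 1ℤ ≤ k v
            u' v a b = case (ℕₚ.m≤n⇒m<n∨m≡n b)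
              where
              case : _ → 1ℤ ≤ k v
              case (inj₁ (ℕ.s≤s q)) = u v a (subst (toℕ v ℕ.≤_) (sym i₁) q)
              case (inj₂ q) = subst (λ z → 1ℤ ≤ k z) (toℕ-injective {i = suc r} (sym q)) (rise {r} (u (inject₁ r) (ℕₚ.<⇒≤ p<t) ℕₚ.≤-refl) g')

      -- Before any positive ⟨c,α_s⟩ is met the increments stay at least 1. A value ≥ 2 ends the
      -- search with a simple root; the value 1 lowers the increment at most to 0 and starts
      -- `phaseB`.
      phaseA : ∀ t → 1ℤ ≤ k t → 1ℤ ≤ g t → Result
      phaseA = FinInd.>-weakInduction (λ t → 1ℤ ≤ k t → 1ℤ ≤ g t → Result) (λ h _ → no-last h) step
        where
        step : ∀ s → (1ℤ ≤ k (suc s) → 1ℤ ≤ g (suc s) → Result) → 1ℤ ≤ k (inject₁ s) → 1ℤ ≤ g (inject₁ s) → Result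
        step s rec hk hg = go (≤⊎> (lookup c s) 0ℤ) (≤⊎> (lookup c s) 1ℤ)
          where
          i₁ : toℕ (inject₁ s) ≡ toℕ s
          i₁ = toℕ-inject₁ s
          go : lookup c s ≤ 0ℤ ⊎ 1ℤ ≤ lookup c s → lookup c s ≤ 1ℤ ⊎ + 2 ≤ lookup c s → Result
          go (inj₁ h) _ = rec (rise {s} hk (1+≤⇒≤ {0ℤ} g')) g'
            where
            g' : 1ℤ ≤ g (suc s)
            g' = next {s} hg h
          go (inj₂ h) (inj₂ h₂) = s , s , inj₁ (≡.refl , h₂) , λ t a b → subst (λ z → 1ℤ ≤ k z) (toℕ-injective (trans i₁ (ℕₚ.≤-antisym a b))) hk
          go (inj₂ h) (inj₁ h₁) = phaseB s h (suc s) ℕₚ.≤-refl u g'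
            where
            g' : 0ℤ ≤ g (suc s)
            g' = next {s} hg h₁
            u : ∀ v → toℕ s ℕ.≤ toℕ v → toℕ v ℕ.≤ suc (toℕ s) → 1ℤ ≤ k v
            u v a b = case (ℕₚ.m≤n⇒m<n∨m≡n b)
              where
              case : _ → 1ℤ ≤ k v
              case (inj₁ (ℕ.s≤s q)) = subst (λ z → 1ℤ ≤ k z) (toℕ-injective (trans i₁ (ℕₚ.≤-antisym a q))) hk
              case (inj₂ q) = subst (λ z → 1ℤ ≤ k z) (toℕ-injective {i = suc s} (sym q)) (rise {s} hk g')

      zero-or-one : ∀ t → k t ≡ 0ℤ ⊎ 1ℤ ≤ k t
      zero-or-one t = go (≤⊎> (k t) 0ℤ)
        where
        go : _ → k t ≡ 0ℤ ⊎ 1ℤ ≤ k t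
        go (inj₁ h) = inj₁ (≤-antisym h (κ≥0 D t))
        go (inj₂ h) = inj₂ h

      search : ∀ t → Result ⊎ k t ≡ 0ℤ
      search = FinInd.<-weakInduction (λ t → Result ⊎ k t ≡ 0ℤ) (start (zero-or-one zero)) step
        where
        start : _ → Result ⊎ k zero ≡ 0ℤ
        start (inj₁ e) = inj₂ e
        start (inj₂ h) = inj₁ (phaseA zero h h)
        step : ∀ s → Result ⊎ k (inject₁ s) ≡ 0ℤ → Result ⊎ k (suc s) ≡ 0ℤ
        step s (inj₁ r) = inj₁ r
        step s (inj₂ e) = go (zero-or-one (suc s))
          where
          go : _ → Result ⊎ k (suc s) ≡ 0ℤ
          go (inj₁ e') = inj₂ e'
          go (inj₂ h) = inj₁ (phaseA (suc s) h (subst (λ z → 1ℤ ≤ k (suc s) - z) (sym e) (subst (1ℤ ≤_) (sym (+-identityʳ (k (suc s)))) h)))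

    -- Walk right from the first s with κ_s > 0.  While ⟨c,α_s⟩ = 0 the increments of κ do not
    -- decrease, so κ stays positive until it has met an s with ⟨c,α_s⟩ ≥ 2 or two with ⟨c,α_s⟩ ≥ 1.
    findBox : c ≢ c' → Σ (Fin n) λ p → Σ (Fin n) λ q → Good c p q × Under (κ D) p q
    findBox c≢c' = go (Finₚ.any? (λ t → ℤₚ._≤?_ 1ℤ (k t)))
      where
      go : Dec (∃ λ t → 1ℤ ≤ k t) → Result
      go (yes (t , h)) = fin (search t)
        where
        fin : Result ⊎ k t ≡ 0ℤ → Result
        fin (inj₁ r) = r
        fin (inj₂ e) = ⊥-elim (1+a≰a {0ℤ} (subst (1ℤ ≤_) e h))
      go (no ¬h) = ⊥-elim (c≢c' (Drop-zero D (λ t → zr t (zero-or-one t))))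
        where
        zr : ∀ t → k t ≡ 0ℤ ⊎ 1ℤ ≤ k t → k t ≡ 0ℤ
        zr t (inj₁ e) = e
        zr t (inj₂ h) = ⊥-elim (¬h (t , h))

-- Independence of the point of the zone

increasing⇒≤ : ∀ {n} (σ : Fin (suc n) → Fin (suc n)) → (∀ {s t} → toℕ s ℕ.< toℕ t → toℕ (σ s) ℕ.< toℕ (σ t)) → ∀ t → toℕ t ℕ.≤ toℕ (σ t)
increasing⇒≤ σ inc = FinInd.<-weakInduction (λ t → toℕ t ℕ.≤ toℕ (σ t)) ℕ.z≤n
  (λ s h → ℕₚ.≤-trans (ℕ.s≤s (subst (ℕ._≤ toℕ (σ (inject₁ s))) (toℕ-inject₁ s) h)) (inc {inject₁ s} {suc s} (ℕ.s≤s (ℕₚ.≤-reflexive (toℕ-inject₁ s)))))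

module _ {n : ℕ} where

  aff-injective : ∀ {x} → IsAff {n} x → ∀ {s t} → val x s ≡ val x t → s ≡ t
  aff-injective {x} G {s} {t} e = go (s Fin.≟ t)
    where
    eq : ∀ a N → a ≡ a + N * 0ℤ
    eq = solve-∀
    go : Dec (s ≡ t) → s ≡ t
    go (yes p) = p
    go (no ¬p) = ⊥-elim (val-≢ 0ℤ G ¬p (trans e (eq (val x t) (N n))))

  sorting-< : ∀ {x} → (∀ {s t} → x s ≡ x t → s ≡ t) → ∀ (π ρ : Permutation′ (suc n)) →
    Decreasing (λ t → x (π ⟨$⟩ʳ t)) → Decreasing (λ t → x (ρ ⟨$⟩ʳ t)) →
    ∀ {s t} → toℕ s ℕ.< toℕ t → toℕ (π ⟨$⟩ˡ (ρ ⟨$⟩ʳ s)) ℕ.< toℕ (π ⟨$⟩ˡ (ρ ⟨$⟩ʳ t))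
  sorting-< {x} x-inj π ρ dπ dρ {s} {t} s<t = ℕₚ.≰⇒> λ h → ℕₚ.<-irrefl (cong toℕ (ρ-inj (x-inj (≤-antisym
      (subst₂ _≤_ (e s) (e t) (dπ h)) (dρ (ℕₚ.<⇒≤ s<t)))))) s<t
    where
    e : ∀ s → x (π ⟨$⟩ʳ (π ⟨$⟩ˡ (ρ ⟨$⟩ʳ s))) ≡ x (ρ ⟨$⟩ʳ s)
    e s = cong x (Perm.inverseʳ π)
    ρ-inj : ∀ {s t} → ρ ⟨$⟩ʳ s ≡ ρ ⟨$⟩ʳ t → s ≡ t
    ρ-inj {s} {t} h = trans (sym (Perm.inverseˡ ρ)) (trans (cong (ρ ⟨$⟩ˡ_) h) (Perm.inverseˡ ρ))

  -- Two sorting permutations of distinct entries differ by an increasing map whose inverse is also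
  -- increasing; neither moves an index to the left, so both are the identity.
  sorting-unique : ∀ {x} → (∀ {s t} → x s ≡ x t → s ≡ t) → ∀ (π ρ : Permutation′ (suc n)) →
    Decreasing (λ t → x (π ⟨$⟩ʳ t)) → Decreasing (λ t → x (ρ ⟨$⟩ʳ t)) → ∀ u → π ⟨$⟩ˡ u ≡ ρ ⟨$⟩ˡ u
  sorting-unique {x} x-inj π ρ dπ dρ u = trans (cong (π ⟨$⟩ˡ_) (sym (Perm.inverseʳ ρ))) (σ-id (ρ ⟨$⟩ˡ u))
    where
    σ τ : Fin (suc n) → Fin (suc n)
    σ t = π ⟨$⟩ˡ (ρ ⟨$⟩ʳ t)
    τ t = ρ ⟨$⟩ˡ (π ⟨$⟩ʳ t)
    τσ : ∀ t → τ (σ t) ≡ t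
    τσ t = trans (cong (ρ ⟨$⟩ˡ_) (Perm.inverseʳ π)) (Perm.inverseˡ ρ)
    σ-id : ∀ t → σ t ≡ t
    σ-id t = toℕ-injective (ℕₚ.≤-antisym
      (subst (λ z → toℕ (σ t) ℕ.≤ toℕ z) (τσ t) (increasing⇒≤ τ (sorting-< {x} x-inj ρ π dρ dπ) (σ t)))
      (increasing⇒≤ σ (sorting-< {x} x-inj π ρ dπ dρ) t))

  -- The constant residue `h₀` goes into the threshold, which is arbitrary in `≤ᴰ`, and the
  -- multiples of N leave the floors alike on both sides.
  ≤ᴰ-shift : ∀ {d d̂ y ŷ η : Fin (suc n) → ℤ} (g : Fin (suc n) → ℤ) h₀ → (∀ t → η t ≡ N n * g t + h₀) →
             (∀ t → d̂ t ≡ d t + η t) → (∀ t → ŷ t ≡ y t + η t) → d ≤ᴰ y → d̂ ≤ᴰ ŷ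
  ≤ᴰ-shift {d} {d̂} {y} {ŷ} {η} g h₀ ηe de ye le j t = subst₂ _≤_ (sym (sh d d̂ de)) (sym (sh y ŷ ye)) (+-monoˡ-≤ (partial g t) (le (j - h₀) t))
    where
    eq : ∀ f N g h j → f + (N * g + h) - j ≡ f - (j - h) + N * g
    eq = solve-∀
    sh : ∀ f f̂ → (∀ t → f̂ t ≡ f t + η t) → partial (floors j f̂) t ≡ partial (floors (j - h₀) f) t + partial g t
    sh f f̂ fe = trans (partial-cong (λ s → trans (cong (fl n) (trans (cong (_- j) (trans (fe s) (cong (_+_ (f s)) (ηe s)))) (eq (f s) (N n) (g s) h₀ j))) (fl-shift (f s - (j - h₀)) (g s))) t)
                      (partial-+ (floors (j - h₀) f) g t)

  Same : Wt n → Wt n → Set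
  Same c ĉ = ∀ s → lookup c s ≡ lookup ĉ s ⊎ (+ 2 ≤ lookup c s × + 2 ≤ lookup ĉ s)

  Same-sym : ∀ {c ĉ} → Same c ĉ → Same ĉ c
  Same-sym h s with h s
  ... | inj₁ e = inj₁ (sym e)
  ... | inj₂ (p , q) = inj₂ (q , p)

  zone⇒Same : ∀ {i c ĉ} → InZone n i c → InZone n i ĉ → Same c ĉ
  zone⇒Same {i} {c} {ĉ} (_ , z) (_ , ẑ) s = go (lookup i s) (z s) (ẑ s)
    where
    go : ∀ f → zoneCond f (lookup c s) → zoneCond f (lookup ĉ s) → lookup c s ≡ lookup ĉ s ⊎ (+ 2 ≤ lookup c s × + 2 ≤ lookup ĉ s)
    go zero                     p q = inj₁ (trans p (sym q))
    go (suc zero)           p q = inj₁ (trans p (sym q))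
    go (suc (suc zero)) p q = inj₂ (p , q)

  Good-Same : ∀ {c ĉ p q} → Same c ĉ → Good c p q → Good ĉ p q
  Good-Same {c} {ĉ} {p} sm (inj₁ (e , h)) = inj₁ (e , two h (sm p))
    where
    two : ∀ {a b} → + 2 ≤ a → a ≡ b ⊎ (+ 2 ≤ a × + 2 ≤ b) → + 2 ≤ b
    two h (inj₁ ≡.refl) = h
    two h (inj₂ (_ , r)) = r
  Good-Same {c} {ĉ} {p} {q} sm (inj₂ (l , h , h')) = inj₂ (l , one h (sm p) , one h' (sm q))
    where
    one : ∀ {a b} → 1ℤ ≤ a → a ≡ b ⊎ (+ 2 ≤ a × + 2 ≤ b) → 1ℤ ≤ b
    one h (inj₁ ≡.refl) = h
    one h (inj₂ (_ , r)) = ≤-trans (+≤+ (ℕ.s≤s ℕ.z≤n)) r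

  box-Drop : ∀ (c : Wt n) p q → Drop c (lower c (box p q))
  box-Drop c p q = lower-Drop c (box p q) (box≥0 p q) (box-last p q)

  κ-≡0 : ∀ {c c'} (D : Drop {n} c c') → c ≡ c' → ∀ t → κ D t ≡ 0ℤ
  κ-≡0 {c} D ≡.refl t = κ-unique D (Drop-refl c) t

  box-≢ : ∀ (c : Wt n) p q → toℕ p ℕ.≤ toℕ q → c ≢ lower c (box p q)
  box-≢ c p q p≤q e = 1+a≰a {0ℤ} (≤-reflexive (trans (sym (box-in {n} {p} {q} {inject₁ p} (ℕₚ.≤-reflexive (sym (toℕ-inject₁ p))) (subst (ℕ._≤ toℕ q) (sym (toℕ-inject₁ p)) p≤q)))
      (κ-≡0 (box-Drop c p q) e (inject₁ p))))

-- Transport of PB_a between weights of one zone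

module Hat {n : ℕ} {1≤n : 1 ℕ.≤ n} {a : Elt n} {F : InF n a} where
  open Boxes 1≤n a F

  -- PB_a(c) with all smaller dominant weights in place of the covered ones; this form is the one
  -- that passes to other weights of the zone.
  record Minimal (c : Wt n) (x : Elt n) : Set where
    constructor minimal
    field
      member : Mem c x
      least  : ∀ c' → Dominant n c' → Drop c c' → c ≢ c' → ¬ Mem c' x
  open Minimal public

  module _ (c ĉ : Wt n) where

    η : Fin (suc n) → ℤ
    η t = scaled ĉ t - scaled c t

    η-form : ∀ t → η t ≡ N n * (height ĉ t - height c t) + (charge c - charge ĉ)
    η-form t = eq (N n) (height ĉ t) (height c t) (charge ĉ) (charge c)
      where
      eq : ∀ N a b k l → N * a + - k - (N * b + - l) ≡ N * (a - b) + (l - k)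
      eq = solve-∀

    order : Elt n → Permutation′ (suc n)
    order x = proj₁ (sorting (val x))

    -- N (ĉ - c) is added to the decreasingly sorted window, and the order is restored.
    hat : Elt n → Elt n
    hat x = translate x (λ t → η (order x ⟨$⟩ˡ t))

    val-hat : ∀ x t → val (hat x) t ≡ val x t + η (order x ⟨$⟩ˡ t)
    val-hat x t = val-fromVal (λ t → val x t + η (order x ⟨$⟩ˡ t)) t

    desc-hat : ∀ x t → desc (hat x) (order x) t ≡ desc x (order x) t + η t
    desc-hat x t = trans (val-hat x (order x ⟨$⟩ʳ t)) (cong (λ u → desc x (order x) t + η u) (Perm.inverseˡ (order x) {t}))

    aff-hat : ∀ {x} → IsAff x → IsAff (hat x)
    aff-hat {x} G = isAff-translate {x = x} {λ t → η (order x ⟨$⟩ˡ t)} (λ t → height ĉ (order x ⟨$⟩ˡ t) - height c (order x ⟨$⟩ˡ t)) (charge c - charge ĉ) G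
      (λ t → η-form (order x ⟨$⟩ˡ t))
      (trans (sym (sum-permute η (Perm.flip (order x)))) (trans (sum-sub (scaled ĉ) (scaled c)) (cong₂ _-_ (scaled-sum ĉ) (scaled-sum c))))

    θ-shift : ∀ {c' ĉ'} (D : Drop c c') (D̂ : Drop ĉ ĉ') → (∀ t → κ D t ≡ κ D̂ t) → ∀ t → val (θ ĉ') t ≡ val (θ c') t + η t
    θ-shift {c'} {ĉ'} D D̂ h t = trans (val-θ ĉ' t) (trans (cong (_+_ (val base t))
        (eq (scaled ĉ' t) (scaled c' t) (scaled ĉ t) (scaled c t) (N n * grad (κ D) t) (N n * grad (κ D̂) t) (descend D̂ t) (descend D t) (cong (λ z → N n * z) (grad-cong h t))))
        (trans (sym (+-assoc (val base t) (scaled c' t) (η t))) (cong (_+ η t) (sym (val-θ c' t)))))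
      where
      l : ∀ a b g → a ≡ b + (a + g - (b + g))
      l = solve-∀
      eq : ∀ a b p q g ĝ → p ≡ a + ĝ → q ≡ b + g → g ≡ ĝ → a ≡ b + (p - q)
      eq a b p q g ĝ ≡.refl ≡.refl ≡.refl = l a b g

    -- The bound `≤ᴰ` holds for the window of `hat x` in any order, in particular in the one that
    -- sorts `x`.
    Mem-unhat : ∀ {c' ĉ' x} (D : Drop c c') (D̂ : Drop ĉ ĉ') → (∀ t → κ D t ≡ κ D̂ t) → Dominant n c' → Dominant n ĉ' → IsAff x →
                Mem ĉ' (hat x) → Mem c' x
    Mem-unhat {c'} {ĉ'} {x} D D̂ h dom' dom̂' G m = ≤ᴰ⇒Mem {c'} {x} (order x) (proj₂ (sorting (val x))) dom' G
        (≤ᴰ-shift {n} {desc (hat x) (order x)} {desc x (order x)} {val (θ ĉ')} {val (θ c')} {λ t → - η t} (λ t → - (height ĉ t - height c t)) (- (charge c - charge ĉ))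
          (λ t → trans (cong -_ (η-form t)) (e₁ (N n) (height ĉ t - height c t) (charge c - charge ĉ)))
          (λ t → sym (trans (cong (_+ - η t) (desc-hat x t)) (e₂ (desc x (order x) t) (η t))))
          (λ t → sym (trans (cong (_+ - η t) (θ-shift D D̂ h t)) (e₂ (val (θ c') t) (η t))))
          (Mem⇒≤ᴰ {ĉ'} {hat x} (order x) dom̂' m))
      where
      e₁ : ∀ N g h → - (N * g + h) ≡ N * (- g) + - h
      e₁ = solve-∀
      e₂ : ∀ a b → a + b + - b ≡ a
      e₂ = solve-∀

    -- The order that sorts `x` has to sort `hat x` as well; for minimal `x` this is `hat-dec`.
    Mem-hat : ∀ {c' ĉ' x} (D : Drop c c') (D̂ : Drop ĉ ĉ') → (∀ t → κ D t ≡ κ D̂ t) → Dominant n c' → Dominant n ĉ' →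
              Decreasing (desc (hat x) (order x)) → Mem c' x → Mem ĉ' (hat x)
    Mem-hat {c'} {ĉ'} {x} D D̂ h dom' dom̂' dec m = ≤ᴰ⇒Mem {ĉ'} {hat x} (order x) dec dom̂' (aff-hat (aff m))
        (≤ᴰ-shift {n} {desc x (order x)} {desc (hat x) (order x)} {val (θ c')} {val (θ ĉ')} {η} (λ t → height ĉ t - height c t) (charge c - charge ĉ)
          η-form (desc-hat x) (θ-shift D D̂ h) (Mem⇒≤ᴰ {c'} {x} (order x) dom' m))

    -- Subtracting α_s lowers only the bounds on the `s`-th partial sums, by 1. As `x` violates the
    -- lowered bounds, one of the original ones is attained at some threshold. There the sorted
    -- window of `x` falls from s to s + 1 at least as steeply as that of `θ c`, measured in floors.
    gap : ∀ {x} → Dominant n c → Minimal c x → ∀ s → + 2 ≤ lookup c s →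
          1ℤ + (desc x (order x) (suc s) + N n * (lookup c s - 1ℤ)) ≤ desc x (order x) (inject₁ s)
    gap {x} dom m s c2 = go (≤⊎> (d (inject₁ s)) (d (suc s) + N n * (lookup c s - 1ℤ)))
      where
      d = desc x (order x)
      c⁻ = lower c (box s s)
      D = box-Drop c s s
      dom⁻ : Dominant n c⁻
      dom⁻ = box-dominant {n} {c} {s} {s} dom (inj₁ (≡.refl , c2))
      Fd Fθ : ℤ → Fin (suc n) → ℤ
      Fd j t = partial (floors j d) t
      Fθ j t = partial (floors j (val (θ c))) t
      le : ∀ j t → Fd j t ≤ Fθ j t
      le = Mem⇒≤ᴰ {c} {x} (order x) dom (member m)
      go : d (inject₁ s) ≤ d (suc s) + N n * (lookup c s - 1ℤ) ⊎ 1ℤ + (d (suc s) + N n * (lookup c s - 1ℤ)) ≤ d (inject₁ s) →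
           1ℤ + (d (suc s) + N n * (lookup c s - 1ℤ)) ≤ d (inject₁ s)
      go (inj₂ h) = h
      go (inj₁ small) = ⊥-elim (least m c⁻ dom⁻ D (box-≢ c s s ℕₚ.≤-refl) (≤ᴰ⇒Mem {c⁻} {x} (order x) (proj₂ (sorting (val x))) dom⁻ (aff (member m)) bound))
        where
        -- Equality at `s` together with the bound at the preceding index compares the floors at
        -- `s`; with the bound at the next index it compares those at s + 1 (`floor-ge`).
        floor-le : ∀ j → Fθ j (inject₁ s) ≤ Fd j (inject₁ s) → floors j (val (θ c)) (inject₁ s) ≤ floors j d (inject₁ s)
        floor-le j h = head s h
          where
          head : ∀ s → Fθ j (inject₁ s) ≤ Fd j (inject₁ s) → floors j (val (θ c)) (inject₁ s) ≤ floors j d (inject₁ s)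
          head zero h = subst₂ _≤_ (partial-zero (floors j (val (θ c)))) (partial-zero (floors j d)) h
          head (suc s) h = lin (subst₂ _≤_ (partial-suc (floors j (val (θ c))) (inject₁ s)) (partial-suc (floors j d) (inject₁ s)) h ⊕ le j (inject₁ (inject₁ s)))
              (e (floors j d (suc (inject₁ s))) (floors j (val (θ c)) (suc (inject₁ s))) (Fθ j (inject₁ (inject₁ s))) (Fd j (inject₁ (inject₁ s))))
            where
            e : ∀ a b p q → a - b ≡ q + a + p - (p + b + q)
            e = solve-∀
        floor-ge : ∀ j → Fθ j (inject₁ s) ≤ Fd j (inject₁ s) → floors j d (suc s) ≤ floors j (val (θ c)) (suc s)
        floor-ge j h = lin (subst₂ _≤_ (partial-suc (floors j d) s) (partial-suc (floors j (val (θ c))) s) (le j (suc s)) ⊕ h)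
              (e (floors j (val (θ c)) (suc s)) (floors j d (suc s)) (Fd j (inject₁ s)) (Fθ j (inject₁ s)))
            where
            e : ∀ a b p q → a - b ≡ q + a + p - (p + b + q)
            e = solve-∀
        θ-gap : val (θ c) (suc s) + N n * lookup c s ≤ val (θ c) (inject₁ s)
        θ-gap = subst₂ _≤_ (trans (sym (+-assoc (val base (suc s)) (scaled c (suc s)) (N n * lookup c s))) (cong (_+ (N n * lookup c s)) (sym (val-θ c (suc s)))))
                  (sym (trans (val-θ c (inject₁ s)) (cong (_+_ (val base (inject₁ s))) (scaled-step c s))))
                  (+-monoˡ-≤ (scaled c (suc s) + N n * lookup c s) (base-dec {inject₁ s} {suc s} (inject₁≤suc s)))
        -- The floors of `θ c` drop by at least ⟨c,α_s⟩ at `s`, those of `x` by at most ⟨c,α_s⟩ - 1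
        -- if the gap is small.
        absurd : ∀ j → ¬ (Fθ j (inject₁ s) ≤ Fd j (inject₁ s))
        absurd j h = 1+a≰a {u} (lin (A ⊕ B ⊕ C ⊕ E) (e u v w z (lookup c s)))
          where
          u = floors j d (suc s)
          v = floors j (val (θ c)) (suc s)
          w = floors j (val (θ c)) (inject₁ s)
          z = floors j d (inject₁ s)
          A : u ≤ v
          A = floor-ge j h
          B : v + lookup c s ≤ w
          B = ≤-trans (≤-reflexive (trans (sym (fl-shift (val (θ c) (suc s) - j) (lookup c s))) (cong (fl n) (e' (val (θ c) (suc s)) j (N n * lookup c s))))) (fl-mono (+-monoˡ-≤ (- j) θ-gap))
            where
            e' : ∀ a j k → a - j + k ≡ a + k - j
            e' = solve-∀
          C : w ≤ z
          C = floor-le j h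
          E : z ≤ u + (lookup c s - 1ℤ)
          E = ≤-trans (fl-mono (+-monoˡ-≤ (- j) small)) (≤-reflexive (trans (cong (fl n) (e' (d (suc s)) j (N n * (lookup c s - 1ℤ)))) (fl-shift (d (suc s) - j) (lookup c s - 1ℤ))))
            where
            e' : ∀ a j k → a + k - j ≡ a - j + k
            e' = solve-∀
          e : ∀ u v w z c → u - (1ℤ + u) ≡ v + w + z + (u + (c - 1ℤ)) - (u + (v + c) + w + z)
          e = solve-∀
        bound : d ≤ᴰ val (θ c⁻)
        bound j t = lin (atBox (boxView s s t)) (e (partial (floors j (val (θ c⁻))) t) (Fd j t) (box s s t) (Fθ j t) (floors-θ D j t))
          where
          e₀ : ∀ a b k → a - b ≡ a + k - (b + k)
          e₀ = solve-∀
          e : ∀ a b k f → f ≡ a + k → a - b ≡ f - (b + k)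
          e a b k f ≡.refl = e₀ a b k
          atBox : BoxView s s t → Fd j t + box s s t ≤ Fθ j t
          atBox (outside _ q) = subst (_≤ Fθ j t) (trans (sym (+-identityʳ (Fd j t))) (cong (_+_ (Fd j t)) (sym q))) (le j t)
          atBox (inside p p' q) = at (toℕ-injective (trans (toℕ-inject₁ s) (ℕₚ.≤-antisym p p')))
            where
            at : inject₁ s ≡ t → Fd j t + box s s t ≤ Fθ j t
            at ≡.refl = cs (≤⊎> (Fθ j t) (Fd j t))
              where
              cs : _ → Fd j t + box s s t ≤ Fθ j t
              cs (inj₁ h) = ⊥-elim (absurd j h)
              cs (inj₂ h) = subst (_≤ Fθ j t) (trans (+-comm 1ℤ (Fd j t)) (cong (_+_ (Fd j t)) (sym q))) h

    η-step : ∀ s → η (inject₁ s) ≡ η (suc s) + N n * (lookup ĉ s - lookup c s)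
    η-step s = trans (cong₂ _-_ (scaled-step ĉ s) (scaled-step c s)) (eq (scaled ĉ (suc s)) (scaled c (suc s)) (N n) (lookup ĉ s) (lookup c s))
      where
      eq : ∀ a b N k l → a + N * k - (b + N * l) ≡ a - b + N * (k - l)
      eq = solve-∀

    hat-dec : ∀ {x} → Dominant n c → Same c ĉ → Minimal c x → Decreasing (desc (hat x) (order x))
    hat-dec {x} dom sm m = decreasing (desc (hat x) (order x)) step
      where
      d = desc x (order x)
      step : ∀ s → desc (hat x) (order x) (suc s) ≤ desc (hat x) (order x) (inject₁ s)
      step s = subst₂ _≤_ (sym (desc-hat x (suc s))) (sym (trans (desc-hat x (inject₁ s)) (cong (_+_ (d (inject₁ s))) (η-step s)))) (go (sm s))
        where
        e₁ : ∀ a b h N k → b + (h + N * (k - k)) - (a + h) ≡ b - a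
        e₁ = solve-∀
        e₂ : ∀ a b h N k l → b + (h + N * (k - l)) - (a + h) ≡ b + N * (k - 1ℤ) + 1ℤ - (1ℤ + (a + N * (l - 1ℤ)) + N * 0ℤ + 0ℤ)
        e₂ = solve-∀
        go : lookup c s ≡ lookup ĉ s ⊎ (+ 2 ≤ lookup c s × + 2 ≤ lookup ĉ s) → d (suc s) + η (suc s) ≤ d (inject₁ s) + (η (suc s) + N n * (lookup ĉ s - lookup c s))
        go (inj₁ e) = lin (proj₂ (sorting (val x)) {inject₁ s} {suc s} (inject₁≤suc s))
                      (trans (cong (λ k → d (inject₁ s) + (η (suc s) + N n * (lookup ĉ s - k)) - (d (suc s) + η (suc s))) e) (e₁ (d (suc s)) (d (inject₁ s)) (η (suc s)) (N n) (lookup ĉ s)))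
        -- The gap of more than N (⟨c,α_s⟩ - 1) changes by N (⟨ĉ,α_s⟩ - ⟨c,α_s⟩), and what remains
        -- exceeds N (⟨ĉ,α_s⟩ - 1) ≥ 0.
        go (inj₂ (p , q)) = lin (gap {x} dom m s p ⊕ N-mono {n} {0ℤ} {lookup ĉ s - 1ℤ} (i≤j⇒0≤j-i (≤-trans (+≤+ (ℕ.s≤s ℕ.z≤n)) q)) ⊕ +≤+ ℕ.z≤n)
                      (e₂ (d (suc s)) (d (inject₁ s)) (η (suc s)) (N n) (lookup ĉ s) (lookup c s))

    -- If `hat x` belonged to a smaller weight, it would belong to `ĉ` minus a root. The same root
    -- can be subtracted from `c`, since `Good` only sees the zone, and undoing the shift
    -- contradicts minimality of `x`.
    hat-Minimal : ∀ {x} → Dominant n c → Dominant n ĉ → Same c ĉ → Minimal c x → Minimal ĉ (hat x)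
    hat-Minimal {x} dom dom̂ sm m = minimal (Mem-hat {c} {ĉ} {x} (Drop-refl c) (Drop-refl ĉ) (λ _ → ≡.refl) dom dom̂ (hat-dec {x} dom sm m) (member m)) lst
      where
      lst : ∀ ĉ' → Dominant n ĉ' → Drop ĉ ĉ' → ĉ ≢ ĉ' → ¬ Mem ĉ' (hat x)
      lst ĉ' dom̂' D̂ ne mem' = go (findBox D̂ dom̂' ne)
        where
        go : (Σ (Fin n) λ p → Σ (Fin n) λ q → Good ĉ p q × Under (κ D̂) p q) → ⊥
        go (p , q , good , u) = least m (lower c (box p q)) dom⁻ (box-Drop c p q) (box-≢ c p q (p≤q good))
            (Mem-unhat {x = x} (box-Drop c p q) (box-Drop ĉ p q) (λ _ → ≡.refl) dom⁻ dom̂⁻ (aff (member m))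
              (Mem-up {c = lower ĉ (box p q)} {ĉ'} {hat x} (Drop-sub (box-Drop ĉ p q) D̂ (under⇒box≤ {n} {κ D̂} {p} {q} (κ≥0 D̂) u)) dom̂⁻ dom̂' mem'))
          where
          p≤q : Good ĉ p q → toℕ p ℕ.≤ toℕ q
          p≤q (inj₁ (≡.refl , _)) = ℕₚ.≤-refl
          p≤q (inj₂ (h , _)) = ℕₚ.<⇒≤ h
          dom̂⁻ : Dominant n (lower ĉ (box p q))
          dom̂⁻ = box-dominant {n} {ĉ} {p} {q} dom̂ good
          dom⁻ : Dominant n (lower c (box p q))
          dom⁻ = box-dominant {n} {c} {p} {q} dom (Good-Same {n} {ĉ} {c} {p} {q} (Same-sym {n} {c} {ĉ} sm) good)

  -- The entries of `hat x` are distinct and sorted by the permutation of `x`, so the shift back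
  -- uses the same permutation and cancels.
  hat-hat : ∀ c ĉ {x} → Dominant n c → Same c ĉ → Minimal c x → hat ĉ c (hat c ĉ x) ≡ x
  hat-hat c ĉ {x} dom sm m = val-injective λ t → trans (val-hat ĉ c (hat c ĉ x) t) (trans (cong (_+ η ĉ c (order ĉ c (hat c ĉ x) ⟨$⟩ˡ t)) (val-hat c ĉ x t))
      (trans (cong (λ u → val x t + η c ĉ (order c ĉ x ⟨$⟩ˡ t) + η ĉ c u) (same t)) (eq (val x t) (scaled ĉ (order c ĉ x ⟨$⟩ˡ t)) (scaled c (order c ĉ x ⟨$⟩ˡ t)))))
    where
    eq : ∀ v a b → v + (a - b) + (b - a) ≡ v
    eq = solve-∀
    same : ∀ t → order ĉ c (hat c ĉ x) ⟨$⟩ˡ t ≡ order c ĉ x ⟨$⟩ˡ t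
    same = sorting-unique {n} {val (hat c ĉ x)} (λ {s} {t} → aff-injective (aff-hat c ĉ (aff (member m))) {s} {t}) (order ĉ c (hat c ĉ x)) (order c ĉ x)
             (proj₂ (sorting (val (hat c ĉ x)))) (hat-dec c ĉ {x} dom sm m)

-- Finite enumerations

-- `Card` with repetitions allowed; they are removed once equality is decidable.
Listing : {A : Set} → (A → Set) → Set
Listing {A} P = Σ (List A) λ xs → ∀ x → (x ∈ xs) ⇔ P x

module _ {A : Set} where

  Card-cong : ∀ {P Q : A → Set} {k} → (∀ x → P x ⇔ Q x) → Card P k → Card Q k
  Card-cong h (xs , l , u , m) = xs , l , u , λ x → mk⇔ (λ p → Equivalence.to (h x) (Equivalence.to (m x) p)) (λ q → Equivalence.from (m x) (Equivalence.from (h x) q))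

  Card-≡ : ∀ {P : A → Set} {k l} → k ≡ l → Card P k → Card P l
  Card-≡ ≡.refl c = c

  -- Source of decidability for `InJ` and `Mem`, whose definitions quantify over infinite types.
  listing? : DecidableEquality A → ∀ {P : A → Set} → Listing P → ∀ x → Dec (P x)
  listing? _≟_ (xs , m) x with DecMem._∈?_ _≟_ x xs
  ... | yes p = yes (Equivalence.to (m x) p)
  ... | no ¬p = no (λ q → ¬p (Equivalence.from (m x) q))

  Listing⇒Card : DecidableEquality A → ∀ {P : A → Set} → Listing P → Σ ℕ (Card P)
  Listing⇒Card _≟_ (xs , m) = length (List.deduplicate _≟_ xs) , List.deduplicate _≟_ xs , ≡.refl , DecUnique.deduplicate-! _≟_ xs ,
    λ x → mk⇔ (λ p → Equivalence.to (m x) (∈ₚ.∈-deduplicate⁻ _≟_ xs p)) (λ q → ∈ₚ.∈-deduplicate⁺ _≟_ (Equivalence.from (m x) q))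

  Listing-filter : ∀ {P Q : A → Set} → (∀ x → Dec (Q x)) → Listing P → Listing (λ x → P x × Q x)
  Listing-filter Q? (xs , m) = List.filter Q? xs , λ x → mk⇔
    (λ p → Equivalence.to (m x) (proj₁ (∈ₚ.∈-filter⁻ Q? p)) , proj₂ (∈ₚ.∈-filter⁻ Q? {xs = xs} p))
    (λ { (p , q) → ∈ₚ.∈-filter⁺ Q? (Equivalence.from (m x) p) q })

  Listing-cong : ∀ {P Q : A → Set} → (∀ x → P x ⇔ Q x) → Listing P → Listing Q
  Listing-cong h (xs , m) = xs , λ x → mk⇔ (λ p → Equivalence.to (h x) (Equivalence.to (m x) p)) (λ q → Equivalence.from (m x) (Equivalence.from (h x) q))

  ∃-listing? : ∀ {P Q : A → Set} → Listing P → (∀ x → Dec (Q x)) → (Σ A λ x → P x × Q x) ⊎ (∀ x → P x → ¬ Q x)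
  ∃-listing? {P} {Q} (xs , m) Q? = go (Any.any? Q? xs)
    where
    go : Dec (Any Q xs) → _
    go (no ¬a) = inj₂ λ x p q → ¬a (lose (Equivalence.from (m x) p) q)
    go (yes a) with find a
    ... | x , x∈xs , q = inj₁ (x , Equivalence.to (m x) x∈xs , q)

  Card-image : ∀ {P Q : A → Set} (f g : A → A) → (∀ x → P x → Q (f x)) → (∀ y → Q y → P (g y)) →
               (∀ x → P x → g (f x) ≡ x) → (∀ y → Q y → f (g y) ≡ y) → ∀ {k} → Card P k → Card Q k
  Card-image {P} {Q} f g pf pg gf fg (xs , l , u , m) = List.map f xs , trans (Listₚ.length-map f xs) l , uniq xs u (λ x x∈ → Equivalence.to (m x) x∈) ,
      λ y → mk⇔ (λ y∈ → to y (∈ₚ.∈-map⁻ f y∈)) (λ q → subst (_∈ List.map f xs) (fg y q) (∈ₚ.∈-map⁺ f (Equivalence.from (m (g y)) (pg y q))))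
    where
    to : ∀ y → (∃ λ x → x ∈ xs × y ≡ f x) → Q y
    to y (x , x∈ , ≡.refl) = pf x (Equivalence.to (m x) x∈)
    uniq : ∀ zs → Unique zs → (∀ x → x ∈ zs → P x) → Unique (List.map f zs)
    uniq List.[] _ _ = []
    uniq (z List.∷ zs) (d ∷ u) p = All.tabulate (λ {y} y∈ e → dist y e (∈ₚ.∈-map⁻ f y∈)) ∷ uniq zs u (λ x x∈ → p x (there x∈))
      where
      dist : ∀ y → f z ≡ y → (∃ λ x → x ∈ zs × y ≡ f x) → ⊥
      dist y e (x , x∈ , e') = All.lookup d x∈ (trans (sym (gf z (p z (here ≡.refl)))) (trans (cong g (trans e e')) (gf x (p x (there x∈)))))

  Card-⋃ : ∀ {Z : Set} (Q : Z → A → Set) (f : Z → ℕ) (zs : List Z) → Unique zs → (∀ z → z ∈ zs → Card (Q z) (f z)) →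
           (∀ {z z' x} → z ∈ zs → z' ∈ zs → Q z x → Q z' x → z ≡ z') → Card (λ x → Σ Z λ z → z ∈ zs × Q z x) (ℕL.sum (List.map f zs))
  Card-⋃ Q f List.[] _ _ _ = List.[] , ≡.refl , [] , λ x → mk⇔ (λ ()) (λ { (_ , () , _) })
  Card-⋃ Q f (z List.∷ zs) (d ∷ u) card disj = join (card z (here ≡.refl)) (Card-⋃ Q f zs u (λ z z∈ → card z (there z∈)) (λ p q → disj (there p) (there q)))
    where
    join : Card (Q z) (f z) → Card (λ x → Σ _ λ z → z ∈ zs × Q z x) (ℕL.sum (List.map f zs)) → Card (λ x → Σ _ λ z' → z' ∈ (z List.∷ zs) × Q z' x) (f z ℕ.+ ℕL.sum (List.map f zs))
    join (xs , l , ux , m) (ys , l' , uy , m') = xs List.++ ys , trans (Listₚ.length-++ xs) (cong₂ ℕ._+_ l l') ,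
        Uniqueₚ.++⁺ ux uy (λ {x} p → apart x (Equivalence.to (m x) (proj₁ p)) (Equivalence.to (m' x) (proj₂ p))) ,
        λ x → mk⇔ (λ p → to x (∈ₚ.∈-++⁻ xs p)) (from x)
      where
      apart : ∀ x → Q z x → (Σ _ λ z' → z' ∈ zs × Q z' x) → ⊥
      apart x q (z' , z'∈ , q') = All.lookup d z'∈ (disj (here ≡.refl) (there z'∈) q q')
      to : ∀ x → x ∈ xs ⊎ x ∈ ys → Σ _ λ z' → z' ∈ (z List.∷ zs) × Q z' x
      to x (inj₁ p) = z , here ≡.refl , Equivalence.to (m x) p
      to x (inj₂ p) with Equivalence.to (m' x) p
      ... | z' , z'∈ , q = z' , there z'∈ , q
      from : ∀ x → (Σ _ λ z' → z' ∈ (z List.∷ zs) × Q z' x) → x ∈ (xs List.++ ys)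
      from x (.z , here ≡.refl , q) = ∈ₚ.∈-++⁺ˡ (Equivalence.from (m x) q)
      from x (z' , there z'∈ , q) = ∈ₚ.∈-++⁺ʳ xs (Equivalence.from (m' x) (z' , z'∈ , q))

sum-replicate : ∀ {Z : Set} c (zs : List Z) → ℕL.sum (List.map (λ _ → c) zs) ≡ c ℕ.* length zs
sum-replicate c List.[]       = sym (ℕₚ.*-zeroʳ c)
sum-replicate c (z List.∷ zs) = trans (cong (c ℕ.+_) (sum-replicate c zs)) (sym (ℕₚ.*-suc c (length zs)))

subwords : {A : Set} → List A → List (List A)
subwords List.[]       = List.[] List.∷ List.[]
subwords (a List.∷ as) = subwords as List.++ List.map (a List.∷_) (subwords as)

∈-subwords : {A : Set} (ws us : List A) → (us ∈ subwords ws) ⇔ (us ⊆ ws)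
∈-subwords ws us = mk⇔ (to ws us) from
  where
  to : ∀ ws us → us ∈ subwords ws → us ⊆ ws
  to List.[] us (here ≡.refl) = []
  to (a List.∷ as) us p with ∈ₚ.∈-++⁻ (subwords as) p
  ... | inj₁ q = a ∷ʳ to as us q
  ... | inj₂ q with ∈ₚ.∈-map⁻ (a List.∷_) q
  ...   | vs , r , ≡.refl = ≡.refl ∷ to as vs r
  from : ∀ {us ws} → us ⊆ ws → us ∈ subwords ws
  from [] = here ≡.refl
  from {ws = a List.∷ as} (_ ∷ʳ p) = ∈ₚ.∈-++⁺ˡ (from p)
  from {ws = a List.∷ as} (≡.refl ∷ p) = ∈ₚ.∈-++⁺ʳ (subwords as) (∈ₚ.∈-map⁺ (a List.∷_) (from p))

boundedVecs : ∀ {m} → Vec ℕ m → List (Vec ℕ m)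
boundedVecs []       = [] List.∷ List.[]
boundedVecs (b ∷ bs) = List.cartesianProductWith _∷_ (List.upTo (suc b)) (boundedVecs bs)

∈-boundedVecs : ∀ {m} (bs ks : Vec ℕ m) → (∀ s → lookup ks s ℕ.≤ lookup bs s) → ks ∈ boundedVecs bs
∈-boundedVecs []       []       h = here ≡.refl
∈-boundedVecs (b ∷ bs) (k ∷ ks) h = ∈ₚ.∈-cartesianProductWith⁺ _∷_ (∈ₚ.∈-upTo⁺ (ℕ.s≤s (h zero))) (∈-boundedVecs bs ks (λ s → h (suc s)))

_≟W_ : ∀ {n} → DecidableEquality (Wt n)
_≟W_ = Vecₚ.≡-dec ℤₚ._≟_

_≟E_ : ∀ {n} → DecidableEquality (Elt n)
_≟E_ = Prodₚ.≡-dec (Vecₚ.≡-dec Fin._≟_) (Vecₚ.≡-dec ℤₚ._≟_)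

-- `allFin 3` is a closed list, so `allZones (suc n)` computes to a cartesian product.
allZones-complete : ∀ n (i : Zone n) → i ∈ allZones n
allZones-complete zero    []      = here ≡.refl
allZones-complete (suc n) (f ∷ i) = ∈ₚ.∈-cartesianProductWith⁺ _∷_ (∈ₚ.∈-allFin f) (allZones-complete n i)

allZones-unique : ∀ n → Unique (allZones n)
allZones-unique zero    = All.[] ∷ []
allZones-unique (suc n) = Uniqueₚ.cartesianProductWith⁺ _∷_ Vecₚ.∷-injective (Uniqueₚ.allFin⁺ 3) (allZones-unique n)

-- Zones, and the finite set of dominant weights below a given one

module _ {n : ℕ} where

  dominant? : ∀ c → Dec (Dominant n c)
  dominant? c = Finₚ.all? (λ s → ℤₚ._≤?_ 0ℤ (lookup c s))

  zoneCond? : ∀ f z → Dec (zoneCond f z)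
  zoneCond? zero                     z = z ℤₚ.≟ + 0
  zoneCond? (suc zero)           z = z ℤₚ.≟ + 1
  zoneCond? (suc (suc zero)) z = ℤₚ._≤?_ (+ 2) z

  inZone? : ∀ i c → Dec (InZone n i c)
  inZone? i c = dominant? c ×-dec Finₚ.all? (λ s → zoneCond? (lookup i s) (lookup c s))

  zoneIndex : ∀ z → 0ℤ ≤ z → Σ (Fin 3) λ f → zoneCond f z
  zoneIndex (+ 0)             _ = zero , ≡.refl
  zoneIndex (+ 1)             _ = suc zero , ≡.refl
  zoneIndex (+ suc (suc k))   _ = suc (suc zero) , +≤+ (ℕ.s≤s (ℕ.s≤s ℕ.z≤n))

  zoneOf : ∀ c → Dominant n c → Σ (Zone n) λ i → InZone n i c
  zoneOf c dom = tabulate (λ s → proj₁ (zi s)) , dom , λ s → subst (λ f → zoneCond f (lookup c s)) (sym (Vecₚ.lookup∘tabulate (λ s → proj₁ (zi s)) s)) (proj₂ (zi s))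
    where
    zi : ∀ s → Σ (Fin 3) λ f → zoneCond f (lookup c s)
    zi s = zoneIndex (lookup c s) (dom s)

  zone-unique : ∀ {i j c} → InZone n i c → InZone n j c → i ≡ j
  zone-unique {i} {j} {c} (_ , p) (_ , q) = vec-ext {n} λ s → go (lookup i s) (lookup j s) (p s) (q s)
    where
    go : ∀ f g {z} → zoneCond f z → zoneCond g z → f ≡ g
    go zero zero _ _ = ≡.refl
    go zero (suc zero) ≡.refl ()
    go zero (suc (suc zero)) ≡.refl (+≤+ ())
    go (suc zero) zero ≡.refl ()
    go (suc zero) (suc zero) _ _ = ≡.refl
    go (suc zero) (suc (suc zero)) ≡.refl (+≤+ (ℕ.s≤s ()))
    go (suc (suc zero)) zero (+≤+ ()) ≡.refl
    go (suc (suc zero)) (suc zero) (+≤+ (ℕ.s≤s ())) ≡.refl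
    go (suc (suc zero)) (suc (suc zero)) _ _ = ≡.refl

  zoneRep : Zone n → Wt n
  zoneRep i = tabulate (λ s → + toℕ (lookup i s))

  zoneRep-InZone : ∀ i → InZone n i (zoneRep i)
  zoneRep-InZone i = (λ s → subst (0ℤ ≤_) (sym (lk s)) (+≤+ ℕ.z≤n)) , λ s → subst (zoneCond (lookup i s)) (sym (lk s)) (cond (lookup i s))
    where
    lk : ∀ s → lookup (zoneRep i) s ≡ + toℕ (lookup i s)
    lk = Vecₚ.lookup∘tabulate (λ s → + toℕ (lookup i s))
    cond : ∀ f → zoneCond f (+ toℕ f)
    cond zero                     = ≡.refl
    cond (suc zero)           = ≡.refl
    cond (suc (suc zero)) = ≤-refl

  scaled-dec : ∀ {c} → Dominant n c → Decreasing (scaled c)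
  scaled-dec {c} dom = decreasing (scaled c) λ s →
    subst (scaled c (suc s) ≤_) (sym (scaled-step c s)) (≤-trans (≤-reflexive (sym (+-identityʳ (scaled c (suc s)))))
      (+-monoʳ-≤ (scaled c (suc s)) (subst (_≤ N n * lookup c s) (*-zeroʳ (N n)) (N-mono {n} (dom s)))))

  -- The entries decrease and sum to 0: if the one at `t` is nonnegative, so are all before it;
  -- otherwise all after it are nonpositive and the partial sum is at least the total.
  partial-dominant : ∀ {c} → Dominant n c → ∀ t → 0ℤ ≤ partial (scaled c) t
  partial-dominant {c} dom t = go (≤-total 0ℤ (scaled c t))
    where
    go : _ → 0ℤ ≤ partial (scaled c) t
    go (inj₁ h) = sum-nonneg λ s → pt s (≤⊎>-Fin s t)
      where
      pt : ∀ s → _ → 0ℤ ≤ upTo t (scaled c) s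
      pt s (inj₁ p) = subst (0ℤ ≤_) (sym (upTo-≤ {t = t} {s} {scaled c} p)) (≤-trans h (scaled-dec {c} dom p))
      pt s (inj₂ p) = ≤-reflexive (sym (upTo-> {t = t} {s} {scaled c} p))
    go (inj₂ h) = subst (_≤ partial (scaled c) t) (scaled-sum c) (sum-mono λ s → pt s (≤⊎>-Fin s t))
      where
      pt : ∀ s → _ → scaled c s ≤ upTo t (scaled c) s
      pt s (inj₁ p) = ≤-reflexive (sym (upTo-≤ {t = t} {s} {scaled c} p))
      pt s (inj₂ p) = subst (scaled c s ≤_) (sym (upTo-> {t = t} {s} {scaled c} p)) (≤-trans (scaled-dec {c} dom (ℕₚ.<⇒≤ p)) h)

  Drop-≡ : ∀ {c c₁ c₂} (D₁ : Drop {n} c c₁) (D₂ : Drop c c₂) → (∀ t → κ D₁ t ≡ κ D₂ t) → c₁ ≡ c₂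
  Drop-≡ D₁ D₂ h = Drop-zero (Drop-sub D₁ D₂ (λ t → ≤-reflexive (h t))) (λ t → i≡j⇒i-j≡0 (sym (h t)))

  -- The partial sum for `c` is N κ plus that for `μ`, which is nonnegative. This bounds all
  -- coefficients and makes the set of dominant `μ` below `c` finite.
  κ≤partial : ∀ {c μ} (D : Drop {n} c μ) → Dominant n μ → ∀ t → κ D t ≤ partial (scaled c) t
  κ≤partial {c} {μ} D dom t = subst (κ D t ≤_) (sym (partial-scaled D t)) (Q≥k (partial (scaled μ) t) (κ D t) (partial-dominant {μ} dom t) (κ≥0 D t))
    where
    eq : ∀ q n k → q + (1ℤ + n) * k - k ≡ q + n * k - (0ℤ + n * 0ℤ)
    eq = solve-∀
    Q≥k : ∀ q k → 0ℤ ≤ q → 0ℤ ≤ k → k ≤ q + N n * k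
    Q≥k q k hq hk = lin (hq ⊕ *-monoˡ-≤-nonNeg (+ n) hk) (eq q (+ n) k)

  module _ (c : Wt n) where

    candidate : Vec ℕ n → Wt n
    candidate k = lower c (extend k)

    bounds : Vec ℕ n
    bounds = tabulate (λ s → ℤ.∣ partial (scaled c) (inject₁ s) ∣)

    candidate-Drop : ∀ k → Drop c (candidate k)
    candidate-Drop k = lower-Drop c (extend k) (extend≥0 k) (extend-last k)

    bounded : ∀ {μ} (p : μ ≼ c) → Dominant n μ → ∀ s → lookup (proj₁ p) s ℕ.≤ lookup bounds s
    bounded {μ} p dom s = subst (lookup (proj₁ p) s ℕ.≤_) (sym (Vecₚ.lookup∘tabulate (λ s → ℤ.∣ partial (scaled c) (inject₁ s) ∣) s)) (drop‿+≤+ fin)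
      where
      D = ≼⇒Drop {n} {c} {μ} p
      t = inject₁ s
      k≤P : κ D t ≤ partial (scaled c) t
      k≤P = κ≤partial D dom t
      fin : + lookup (proj₁ p) s ≤ + ℤ.∣ partial (scaled c) t ∣
      fin = subst₂ _≤_ (extend-inject₁ (proj₁ p) s) (sym (0≤i⇒+∣i∣≡i (≤-trans (κ≥0 D t) k≤P))) k≤P

    InJ⇒candidate : ∀ μ → InJ n c μ → μ ∈ List.map candidate (boundedVecs bounds)
    InJ⇒candidate μ (dom , p) = subst (_∈ List.map candidate (boundedVecs bounds)) (Drop-≡ (candidate-Drop (proj₁ p)) (≼⇒Drop {n} {c} {μ} p) (λ _ → ≡.refl))
                        (∈ₚ.∈-map⁺ candidate (∈-boundedVecs bounds (proj₁ p) (bounded {μ} p dom)))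

    candidate⇒InJ : ∀ μ → μ ∈ List.map candidate (boundedVecs bounds) → Dominant n μ → InJ n c μ
    candidate⇒InJ μ p dom = dom , go (∈ₚ.∈-map⁻ candidate p)
      where
      go : (∃ λ k → k ∈ boundedVecs bounds × μ ≡ candidate k) → μ ≼ c
      go (k , _ , e) = Drop⇒≼ (subst (Drop c) (sym e) (candidate-Drop k))

  abstract

    J-listing : ∀ c → Listing (InJ n c)
    J-listing c = List.filter dominant? xs , λ μ → mk⇔ (to μ) (from μ)
      where
      xs : List (Wt n)
      xs = List.map (candidate c) (boundedVecs (bounds c))
      to : ∀ μ → μ ∈ List.filter dominant? xs → InJ n c μ
      to μ p = candidate⇒InJ c μ (proj₁ (∈ₚ.∈-filter⁻ dominant? {xs = xs} p)) (proj₂ (∈ₚ.∈-filter⁻ dominant? {xs = xs} p))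
      from : ∀ μ → InJ n c μ → μ ∈ List.filter dominant? xs
      from μ j = ∈ₚ.∈-filter⁺ dominant? (InJ⇒candidate c μ j) (proj₁ j)

  J? : ∀ c μ → Dec (InJ n c μ)
  J? c = listing? _≟W_ (J-listing c)

  size : ∀ {c c'} → Drop {n} c c' → ℤ
  size D = sum (κ D)

  size-nonneg : ∀ {c c'} (D : Drop {n} c c') → 0ℤ ≤ size D
  size-nonneg D = sum-nonneg (κ≥0 D)

  size-pos : ∀ {c c'} (D : Drop {n} c c') → c ≢ c' → 1ℤ ≤ size D
  size-pos {c} {c'} D ne = go (≤⊎> (size D) 0ℤ)
    where
    go : _ → 1ℤ ≤ size D
    go (inj₂ h) = h
    go (inj₁ h) = ⊥-elim (ne (Drop-zero D (λ t → sym (sum-mono-≡ {f = λ _ → 0ℤ} {κ D} (κ≥0 D) (≤-trans h (≤-reflexive (sym (sum-0 (suc n))))) t))))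

  size-split : ∀ {c c₁ c₂} (D : Drop {n} c c₂) (D₁ : Drop c c₁) (D₂ : Drop c₁ c₂) → size D ≡ size D₁ + size D₂
  size-split D D₁ D₂ = trans (sum-≡ (κ-unique D (Drop-trans D₁ D₂))) (∑-distrib-+ (κ D₁) (κ D₂))

  -- As long as some dominant weight lies strictly between, it replaces `c'` and the coefficient sum
  -- of the drop decreases; when there is none, `c` covers the weight reached.
  findCover : ∀ {c c'} → Dominant n c → Dominant n c' → Drop c c' → c ≢ c' → Σ (Wt n) λ ρ → Covers n ρ c × Drop ρ c'
  findCover {c} {c'} dom dom' D ne = go ℤ.∣ size D ∣ c' dom' D ne (≤-reflexive (sym (0≤i⇒+∣i∣≡i (size-nonneg D)))) 
    where
    go : ∀ k c' → Dominant n c' → (D : Drop c c') → c ≢ c' → size D ≤ + k → Σ (Wt n) λ ρ → Covers n ρ c × Drop ρ c'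
    go zero c' dom' D ne b = ⊥-elim (1+a≰a {0ℤ} (≤-trans (size-pos D ne) b))
    go (suc k) c' dom' D ne b = step (∃-listing? (J-listing c) between?)
      where
      Between : Wt n → Set
      Between ρ = InJ n ρ c' × (ρ ≢ c' × ρ ≢ c)
      between? : ∀ ρ → Dec (Between ρ)
      between? ρ = J? ρ c' ×-dec (¬? (ρ ≟W c') ×-dec ¬? (ρ ≟W c))
      step : (Σ (Wt n) λ ρ → InJ n c ρ × Between ρ) ⊎ (∀ ρ → InJ n c ρ → ¬ Between ρ) → Σ (Wt n) λ ρ → Covers n ρ c × Drop ρ c'
      step (inj₁ (ρ , (domρ , ρ≼c) , (_ , c'≼ρ) , ρ≢c' , ρ≢c)) = lift (go k ρ domρ D₁ (λ e → ρ≢c (sym e)) (lin (b ⊕ size-pos D₂ ρ≢c') (eq (size D) (size D₁) (size D₂) (+ k) (size-split D D₁ D₂))))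
        where
        D₁ = ≼⇒Drop {n} {c} {ρ} ρ≼c
        D₂ = ≼⇒Drop {n} {ρ} {c'} c'≼ρ
        l : ∀ a b k → k - a ≡ 1ℤ + k + b - (a + b + 1ℤ)
        l = solve-∀
        eq : ∀ s a b k → s ≡ a + b → k - a ≡ 1ℤ + k + b - (s + 1ℤ)
        eq s a b k ≡.refl = l a b k
        lift : (Σ (Wt n) λ σ → Covers n σ c × Drop σ ρ) → Σ (Wt n) λ σ → Covers n σ c × Drop σ c'
        lift (σ , cov , D') = σ , cov , Drop-trans D' D₂
      step (inj₂ none) = c' , (dom' , Drop⇒≼ D , (λ e → ne (sym e)) , cov) , Drop-refl c'
        where
        cov : ∀ ν → Dominant n ν → c' ≼ ν → ν ≼ c → ν ≡ c' ⊎ ν ≡ c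
        cov ν domν p q = cs (ν ≟W c') (ν ≟W c)
          where
          cs : Dec (ν ≡ c') → Dec (ν ≡ c) → ν ≡ c' ⊎ ν ≡ c
          cs (yes e) _ = inj₁ e
          cs (no _) (yes e) = inj₂ e
          cs (no ne₁) (no ne₂) = ⊥-elim (none ν (domν , q) ((dom' , p) , ne₁ , ne₂))

-- Counting

module Count {n : ℕ} (1≤n : 1 ℕ.≤ n) (a : Elt n) (F : InF n a) where
  open Boxes 1≤n a F
  open Hat {n} {1≤n} {a} {F}

  abstract

    Mem-listing : ∀ c → Listing (Mem c)
    Mem-listing c = go (reduced-word 1≤n (θ c) (aff-θ c))
      where
      go : (Σ (List (Gen n)) λ ws → AscWord 1≤n ws × Reduced n ws (θ c)) → Listing (Mem c)
      go (ws , aw , ev , _) = List.map (evalWord n) (subwords ws) , λ x → mk⇔ (λ p → to x (∈ₚ.∈-map⁻ (evalWord n) p)) (λ m → from x (⊴⇒subword 1≤n ws aw x (aff m) (subst (λ y → val x ⊴ val y) (sym ev) (below m))))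
        where
        to : ∀ x → (∃ λ us → us ∈ subwords ws × x ≡ evalWord n us) → Mem c x
        to x (us , us∈ , e) = subst (Mem c) (sym e) (mem (isAff-word 1≤n us) (subst (λ y → val (evalWord n us) ⊴ val y) ev (subword⇒⊴ 1≤n (Equivalence.to (∈-subwords ws us) us∈) aw)))
        from : ∀ x → (Σ (List (Gen n)) λ us → us ⊆ ws × evalWord n us ≡ x) → x ∈ List.map (evalWord n) (subwords ws)
        from x (us , p , e) = subst (_∈ List.map (evalWord n) (subwords ws)) e (∈ₚ.∈-map⁺ (evalWord n) (Equivalence.from (∈-subwords ws us) p))

  Mem? : ∀ c x → Dec (Mem c x)
  Mem? c = listing? _≟E_ (Mem-listing c)

  Lower : Wt n → Elt n → Set
  Lower c x = Σ (Wt n) λ ν → InJ n c ν × (c ≢ ν × Mem ν x)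

  lower⊎minimal : ∀ {c x} → Mem c x → Lower c x ⊎ Minimal c x
  lower⊎minimal {c} {x} m = go (∃-listing? (J-listing c) Q?)
    where
    Q? : ∀ ν → Dec (c ≢ ν × Mem ν x)
    Q? ν = ¬? (c ≟W ν) ×-dec Mem? ν x
    go : Lower c x ⊎ (∀ ν → InJ n c ν → ¬ (c ≢ ν × Mem ν x)) → Lower c x ⊎ Minimal c x
    go (inj₁ l) = inj₁ l
    go (inj₂ h) = inj₂ (minimal m (λ c' dom' D ne mem' → h c' (dom' , Drop⇒≼ D) (ne , mem')))

  Minimal? : ∀ c x → Dec (Minimal c x)
  Minimal? c x = go (Mem? c x)
    where
    go' : Lower c x ⊎ Minimal c x → Dec (Minimal c x)
    go' (inj₂ m) = yes m
    go' (inj₁ (ν , (dom , p) , ne , mν)) = no λ m → least m ν dom (≼⇒Drop {n} {c} {ν} p) ne mν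
    go : Dec (Mem c x) → Dec (Minimal c x)
    go (no ¬m) = no λ m → ¬m (member m)
    go (yes m) = go' (lower⊎minimal m)

  abstract

    Minimal-card : ∀ c → Σ ℕ (Card (Minimal c))
    Minimal-card c = Listing⇒Card _≟E_ (Listing-cong (λ x → mk⇔ proj₂ (λ m → member m , m)) (Listing-filter (Minimal? c) (Mem-listing c)))

  Minimal⇒InPB : ∀ {c x} → Minimal c x → InPB n a c x
  Minimal⇒InPB {c} {x} m = Mem⇒InI (member m) , λ μ cov i → excl μ cov (InI⇒Mem i)
    where
    excl : ∀ μ → Covers n μ c → Mem μ x → ⊥
    excl μ (dom , p , ne , _) mμ = least m μ dom (≼⇒Drop {n} {c} {μ} p) (λ e → ne (sym e)) mμ

  -- A smaller weight whose I_a contains `x` lies below one covered by `c`, and I_a grows with the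
  -- weight.
  InPB⇒Minimal : ∀ {c x} → Dominant n c → InPB n a c x → Minimal c x
  InPB⇒Minimal {c} {x} dom (i , h) = minimal (InI⇒Mem i) λ c' dom' D ne m' → go c' dom' m' (findCover dom dom' D ne)
    where
    go : ∀ c' → Dominant n c' → Mem c' x → (Σ (Wt n) λ ρ → Covers n ρ c × Drop ρ c') → ⊥
    go c' dom' m' (ρ , cov , D) = h ρ cov (Mem⇒InI (Mem-up {ρ} {c'} {x} D (proj₁ cov) dom' m'))

  -- By `Mem-meet` the element belongs to the meet, and minimality identifies both weights with it.
  minimal-unique : ∀ {c μ μ' x} → Drop c μ → Drop c μ' → Dominant n μ → Dominant n μ' → Minimal μ x → Minimal μ' x → μ ≡ μ'
  minimal-unique {c} {μ} {μ'} {x} D D' dom dom' m m' = trans (same D m (λ t → i≤i⊔j (κ D t) (κ D' t))) (sym (same D' m' (λ t → i≤j⊔i (κ D t) (κ D' t))))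
    where
    ν = meet {n} {1≤n} {a} {F} D D'
    Dν : Drop c ν
    Dν = meet-Drop {n} {1≤n} {a} {F} D D'
    domν : Dominant n ν
    domν = meet-dominant {n} {1≤n} {a} {F} D D' dom dom'
    memν : Mem ν x
    memν = Mem-meet {n} {1≤n} {a} {F} {x = x} D D' dom dom' (member m) (member m')
    same : ∀ {ρ} (E : Drop c ρ) → Minimal ρ x → (∀ t → κ E t ≤ κ Dν t) → ρ ≡ ν
    same {ρ} E mρ h = go (ρ ≟W ν)
      where
      go : Dec (ρ ≡ ν) → ρ ≡ ν
      go (yes e) = e
      go (no ne) = ⊥-elim (least mρ ν domν (Drop-sub E Dν h) ne memν)

  -- Equal to N ⟨c,ρ⟩: nonnegative on dominant weights and strictly smaller on smaller ones, hence a
  -- measure for the descent in `findMinimal`.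
  volume : Wt n → ℤ
  volume c = sum (partial (scaled c))

  volume-drop : ∀ {c ν} (D : Drop c ν) → volume c ≡ volume ν + N n * size D
  volume-drop {c} {ν} D = trans (sum-≡ (partial-scaled D)) (trans (∑-distrib-+ (partial (scaled ν)) (λ t → N n * κ D t)) (cong (_+_ (volume ν)) (*-distribˡ-sum (N n) (κ D))))

  volume-nonneg : ∀ {c} → Dominant n c → 0ℤ ≤ volume c
  volume-nonneg {c} dom = sum-nonneg (partial-dominant {n} {c} dom)

  volume-< : ∀ {c ν} → Drop c ν → c ≢ ν → 1ℤ + volume ν ≤ volume c
  volume-< {c} {ν} D ne = subst (1ℤ + volume ν ≤_) (sym (volume-drop D)) (fin (volume ν) (size D) (size-pos D ne))
    where
    eq : ∀ v n s → v + (1ℤ + n) * s - (1ℤ + v) ≡ s + n * s - (1ℤ + n * 0ℤ)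
    eq = solve-∀
    fin : ∀ v s → 1ℤ ≤ s → 1ℤ + v ≤ v + N n * s
    fin v s h = lin (h ⊕ *-monoˡ-≤-nonNeg (+ n) (1+≤⇒≤ {0ℤ} h)) (eq v (+ n) s)

  findMinimal : ∀ {c x} → Dominant n c → Mem c x → Σ (Wt n) λ μ → (Dominant n μ × Drop c μ) × Minimal μ x
  findMinimal {c} {x} dom m = go ℤ.∣ volume c ∣ c dom m (≤-reflexive (sym (0≤i⇒+∣i∣≡i (volume-nonneg {c} dom))))
    where
    go : ∀ k c → Dominant n c → Mem c x → volume c ≤ + k → Σ (Wt n) λ μ → (Dominant n μ × Drop c μ) × Minimal μ x
    go k c dom m b = step k b (lower⊎minimal m)
      where
      step : ∀ k → volume c ≤ + k → Lower c x ⊎ Minimal c x → Σ (Wt n) λ μ → (Dominant n μ × Drop c μ) × Minimal μ x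
      step k b (inj₂ mm) = c , (dom , Drop-refl c) , mm
      step zero b (inj₁ (ν , (domν , p) , ne , mν)) = ⊥-elim (1+a≰a {volume ν} (≤-trans (volume-< (≼⇒Drop {n} {c} {ν} p) ne) (≤-trans b (volume-nonneg {ν} domν))))
      step (suc k) b (inj₁ (ν , (domν , p) , ne , mν)) = lift (go k ν domν mν (lin (≤-trans (volume-< D ne) b) (eq (volume ν) (+ k))))
        where
        D = ≼⇒Drop {n} {c} {ν} p
        eq : ∀ v k → k - v ≡ 1ℤ + k - (1ℤ + v)
        eq = solve-∀
        lift : (Σ (Wt n) λ μ → (Dominant n μ × Drop ν μ) × Minimal μ x) → Σ (Wt n) λ μ → (Dominant n μ × Drop c μ) × Minimal μ x
        lift (μ , (domμ , E) , mm) = μ , (domμ , Drop-trans D E) , mm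

  zoneCount : Zone n → ℕ
  zoneCount i = proj₁ (Minimal-card (zoneRep i))

  -- The maps `hat` from the representative to `μ` and back are mutually inverse.
  zone-card : ∀ i μ → InZone n i μ → Card (Minimal μ) (zoneCount i)
  zone-card i μ z = Card-image {P = Minimal ρ} {Minimal μ} (hat ρ μ) (hat μ ρ)
      (λ x m → hat-Minimal ρ μ {x} domρ domμ sm m) (λ y m → hat-Minimal μ ρ {y} domμ domρ sm' m)
      (λ x m → hat-hat ρ μ {x} domρ sm m) (λ y m → hat-hat μ ρ {y} domμ sm' m) (proj₂ (Minimal-card ρ))
    where
    ρ = zoneRep i
    domρ : Dominant n ρ
    domρ = proj₁ (zoneRep-InZone i)
    domμ : Dominant n μ
    domμ = proj₁ z
    sm : Same ρ μ
    sm = zone⇒Same {n} {i} {ρ} {μ} (zoneRep-InZone i) z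
    sm' : Same μ ρ
    sm' = zone⇒Same {n} {i} {μ} {ρ} z (zoneRep-InZone i)

  InPB-card : ∀ i μ → InZone n i μ → Card (InPB n a μ) (zoneCount i)
  InPB-card i μ z = Card-cong (λ x → mk⇔ Minimal⇒InPB (InPB⇒Minimal {μ} {x} (proj₁ z))) (zone-card i μ z)

  module _ (c : Wt n) (dom : Dominant n c) where

    zoneSlice : ∀ i → Σ ℕ (Card (λ μ → InJ n c μ × InZone n i μ))
    zoneSlice i = Listing⇒Card _≟W_ (Listing-filter (inZone? i) (J-listing c))

    Piece : Zone n → Elt n → Set
    Piece i x = Σ (Wt n) λ μ → (InJ n c μ × InZone n i μ) × Minimal μ x

    pieces-agree : ∀ {μ μ' x} → InJ n c μ → InJ n c μ' → Minimal μ x → Minimal μ' x → μ ≡ μ'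
    pieces-agree {μ} {μ'} {x} (dμ , p) (dμ' , p') = minimal-unique {c} {μ} {μ'} {x} (≼⇒Drop {n} {c} {μ} p) (≼⇒Drop {n} {c} {μ'} p') dμ dμ'

    Piece-card : ∀ i → Card (Piece i) (zoneCount i ℕ.* proj₁ (zoneSlice i))
    Piece-card i = go (proj₂ (zoneSlice i))
      where
      go : ∀ {k} → Card (λ μ → InJ n c μ × InZone n i μ) k → Card (Piece i) (zoneCount i ℕ.* k)
      go (μs , l , u , m) = Card-≡ (trans (sum-replicate (zoneCount i) μs) (cong (zoneCount i ℕ.*_) l))
        (Card-cong (λ x → mk⇔ (λ { (μ , μ∈ , q) → μ , Equivalence.to (m μ) μ∈ , q }) (λ { (μ , p , q) → μ , Equivalence.from (m μ) p , q }))
          (Card-⋃ (λ μ → Minimal μ) (λ _ → zoneCount i) μs u (λ μ μ∈ → zone-card i μ (proj₂ (Equivalence.to (m μ) μ∈)))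
            (λ {μ} {μ'} μ∈ μ'∈ q q' → pieces-agree (proj₁ (Equivalence.to (m μ) μ∈)) (proj₁ (Equivalence.to (m μ') μ'∈)) q q')))

    InI-card : Card (InI n a c) (zoneSum n zoneCount (λ i → proj₁ (zoneSlice i)))
    InI-card = Card-cong (λ x → mk⇔ (to x) (from x))
        (Card-⋃ Piece (λ i → zoneCount i ℕ.* proj₁ (zoneSlice i)) (allZones n) (allZones-unique n) (λ i _ → Piece-card i) disjoint)
      where
      disjoint : ∀ {i j x} → i ∈ allZones n → j ∈ allZones n → Piece i x → Piece j x → i ≡ j
      disjoint {i} {j} _ _ (μ , (p , z) , q) (μ' , (p' , z') , q') = zone-unique {n} {i} {j} {μ} z (subst (InZone n j) (sym (pieces-agree p p' q q')) z')
      to : ∀ x → (Σ (Zone n) λ i → i ∈ allZones n × Piece i x) → InI n a c x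
      to x (i , _ , μ , ((dμ , p) , _) , q) = Mem⇒InI (Mem-up {c} {μ} {x} (≼⇒Drop {n} {c} {μ} p) dom dμ (member q))
      from : ∀ x → InI n a c x → Σ (Zone n) λ i → i ∈ allZones n × Piece i x
      from x i = locate (findMinimal dom (InI⇒Mem i))
        where
        locate : (Σ (Wt n) λ μ → (Dominant n μ × Drop c μ) × Minimal μ x) → Σ (Zone n) λ i → i ∈ allZones n × Piece i x
        locate (μ , (dμ , D) , q) = proj₁ (zoneOf μ dμ) , allZones-complete n (proj₁ (zoneOf μ dμ)) , μ , ((dμ , Drop⇒≼ D) , proj₂ (zoneOf μ dμ)) , q

theoremC : (n : ℕ) → 1 ℕ.≤ n → (a : Elt n) → InF n a →
    Σ (Zone n → ℕ) λ c →
      (∀ i μ → InZone n i μ → Card (InPB n a μ) (c i)) ×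
      (∀ lam → Dominant n lam →
        Σ (Zone n → ℕ) λ m →
          (∀ i → Card (λ μ → InJ n lam μ × InZone n i μ) (m i)) ×
          Card (InI n a lam) (zoneSum n c m))
theoremC n 1≤n a F = zoneCount , InPB-card , λ lam dom →
    (λ i → proj₁ (zoneSlice lam dom i)) , (λ i → proj₂ (zoneSlice lam dom i)) , InI-card lam dom
  where open Count 1≤n a F
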